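{- (a) $\chi_2([2,1,1])\le P_2(2,1,1;10,10,2)=5$. (b) For all positive integers $a,b$, $\chi_2([a,b,1])\le 8$. (c) For all positive integers $a,b,c$ with both $a$ and $b$ odd, $\chi_2([a,b,c])\le 8$. (d) For all positive integers $a,b,c$, $\chi_2([a,b,c])\le 16$.
   Context: For positive integers $p,q,r$ let $\mathcal{CC}_1([p,q,r])=\{[x,x+p]\times[y,y+q]\times[z,z+r]: x,y,z\in\mathbb{Z}\}$ and $\mathcal{CC}_2([a,b,c])=\mathcal{CC}_1([a,b,c])\cup\mathcal{CC}_1([b,a,c])$. Two cuboids touch if their interiors are disjoint and their intersection is a non-degenerate two-dimensional rectangle. A configuration is a finite subset of $\mathcal{CC}_2([a,b,c])$ with pairwise disjoint interiors; its contact graph has the cuboids as vertices and edges between touching cuboids; $\chi_2([a,b,c])$ is the maximum chromatic number of such contact graphs. For positive integers $X,Y,Z$, $P_2(a,b,c;X,Y,Z)$ is the least $n$ for which there is a coloring $\kappa$ assigning a color in $\{1,\dots,n\}$ to every cuboid of $\mathcal{CC}_2([a,b,c])$ (determined by its root $(x,y,z)$, the minimal corner, and its orientation), invariant under translation by $(X,0,0)$, $(0,Y,0)$ and $(0,0,Z)$, such that any two touching cuboids of $\mathcal{CC}_2([a,b,c])$ receive different colors; it is $\infty$ if no such coloring exists. -}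

module Defs where

open import Data.Nat as ℕ using (ℕ)
open import Data.Integer using (ℤ; +_; _+_; _≤_; _<_)
open import Data.Fin using (Fin)
open import Data.Product using (Σ; ∃; _×_; _,_)
open import Data.Sum using (_⊎_)
open import Relation.Nullary using (¬_)
open import Relation.Binary.PropositionalEquality using (_≡_; _≢_)

data Axis : Set where
  ax-x ax-y ax-z : Axis

record Box : Set where
  constructor mkBox
  field
    lo  : Axis → ℤ
    len : Axis → ℕ

open Box public

hi : Box → Axis → ℤ
hi B ax = lo B ax + + (len B ax)

InteriorDisjoint : Box → Box → Set
InteriorDisjoint A B = ∃ λ ax → (hi A ax ≤ lo B ax) ⊎ (hi B ax ≤ lo A ax)

PosOverlap : Box → Box → Axis → Set
PosOverlap A B ax = (lo A ax < hi B ax) × (lo B ax < hi A ax)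

-- The intersection is a non-degenerate 2-dimensional rectangle: along one
-- axis the intervals meet in a single point, along the other two they
-- overlap with positive length.
FaceContact : Box → Box → Set
FaceContact A B = ∃ λ ax → ((hi A ax ≡ lo B ax) ⊎ (hi B ax ≡ lo A ax))
                           × (∀ ax' → ax' ≢ ax → PosOverlap A B ax')

Touch : Box → Box → Set
Touch A B = InteriorDisjoint A B × FaceContact A B

data Orient : Set where
  o₁ o₂ : Orient

Root : Set
Root = ℤ × ℤ × ℤ

cub : ℕ → ℕ → ℕ → Root → Orient → Box
cub a b c (x , y , z) o = mkBox lo' (len' o)
  where
    lo' : Axis → ℤ
    lo' ax-x = x
    lo' ax-y = y
    lo' ax-z = z
    len' : Orient → Axis → ℕ
    len' o₁ ax-x = a
    len' o₁ ax-y = b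
    len' o₂ ax-x = b
    len' o₂ ax-y = a
    len' _  ax-z = c

IsConfiguration : ℕ → ℕ → ℕ → (n : ℕ) → (Fin n → Root × Orient) → Set
IsConfiguration a b c n cfg =
  ∀ i j → i ≢ j →
    InteriorDisjoint (cub a b c (Σ.proj₁ (cfg i)) (Σ.proj₂ (cfg i)))
                     (cub a b c (Σ.proj₁ (cfg j)) (Σ.proj₂ (cfg j)))

ChiLe : ℕ → ℕ → ℕ → ℕ → Set
ChiLe a b c k =
  ∀ n (cfg : Fin n → Root × Orient) → IsConfiguration a b c n cfg →
    ∃ λ (col : Fin n → Fin k) → ∀ i j →
      Touch (cub a b c (Σ.proj₁ (cfg i)) (Σ.proj₂ (cfg i)))
            (cub a b c (Σ.proj₁ (cfg j)) (Σ.proj₂ (cfg j))) →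
      col i ≢ col j

record PeriodicColoring (a b c X Y Z n : ℕ) : Set where
  field
    κ      : Root → Orient → Fin n
    perX   : ∀ x y z o → κ (x + + X , y , z) o ≡ κ (x , y , z) o
    perY   : ∀ x y z o → κ (x , y + + Y , z) o ≡ κ (x , y , z) o
    perZ   : ∀ x y z o → κ (x , y , z + + Z) o ≡ κ (x , y , z) o
    proper : ∀ r o r' o' → Touch (cub a b c r o) (cub a b c r' o') →
             κ r o ≢ κ r' o'

P2Is : ℕ → ℕ → ℕ → ℕ → ℕ → ℕ → ℕ → Set
P2Is a b c X Y Z m =
  PeriodicColoring a b c X Y Z m ×
  (∀ n → n ℕ.< m → ¬ PeriodicColoring a b c X Y Z n)

{-# OPTIONS --safe #-}
module Submission where

-- A cuboid of one orientation is coloured by the parities of ⌊x/p⌋, ⌊y/q⌋ and ⌊z/r⌋, as a contact moves one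
-- of the coordinates by exactly the side length; for odd a and b the parities of x and y serve both
-- orientations.  For [2,1,1] the colour is read off from x + 7y + 5z mod 10, and eleven bricks force a fifth
-- colour.
--
-- For c = 1 the layers alternate between two palettes of four colours, and no general four colour theorem is
-- needed: a packing of a×b and b×a rectangles with a ≥ b always contains a rectangle with at most four
-- neighbours, so Kempe's argument applies.  To find it, call a vertical (b×a) rectangle harmless if its only
-- left neighbours are vertical and higher, and a horizontal one if its only lower neighbours are horizontal
-- and further right.  A neighbour violating this has a smaller x + y, so a region closed under passing to
-- such neighbours is empty as soon as it contains no harmless rectangle.  A suitable extremal harmless
-- rectangle, vertical say, thus has no horizontal rectangle below its top and left of its right side, and
-- no vertical one starting lower and near it; then either it has at most two right neighbours and two more
-- on the left and on top, or the lowest horizontal rectangle flush with its right side has at most four.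
-- In Kempe's argument two crossing chains through such a rectangle are excluded by a parity count on cells.

open import Defs
open import Data.Bool using (Bool; true; false; T; not; _∧_; _∨_; _xor_; if_then_else_)
open import Data.Bool.Properties using (T-∧; T-∨; xor-comm; xor-assoc; xor-same; xor-identityʳ)
open import Data.Empty using (⊥; ⊥-elim)
open import Data.Fin as Fin using (Fin; zero; suc; combine)
open import Data.Fin.Patterns
import Data.Fin.Properties as Finₚ
import Data.Integer.Properties as ℤₚ
open import Algebra.Properties.CommutativeSemigroup ℤₚ.+-commutativeSemigroup using (interchange; x∙yz≈y∙xz)
import Algebra.Properties.CommutativeSemigroup ℤₚ.*-commutativeSemigroup as ×
open import Data.List using (List; []; _∷_; length; map; filter; allFin)
open import Data.List.Membership.Propositional using (_∈_; find; lose)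
open import Data.List.Membership.Propositional.Properties using (∈-map⁺; ∈-map⁻; ∈-filter⁺; ∈-filter⁻; ∈-allFin)
import Data.List.Properties as Listₚ
open import Data.List.Relation.Unary.All as All using (All; []; _∷_; all?)
open import Data.List.Relation.Unary.Any as Any using (Any; here; there)
open import Data.Nat as ℕ using (ℕ; zero; suc; NonZero; _/_; _%_; z≤n; s≤s)
import Data.Nat.DivMod as DivMod
import Data.Nat.Properties as ℕₚ
open import Data.Product using (_×_; _,_; proj₁; proj₂; ∃; ∃₂; swap)
open import Data.Sum using (_⊎_; inj₁; inj₂)
open import Data.Unit using (tt)
open import Data.Vec as Vec using (Vec; []; _∷_; lookup)
import Data.Vec.Properties as Vecₚ
open import Function using (_∘_; id; Equivalence)
open import Relation.Binary.Definitions using (DecidableEquality; tri<; tri≈; tri>)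
open import Relation.Binary.PropositionalEquality
open import Relation.Nullary using (¬_; yes; no; Dec; does; _→-dec_)
open import Relation.Nullary.Decidable using (_×-dec_; _⊎-dec_; ¬?; map′; toWitness; True; ⌊_⌋; dec-true; dec-false)
open import Relation.Unary using (Decidable)

-- Planarity alone promises only a vertex with at most five neighbours, and Kempe's argument fails
-- at five; so the geometry has to supply a rectangle with four. That takes many small facts, each
-- about a handful of rectangles. Once orientations are fixed, such a fact is a statement about
-- linear inequalities between corners, so none of them is argued by hand: a verified elimination
-- procedure refutes the negation for every choice of orientations and disjuncts, by evaluation.
-- This is why regions, slots and crossing patterns are written as formulas of a small language.
-- What remains outside the language is the choice of extremal rectangles from the whole packing.
-- The other obstacle is topological. Contacts have positive length, so a chain of touching
-- rectangles carries a walk through adjacent cells of a refined grid, and for such walks the needed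
-- fragment of the Jordan curve theorem is a computation modulo 2.

-- Fourier-Motzkin elimination for linear inequalities

module FourierMotzkin where

  open import Data.Integer using (ℤ; +_; -[1+_]; 0ℤ; _+_; _*_; _≤_; -_)

  Form : Set
  Form = ℤ × List ℤ

  -- A short coefficient list counts as padded by zeros, so a constant or a single coordinate needs
  -- no vector of full length.
  dot : List ℤ → List ℤ → ℤ
  dot []       _        = 0ℤ
  dot (_ ∷ _)  []       = 0ℤ
  dot (c ∷ cs) (v ∷ vs) = c * v + dot cs vs

  eval : List ℤ → Form → ℤ
  eval ρ (k , cs) = k + dot cs ρ

  addL : List ℤ → List ℤ → List ℤ
  addL []       ds       = ds
  addL (c ∷ cs) []       = c ∷ cs
  addL (c ∷ cs) (d ∷ ds) = c + d ∷ addL cs ds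

  scaleL : ℤ → List ℤ → List ℤ
  scaleL k []       = []
  scaleL k (c ∷ cs) = k * c ∷ scaleL k cs

  dot-add : ∀ cs ds ρ → dot (addL cs ds) ρ ≡ dot cs ρ + dot ds ρ
  dot-add []       ds       ρ       = sym (ℤₚ.+-identityˡ (dot ds ρ))
  dot-add (c ∷ cs) []       ρ       = sym (ℤₚ.+-identityʳ (dot (c ∷ cs) ρ))
  dot-add (c ∷ cs) (d ∷ ds) []      = refl
  dot-add (c ∷ cs) (d ∷ ds) (v ∷ ρ) =
    trans (cong (λ u → (c + d) * v + u) (dot-add cs ds ρ)) (lem c d v (dot cs ρ) (dot ds ρ))
    where
    lem : ∀ c d v p q → (c + d) * v + (p + q) ≡ (c * v + p) + (d * v + q)
    lem c d v p q = trans (cong (λ u → u + (p + q)) (ℤₚ.*-distribʳ-+ v c d)) (interchange (c * v) (d * v) p q)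

  dot-scale : ∀ k cs ρ → dot (scaleL k cs) ρ ≡ k * dot cs ρ
  dot-scale k []       ρ       = sym (ℤₚ.*-zeroʳ k)
  dot-scale k (c ∷ cs) []      = sym (ℤₚ.*-zeroʳ k)
  dot-scale k (c ∷ cs) (v ∷ ρ) =
    trans (cong (λ u → k * c * v + u) (dot-scale k cs ρ)) (lem k c v (dot cs ρ))
    where
    lem : ∀ k c v p → k * c * v + k * p ≡ k * (c * v + p)
    lem k c v p = trans (cong (λ u → u + k * p) (ℤₚ.*-assoc k c v)) (sym (ℤₚ.*-distribˡ-+ k (c * v) p))

  addF : Form → Form → Form
  addF (k , cs) (l , ds) = k + l , addL cs ds

  scaleF : ℤ → Form → Form
  scaleF k (l , cs) = k * l , scaleL k cs

  eval-add : ∀ f g ρ → eval ρ (addF f g) ≡ eval ρ f + eval ρ g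
  eval-add (k , cs) (l , ds) ρ =
    trans (cong (λ u → k + l + u) (dot-add cs ds ρ)) (lem k l (dot cs ρ) (dot ds ρ))
    where
    lem : ∀ k l p q → k + l + (p + q) ≡ (k + p) + (l + q)
    lem k l p q = interchange k l p q

  eval-scale : ∀ k f ρ → eval ρ (scaleF k f) ≡ k * eval ρ f
  eval-scale k (l , cs) ρ =
    trans (cong (λ u → k * l + u) (dot-scale k cs ρ)) (sym (ℤₚ.*-distribˡ-+ k l (dot cs ρ)))

  Holds : List ℤ → Form → Set
  Holds ρ f = 0ℤ ≤ eval ρ f

  -- An entry `(h , f)` of `pos` or `neg` stands for leading coefficient 1 + h or -(1 + h), with `f`
  -- the form without that variable.
  record Split : Set where
    constructor split
    field
      zeros     : List Form
      pos neg   : List (ℕ × Form)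

  classify : List Form → Split
  classify [] = split [] [] []
  classify ((k , [])              ∷ fs) = let split z p n = classify fs in split ((k , []) ∷ z) p n
  classify ((k , + zero ∷ cs)     ∷ fs) = let split z p n = classify fs in split ((k , cs) ∷ z) p n
  classify ((k , + suc h ∷ cs)    ∷ fs) = let split z p n = classify fs in split z ((h , k , cs) ∷ p) n
  classify ((k , -[1+ h ] ∷ cs)   ∷ fs) = let split z p n = classify fs in split z p ((h , k , cs) ∷ n)

  resolvent : ℕ × Form → ℕ × Form → Form
  resolvent (h , f) (h′ , g) = addF (scaleF (+ suc h′) f) (scaleF (+ suc h) g)

  resolvents : ℕ × Form → List (ℕ × Form) → List Form → List Form
  resolvents p []       fs = fs
  resolvents p (n ∷ ns) fs = resolvent p n ∷ resolvents p ns fs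

  products : List (ℕ × Form) → List (ℕ × Form) → List Form → List Form
  products []       ns fs = fs
  products (p ∷ ps) ns fs = resolvents p ns (products ps ns fs)

  isNeg : ℤ → Bool
  isNeg (+ _)    = false
  isNeg -[1+ _ ] = true

  isZero : ℤ → Bool
  isZero (+ zero) = true
  isZero _        = false

  constant : List ℤ → Bool
  constant []       = true
  constant (c ∷ cs) = isZero c ∧ constant cs

  negative trivial : Form → Bool
  negative (k , cs) = isNeg k ∧ constant cs
  trivial  (k , cs) = not (isNeg k) ∧ constant cs

  anyNegative : List Form → Bool
  anyNegative []       = false
  anyNegative (f ∷ fs) = negative f ∨ anyNegative fs

  prune : List Form → List Form
  prune []       = []
  prune (f ∷ fs) = if trivial f then prune fs else f ∷ prune fs

  eliminate : List Form → List Form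
  eliminate fs = let split z p n = classify fs in prune (products p n z)

  -- The number counts the variables still present. A negative constant is looked for before every
  -- elimination, so many systems close early. Only soundness is proved: a wrong `false` would
  -- merely leave a fact unproved.
  infeasible : ℕ → List Form → Bool
  infeasible zero    fs = anyNegative fs
  infeasible (suc n) fs = anyNegative fs ∨ infeasible n (eliminate fs)

  PosHolds NegHolds : ℤ → List ℤ → ℕ × Form → Set
  PosHolds v ρ (h , f) = 0ℤ ≤ + suc h * v + eval ρ f
  NegHolds v ρ (h , f) = 0ℤ ≤ -[1+ h ] * v + eval ρ f

  module _ (v : ℤ) (ρ : List ℤ) where

    classify-sound : ∀ fs → All (Holds (v ∷ ρ)) fs →
      let split z p n = classify fs in
      All (Holds ρ) z × All (PosHolds v ρ) p × All (NegHolds v ρ) n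
    classify-sound [] [] = [] , [] , []
    classify-sound ((k , []) ∷ fs) (q ∷ qs) =
      let z , p , n = classify-sound fs qs in q ∷ z , p , n
    classify-sound ((k , + zero ∷ cs) ∷ fs) (q ∷ qs) =
      let z , p , n = classify-sound fs qs in
      subst (0ℤ ≤_) (cong (λ u → k + u) (ℤₚ.+-identityˡ (dot cs ρ))) q ∷ z , p , n
    classify-sound ((k , + suc h ∷ cs) ∷ fs) (q ∷ qs) =
      let z , p , n = classify-sound fs qs in
      z , subst (0ℤ ≤_) (x∙yz≈y∙xz k (+ suc h * v) (dot cs ρ)) q ∷ p , n
    classify-sound ((k , -[1+ h ] ∷ cs) ∷ fs) (q ∷ qs) =
      let z , p , n = classify-sound fs qs in
      z , p , subst (0ℤ ≤_) (x∙yz≈y∙xz k (-[1+ h ] * v) (dot cs ρ)) q ∷ n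

    resolvent-sound : ∀ p n → PosHolds v ρ p → NegHolds v ρ n → Holds ρ (resolvent p n)
    resolvent-sound (h , f) (h′ , g) P N = subst (0ℤ ≤_) eq (ℤₚ.+-mono-≤ P′ N′)
      where
      P′ : 0ℤ ≤ + suc h′ * (+ suc h * v + eval ρ f)
      P′ = subst (_≤ + suc h′ * (+ suc h * v + eval ρ f)) (ℤₚ.*-zeroʳ (+ suc h′)) (ℤₚ.*-monoˡ-≤-nonNeg (+ suc h′) {0ℤ} {+ suc h * v + eval ρ f} P)
      N′ : 0ℤ ≤ + suc h * (-[1+ h′ ] * v + eval ρ g)
      N′ = subst (_≤ + suc h * (-[1+ h′ ] * v + eval ρ g)) (ℤₚ.*-zeroʳ (+ suc h)) (ℤₚ.*-monoˡ-≤-nonNeg (+ suc h) {0ℤ} { -[1+ h′ ] * v + eval ρ g} N)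
      lem : ∀ s t v f g → t * (s * v + f) + s * (- t * v + g) ≡ t * f + s * g
      lem s t v f g = begin
        t * (s * v + f) + s * (- t * v + g)
          ≡⟨ cong₂ _+_ (ℤₚ.*-distribˡ-+ t (s * v) f) (ℤₚ.*-distribˡ-+ s (- t * v) g) ⟩
        t * (s * v) + t * f + (s * (- t * v) + s * g)
          ≡⟨ interchange (t * (s * v)) (t * f) (s * (- t * v)) (s * g) ⟩
        t * (s * v) + s * (- t * v) + (t * f + s * g)
          ≡⟨ cong (λ u → t * (s * v) + u + (t * f + s * g))
                  (trans (×.x∙yz≈y∙xz s (- t) v) (sym (ℤₚ.neg-distribˡ-* t (s * v)))) ⟩
        t * (s * v) + - (t * (s * v)) + (t * f + s * g)
          ≡⟨ cong (λ u → u + (t * f + s * g)) (ℤₚ.+-inverseʳ (t * (s * v))) ⟩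
        0ℤ + (t * f + s * g)
          ≡⟨ ℤₚ.+-identityˡ (t * f + s * g) ⟩
        t * f + s * g ∎
        where open ≡-Reasoning
      eq : + suc h′ * (+ suc h * v + eval ρ f) + + suc h * (-[1+ h′ ] * v + eval ρ g)
           ≡ eval ρ (resolvent (h , f) (h′ , g))
      eq = trans (lem (+ suc h) (+ suc h′) v (eval ρ f) (eval ρ g))
                 (sym (trans (eval-add (scaleF (+ suc h′) f) (scaleF (+ suc h) g) ρ)
                             (cong₂ _+_ (eval-scale (+ suc h′) f ρ) (eval-scale (+ suc h) g ρ))))

    resolvents-sound : ∀ p ns fs → PosHolds v ρ p → All (NegHolds v ρ) ns →
                       All (Holds ρ) fs → All (Holds ρ) (resolvents p ns fs)
    resolvents-sound p []       fs P []       F = F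
    resolvents-sound p (n ∷ ns) fs P (N ∷ Ns) F =
      resolvent-sound p n P N ∷ resolvents-sound p ns fs P Ns F

    products-sound : ∀ ps ns fs → All (PosHolds v ρ) ps → All (NegHolds v ρ) ns →
                     All (Holds ρ) fs → All (Holds ρ) (products ps ns fs)
    products-sound []       ns fs []       Ns F = F
    products-sound (p ∷ ps) ns fs (P ∷ Ps) Ns F =
      resolvents-sound p ns _ P Ns (products-sound ps ns fs Ps Ns F)

  prune-sound : ∀ ρ fs → All (Holds ρ) fs → All (Holds ρ) (prune fs)
  prune-sound ρ [] [] = []
  prune-sound ρ (f ∷ fs) (q ∷ qs) with trivial f
  ... | true  = prune-sound ρ fs qs
  ... | false = q ∷ prune-sound ρ fs qs

  constant-sound : ∀ ρ cs → T (constant cs) → dot cs ρ ≡ 0ℤ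
  constant-sound ρ       []            t = refl
  constant-sound []      (c ∷ cs)      t = refl
  constant-sound (v ∷ ρ) (+ zero ∷ cs) t = trans (ℤₚ.+-identityˡ (dot cs ρ)) (constant-sound ρ cs t)

  negative-sound : ∀ ρ f → T (negative f) → Holds ρ f → ⊥
  negative-sound ρ (-[1+ k ] , cs) t q
    with () ← subst (0ℤ ≤_) (cong (λ u → -[1+ k ] + u) (constant-sound ρ cs t)) q

  anyNegative-sound : ∀ ρ fs → T (anyNegative fs) → All (Holds ρ) fs → ⊥
  anyNegative-sound ρ (f ∷ fs) t (q ∷ qs) with Equivalence.to T-∨ t
  ... | inj₁ t′ = negative-sound ρ f t′ q
  ... | inj₂ t′ = anyNegative-sound ρ fs t′ qs

  infeasible-sound : ∀ ρ fs → T (infeasible (length ρ) fs) → All (Holds ρ) fs → ⊥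
  infeasible-sound []      fs t qs = anyNegative-sound [] fs t qs
  infeasible-sound (v ∷ ρ) fs t qs with Equivalence.to T-∨ t
  ... | inj₁ t′ = anyNegative-sound (v ∷ ρ) fs t′ qs
  ... | inj₂ t′ =
    let z , p , m = classify-sound v ρ fs qs in
    infeasible-sound ρ _ t′ (prune-sound ρ _ (products-sound v ρ _ _ _ p m z))

open FourierMotzkin

-- A decision procedure for formulas about rectangles

module Formulas where

  open import Data.Integer using (ℤ; +_; 0ℤ; 1ℤ; -1ℤ; _+_; _*_; _-_; _≤_; _<_; -_)

  infixl 7 _⊕_
  infix  6 _≤ᶠ_ _<ᶠ_ _≡ᶠ_
  infixr 3 _∧ᶠ_
  infixr 2 _∨ᶠ_

  -- Formulas about n rectangles with sides 𝐚 ≥ 𝐛: X i, Y i and X⁺ i, Y⁺ i are the lower and upper corner of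
  -- the i-th one, and o₁ is the orientation with the long side along the x-axis.
  data Term (n : ℕ) : Set where
    X Y X⁺ Y⁺ : Fin n → Term n
    𝐚 𝐛       : Term n
    ♯_        : ℤ → Term n
    _⊕_       : Term n → Term n → Term n

  data Formula (n : ℕ) : Set where
    _≤ᶠ_ _<ᶠ_ _≡ᶠ_ : Term n → Term n → Formula n
    is            : Orient → Fin n → Formula n
    _∧ᶠ_ _∨ᶠ_     : Formula n → Formula n → Formula n

  flip : Orient → Orient
  flip o₁ = o₂
  flip o₂ = o₁

  neg : ∀ {n} → Formula n → Formula n
  neg (s ≤ᶠ t) = t <ᶠ s
  neg (s <ᶠ t) = t ≤ᶠ s
  neg (s ≡ᶠ t) = s <ᶠ t ∨ᶠ t <ᶠ s
  neg (is o i) = is (flip o) i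
  neg (f ∧ᶠ g) = neg f ∨ᶠ neg g
  neg (f ∨ᶠ g) = neg f ∧ᶠ neg g

  xL yL : ∀ {n} → Fin n → List ℤ
  xL zero    = 1ℤ ∷ []
  xL (suc i) = 0ℤ ∷ 0ℤ ∷ xL i
  yL zero    = 0ℤ ∷ 1ℤ ∷ []
  yL (suc i) = 0ℤ ∷ 0ℤ ∷ yL i

  aL bL : ℕ → List ℤ
  aL zero    = 1ℤ ∷ []
  aL (suc n) = 0ℤ ∷ 0ℤ ∷ aL n
  bL zero    = 0ℤ ∷ 1ℤ ∷ []
  bL (suc n) = 0ℤ ∷ 0ℤ ∷ bL n

  same : Orient → Orient → Bool
  same o₁ o₁ = true
  same o₂ o₂ = true
  same _  _  = false

  module _ {n : ℕ} (os : Vec Orient n) where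

    form : Term n → Form
    form (X i)   = 0ℤ , xL i
    form (Y i)   = 0ℤ , yL i
    form (X⁺ i) with lookup os i
    ... | o₁ = 0ℤ , addL (xL i) (aL n)
    ... | o₂ = 0ℤ , addL (xL i) (bL n)
    form (Y⁺ i) with lookup os i
    ... | o₁ = 0ℤ , addL (yL i) (bL n)
    ... | o₂ = 0ℤ , addL (yL i) (aL n)
    form 𝐚       = 0ℤ , aL n
    form 𝐛       = 0ℤ , bL n
    form (♯ k)   = k , []
    form (s ⊕ t) = addF (form s) (form t)

    minus : Term n → Term n → Form
    minus t s = addF (form t) (scaleF -1ℤ (form s))

    -- The continuation stands for the hypotheses still to be read, so a disjunction repeats them in
    -- both branches without forming a normal form. The test before splitting avoids branches that
    -- are already contradictory, and an orientation at odds with `os` closes its branch at once.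
    closes : Formula n → (List Form → Bool) → List Form → Bool
    closes (s ≤ᶠ t) k fs = k (minus t s ∷ fs)
    closes (s <ᶠ t) k fs = k (addF (-1ℤ , []) (minus t s) ∷ fs)
    closes (s ≡ᶠ t) k fs = k (minus t s ∷ minus s t ∷ fs)
    closes (is o i) k fs = if same o (lookup os i) then k fs else true
    closes (f ∧ᶠ g) k fs = closes f (closes g k) fs
    closes (f ∨ᶠ g) k fs = infeasible (n ℕ.+ n ℕ.+ 2) fs ∨ (closes f k fs ∧ closes g k fs)

    closesAll : List (Formula n) → List Form → Bool
    closesAll []       fs = infeasible (n ℕ.+ n ℕ.+ 2) fs
    closesAll (φ ∷ φs) fs = closes φ (closesAll φs) fs

    base : List Form
    base = addF (-1ℤ , []) (minus 𝐛 (♯ 0ℤ)) ∷ minus 𝐚 𝐛 ∷ []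

  everyOrientation : ∀ n → (Vec Orient n → Bool) → Bool
  everyOrientation zero    k = k []
  everyOrientation (suc n) k = everyOrientation n (k ∘ (o₁ ∷_)) ∧ everyOrientation n (k ∘ (o₂ ∷_))

  everyOrientation-sound : ∀ {n} k (os : Vec Orient n) → T (everyOrientation n k) → T (k os)
  everyOrientation-sound k []        t = t
  everyOrientation-sound k (o₁ ∷ os) t = everyOrientation-sound _ os (proj₁ (Equivalence.to T-∧ t))
  everyOrientation-sound k (o₂ ∷ os) t = everyOrientation-sound _ os (proj₂ (Equivalence.to T-∧ t))

  -- Fourier–Motzkin elimination for every choice of orientations and of disjuncts.
  absurd : ∀ {n} → List (Formula n) → Bool
  absurd {n} φs = everyOrientation n (λ os → closesAll os φs (base os))

  record Pos : Set where
    constructor pos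
    field
      x y : ℤ
      o   : Orient

  open Pos public

  module Semantics (a b : ℤ) (0<b : 0ℤ < b) (b≤a : b ≤ a) where

    width height : Orient → ℤ
    width  o₁ = a
    width  o₂ = b
    height o₁ = b
    height o₂ = a

    x⁺ y⁺ : Pos → ℤ
    x⁺ r = x r + width (o r)
    y⁺ r = y r + height (o r)

    ⟦_⟧ᵗ : ∀ {n} → Term n → Vec Pos n → ℤ
    ⟦ X i ⟧ᵗ   rs = x (lookup rs i)
    ⟦ Y i ⟧ᵗ   rs = y (lookup rs i)
    ⟦ X⁺ i ⟧ᵗ  rs = x⁺ (lookup rs i)
    ⟦ Y⁺ i ⟧ᵗ  rs = y⁺ (lookup rs i)
    ⟦ 𝐚 ⟧ᵗ     rs = a
    ⟦ 𝐛 ⟧ᵗ     rs = b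
    ⟦ ♯ k ⟧ᵗ   rs = k
    ⟦ s ⊕ t ⟧ᵗ rs = ⟦ s ⟧ᵗ rs + ⟦ t ⟧ᵗ rs

    ⟦_⟧ : ∀ {n} → Formula n → Vec Pos n → Set
    ⟦ s ≤ᶠ t ⟧ rs = ⟦ s ⟧ᵗ rs ≤ ⟦ t ⟧ᵗ rs
    ⟦ s <ᶠ t ⟧ rs = ⟦ s ⟧ᵗ rs < ⟦ t ⟧ᵗ rs
    ⟦ s ≡ᶠ t ⟧ rs = ⟦ s ⟧ᵗ rs ≡ ⟦ t ⟧ᵗ rs
    ⟦ is p i ⟧ rs = o (lookup rs i) ≡ p
    ⟦ f ∧ᶠ g ⟧ rs = ⟦ f ⟧ rs × ⟦ g ⟧ rs
    ⟦ f ∨ᶠ g ⟧ rs = ⟦ f ⟧ rs ⊎ ⟦ g ⟧ rs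

    decide : ∀ {n} (f : Formula n) rs → ⟦ f ⟧ rs ⊎ ⟦ neg f ⟧ rs
    decide (s ≤ᶠ t) rs with ⟦ s ⟧ᵗ rs ℤₚ.≤? ⟦ t ⟧ᵗ rs
    ... | yes p = inj₁ p
    ... | no ¬p = inj₂ (ℤₚ.≰⇒> ¬p)
    decide (s <ᶠ t) rs with ⟦ s ⟧ᵗ rs ℤₚ.<? ⟦ t ⟧ᵗ rs
    ... | yes p = inj₁ p
    ... | no ¬p = inj₂ (ℤₚ.≮⇒≥ ¬p)
    decide (s ≡ᶠ t) rs with ℤₚ.<-cmp (⟦ s ⟧ᵗ rs) (⟦ t ⟧ᵗ rs)
    ... | tri< p _ _ = inj₂ (inj₁ p)
    ... | tri≈ _ p _ = inj₁ p
    ... | tri> _ _ p = inj₂ (inj₂ p)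
    decide (is p i) rs with o (lookup rs i) | p
    ... | o₁ | o₁ = inj₁ refl
    ... | o₁ | o₂ = inj₂ refl
    ... | o₂ | o₁ = inj₂ refl
    ... | o₂ | o₂ = inj₁ refl
    decide (f ∧ᶠ g) rs with decide f rs | decide g rs
    ... | inj₁ p | inj₁ q = inj₁ (p , q)
    ... | inj₂ p | _      = inj₂ (inj₁ p)
    ... | inj₁ _ | inj₂ q = inj₂ (inj₂ q)
    decide (f ∨ᶠ g) rs with decide f rs | decide g rs
    ... | inj₁ p | _      = inj₁ (inj₁ p)
    ... | inj₂ _ | inj₁ q = inj₁ (inj₂ q)
    ... | inj₂ p | inj₂ q = inj₂ (p , q)

    consistent : ∀ {n} (f : Formula n) rs → ⟦ f ⟧ rs → ⟦ neg f ⟧ rs → ⊥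
    consistent (s ≤ᶠ t) rs p q = ℤₚ.<⇒≱ q p
    consistent (s <ᶠ t) rs p q = ℤₚ.<⇒≱ p q
    consistent (s ≡ᶠ t) rs p (inj₁ q) = ℤₚ.<⇒≢ q p
    consistent (s ≡ᶠ t) rs p (inj₂ q) = ℤₚ.<⇒≢ q (sym p)
    consistent (is o₁ i) rs p q with () ← trans (sym p) q
    consistent (is o₂ i) rs p q with () ← trans (sym p) q
    consistent (f ∧ᶠ g) rs (p , _) (inj₁ p′) = consistent f rs p p′
    consistent (f ∧ᶠ g) rs (_ , q) (inj₂ q′) = consistent g rs q q′
    consistent (f ∨ᶠ g) rs (inj₁ p) (p′ , _) = consistent f rs p p′
    consistent (f ∨ᶠ g) rs (inj₂ q) (_ , q′) = consistent g rs q q′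

    holds? : ∀ {n} (f : Formula n) rs → Dec (⟦ f ⟧ rs)
    holds? f rs with decide f rs
    ... | inj₁ p = yes p
    ... | inj₂ q = no (λ p → consistent f rs p q)

    coordinates : ∀ {n} → Vec Pos n → List ℤ
    coordinates []       = a ∷ b ∷ []
    coordinates (r ∷ rs) = x r ∷ y r ∷ coordinates rs

    length-coordinates : ∀ {n} (rs : Vec Pos n) → length (coordinates rs) ≡ n ℕ.+ n ℕ.+ 2
    length-coordinates []       = refl
    length-coordinates {suc n} (r ∷ rs) =
      cong suc (trans (cong suc (length-coordinates rs)) (cong (ℕ._+ 2) (sym (ℕₚ.+-suc n n))))

    private
      one : ∀ v → 1ℤ * v + 0ℤ ≡ v
      one v = trans (ℤₚ.+-identityʳ (1ℤ * v)) (ℤₚ.*-identityˡ v)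

      one′ : ∀ u v → 0ℤ * u + (1ℤ * v + 0ℤ) ≡ v
      one′ u v = trans (ℤₚ.+-identityˡ (1ℤ * v + 0ℤ)) (one v)

      skip : ∀ {w w′} → w ≡ w′ → 0ℤ + (0ℤ + w) ≡ w′
      skip p = trans (ℤₚ.+-identityˡ _) (trans (ℤₚ.+-identityˡ _) p)

    dot-x : ∀ {n} (i : Fin n) rs → dot (xL i) (coordinates rs) ≡ x (lookup rs i)
    dot-x zero    (r ∷ rs) = one (x r)
    dot-x (suc i) (r ∷ rs) = skip (dot-x i rs)

    dot-y : ∀ {n} (i : Fin n) rs → dot (yL i) (coordinates rs) ≡ y (lookup rs i)
    dot-y zero    (r ∷ rs) = one′ (x r) (y r)
    dot-y (suc i) (r ∷ rs) = skip (dot-y i rs)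

    dot-a : ∀ {n} (rs : Vec Pos n) → dot (aL n) (coordinates rs) ≡ a
    dot-a []       = one a
    dot-a (r ∷ rs) = skip (dot-a rs)

    dot-b : ∀ {n} (rs : Vec Pos n) → dot (bL n) (coordinates rs) ≡ b
    dot-b []       = one′ a b
    dot-b (r ∷ rs) = skip (dot-b rs)

    module _ {n} (rs : Vec Pos n) where

      private
        os : Vec Orient n
        os = Vec.map o rs

        ρ : List ℤ
        ρ = coordinates rs

        zero+ : ∀ {u v} → u ≡ v → 0ℤ + u ≡ v
        zero+ p = trans (ℤₚ.+-identityˡ _) p

        sum : ∀ cs ds {u v} → dot cs ρ ≡ u → dot ds ρ ≡ v → dot (addL cs ds) ρ ≡ u + v
        sum cs ds p q = trans (dot-add cs ds ρ) (cong₂ _+_ p q)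

      eval-form : ∀ t → eval ρ (form os t) ≡ ⟦ t ⟧ᵗ rs
      eval-form (X i) = zero+ (dot-x i rs)
      eval-form (Y i) = zero+ (dot-y i rs)
      eval-form (X⁺ i) rewrite Vecₚ.lookup-map i o rs with o (lookup rs i)
      ... | o₁ = zero+ (sum (xL i) (aL n) (dot-x i rs) (dot-a rs))
      ... | o₂ = zero+ (sum (xL i) (bL n) (dot-x i rs) (dot-b rs))
      eval-form (Y⁺ i) rewrite Vecₚ.lookup-map i o rs with o (lookup rs i)
      ... | o₁ = zero+ (sum (yL i) (bL n) (dot-y i rs) (dot-b rs))
      ... | o₂ = zero+ (sum (yL i) (aL n) (dot-y i rs) (dot-a rs))
      eval-form 𝐚 = zero+ (dot-a rs)
      eval-form 𝐛 = zero+ (dot-b rs)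
      eval-form (♯ k) = ℤₚ.+-identityʳ k
      eval-form (s ⊕ t) = trans (eval-add (form os s) (form os t) ρ) (cong₂ _+_ (eval-form s) (eval-form t))

      eval-minus : ∀ t s → eval ρ (minus os t s) ≡ ⟦ t ⟧ᵗ rs - ⟦ s ⟧ᵗ rs
      eval-minus t s = trans (eval-add (form os t) (scaleF -1ℤ (form os s)) ρ)
        (cong₂ _+_ (eval-form t)
          (trans (eval-scale -1ℤ (form os s) ρ)
            (trans (ℤₚ.-1*i≡-i _) (cong -_ (eval-form s)))))

      holds-≤ : ∀ s t → ⟦ s ≤ᶠ t ⟧ rs → Holds ρ (minus os t s)
      holds-≤ s t p = subst (0ℤ ≤_) (sym (eval-minus t s)) (ℤₚ.i≤j⇒0≤j-i p)

      -- Integrality enters here: a strict inequality leaves a margin of 1. The elimination itself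
      -- draws only rational consequences.
      holds-< : ∀ s t → ⟦ s <ᶠ t ⟧ rs → Holds ρ (addF (-1ℤ , []) (minus os t s))
      holds-< s t p = subst (0ℤ ≤_) eq (ℤₚ.i≤j⇒0≤j-i (ℤₚ.i<j⇒suc[i]≤j p))
        where
        u v : ℤ
        u = ⟦ s ⟧ᵗ rs
        v = ⟦ t ⟧ᵗ rs
        eq : v - (1ℤ + u) ≡ eval ρ (addF (-1ℤ , []) (minus os t s))
        eq = trans (cong (λ w → v + w) (ℤₚ.neg-distrib-+ 1ℤ u))
            (trans (x∙yz≈y∙xz v -1ℤ (- u))
            (sym (trans (eval-add (-1ℤ , []) (minus os t s) ρ) (cong (λ w → -1ℤ + w) (eval-minus t s)))))

      private
        infeasible-sound′ : ∀ fs → T (infeasible (n ℕ.+ n ℕ.+ 2) fs) → All (Holds ρ) fs → ⊥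
        infeasible-sound′ fs t =
          infeasible-sound ρ fs (subst (λ m → T (infeasible m fs)) (sym (length-coordinates rs)) t)

      closes-sound : ∀ φ k fs → (∀ gs → T (k gs) → All (Holds ρ) gs → ⊥) →
                     T (closes os φ k fs) → ⟦ φ ⟧ rs → All (Holds ρ) fs → ⊥
      closes-sound (s ≤ᶠ t) k fs K c p hs = K _ c (holds-≤ s t p ∷ hs)
      closes-sound (s <ᶠ t) k fs K c p hs = K _ c (holds-< s t p ∷ hs)
      closes-sound (s ≡ᶠ t) k fs K c p hs =
        K _ c (holds-≤ s t (ℤₚ.≤-reflexive p) ∷ holds-≤ t s (ℤₚ.≤-reflexive (sym p)) ∷ hs)
      closes-sound (is q i) k fs K c p hs rewrite Vecₚ.lookup-map i o rs | p with q
      ... | o₁ = K fs c hs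
      ... | o₂ = K fs c hs
      closes-sound (f ∧ᶠ g) k fs K c (p , q) hs =
        closes-sound f _ fs (λ gs c′ hs′ → closes-sound g k gs K c′ q hs′) c p hs
      closes-sound (f ∨ᶠ g) k fs K c p hs with Equivalence.to T-∨ c
      ... | inj₁ c′ = infeasible-sound′ fs c′ hs
      ... | inj₂ c′ with p | Equivalence.to (T-∧ {closes os f k fs} {closes os g k fs}) c′
      ...   | inj₁ q | d , _ = closes-sound f k fs K d q hs
      ...   | inj₂ q | _ , d = closes-sound g k fs K d q hs

      closesAll-sound : ∀ φs fs → T (closesAll os φs fs) →
                        All (λ φ → ⟦ φ ⟧ rs) φs → All (Holds ρ) fs → ⊥
      closesAll-sound []       fs c []       hs = infeasible-sound′ fs c hs
      closesAll-sound (φ ∷ φs) fs c (p ∷ ps) hs =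
        closes-sound φ _ fs (λ gs c′ → closesAll-sound φs gs c′ ps) c p hs

      -- When the search succeeds, the implicit argument evaluates to the unit type and is filled in
      -- by itself; each call is thus checked by computation.
      refute : ∀ φs {_ : T (absurd φs)} → All (λ φ → ⟦ φ ⟧ rs) φs → ⊥
      refute φs {t} ps =
        closesAll-sound φs (base os) (everyOrientation-sound _ os t) ps
          (holds-< (♯ 0ℤ) 𝐛 0<b ∷ holds-≤ 𝐛 𝐚 b≤a ∷ [])

      prove : ∀ φ φs {_ : T (absurd (neg φ ∷ φs))} → All (λ φ → ⟦ φ ⟧ rs) φs → ⟦ φ ⟧ rs
      prove φ φs {t} ps with decide φ rs
      ... | inj₁ p = p
      ... | inj₂ p = ⊥-elim (refute (neg φ ∷ φs) {t} (p ∷ ps))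

open Formulas

-- Harmless rectangles and the existence of a corner

module Corners where

  open import Data.Integer using (ℤ; +_; 0ℤ; _+_; _≤_; _<_)

  module _ {R : Set} where

    search : {P : R → Set} → Decidable P → ∀ xs →
             (∃ λ r → r ∈ xs × P r) ⊎ (∀ {r} → r ∈ xs → ¬ P r)
    search P? xs with Any.any? P? xs
    ... | yes p = inj₁ (find p)
    ... | no ¬p = inj₂ (λ i p → ¬p (lose i p))

    forall? : {P : R → Set} → Decidable P → ∀ xs → Dec (∀ {r} → r ∈ xs → P r)
    forall? P? xs with All.all? P? xs
    ... | yes p = yes (All.lookup p)
    ... | no ¬p = no (λ f → ¬p (All.tabulate f))

    least : {P : R → Set} → Decidable P → (m : R → ℤ) → ∀ xs →
            (∃ λ r → r ∈ xs × P r × (∀ {s} → s ∈ xs → P s → m r ≤ m s)) ⊎ (∀ {r} → r ∈ xs → ¬ P r)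
    least P? m [] = inj₂ λ ()
    least P? m (r ∷ xs) with P? r | least P? m xs
    ... | no ¬p | inj₂ none = inj₂ λ { (here refl) → ¬p ; (there i) → none i }
    ... | no ¬p | inj₁ (s , i , q , min) =
          inj₁ (s , there i , q , λ { (here refl) p → ⊥-elim (¬p p) ; (there j) → min j })
    ... | yes p | inj₂ none =
          inj₁ (r , here refl , p , λ { (here refl) _ → ℤₚ.≤-refl ; (there j) q → ⊥-elim (none j q) })
    ... | yes p | inj₁ (s , i , q , min) with ℤₚ.≤-total (m r) (m s)
    ...   | inj₁ r≤s = inj₁ (r , here refl , p ,
              λ { (here refl) _ → ℤₚ.≤-refl ; (there j) q′ → ℤₚ.≤-trans r≤s (min j q′) })
    ...   | inj₂ s≤r = inj₁ (s , there i , q , λ { (here refl) _ → s≤r ; (there j) → min j })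

  -- A neighbour i on the left of a vertical j offends j unless it is vertical and higher; below a horizontal
  -- j it offends unless it is horizontal and further right.  Offending neighbours have a smaller x + y.
  module _ {n} (i j : Fin n) where

    leftOf below touch disjoint apart offends region region′ flush beyond toLeft : Formula n
    leftOf   = X⁺ i ≡ᶠ X j ∧ᶠ Y i <ᶠ Y⁺ j ∧ᶠ Y j <ᶠ Y⁺ i
    below    = Y⁺ i ≡ᶠ Y j ∧ᶠ X i <ᶠ X⁺ j ∧ᶠ X j <ᶠ X⁺ i
    touch    = leftOf ∨ᶠ (X⁺ j ≡ᶠ X i ∧ᶠ Y j <ᶠ Y⁺ i ∧ᶠ Y i <ᶠ Y⁺ j) ∨ᶠ
               below  ∨ᶠ (Y⁺ j ≡ᶠ Y i ∧ᶠ X j <ᶠ X⁺ i ∧ᶠ X i <ᶠ X⁺ j)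
    disjoint = X⁺ i ≤ᶠ X j ∨ᶠ X⁺ j ≤ᶠ X i ∨ᶠ Y⁺ i ≤ᶠ Y j ∨ᶠ Y⁺ j ≤ᶠ Y i
    apart    = ((is o₁ i ∧ᶠ is o₁ j ∨ᶠ is o₂ i ∧ᶠ is o₂ j) ∧ᶠ X i ≡ᶠ X j ∧ᶠ Y i ≡ᶠ Y j) ∨ᶠ disjoint
    offends  = (is o₂ j ∧ᶠ leftOf ∧ᶠ (is o₁ i ∨ᶠ Y i ≤ᶠ Y j)) ∨ᶠ
               (is o₁ j ∧ᶠ below ∧ᶠ (is o₂ i ∨ᶠ X i ≤ᶠ X j))
    region   = (is o₂ j ∨ᶠ X⁺ i ≤ᶠ X j ∨ᶠ Y⁺ i ≤ᶠ Y j) ∧ᶠ (is o₁ j ∨ᶠ X⁺ i ⊕ 𝐚 ≤ᶠ X j ∨ᶠ Y i ≤ᶠ Y j)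
    region′  = (is o₁ j ∨ᶠ Y⁺ i ≤ᶠ Y j ∨ᶠ X⁺ i ≤ᶠ X j) ∧ᶠ (is o₂ j ∨ᶠ Y⁺ i ⊕ 𝐚 ≤ᶠ Y j ∨ᶠ X i ≤ᶠ X j)
    flush    = is o₁ j ∧ᶠ X j ≡ᶠ X⁺ i ∧ᶠ Y j <ᶠ Y⁺ i
    -- Of `i` only the lower left point is used, as the apex of a region. The slack `𝐚` closes the
    -- region under offending neighbours: a horizontal one on the left of a vertical `j` starts less
    -- than `𝐚` above the bottom of `j`, and symmetrically.
    beyond   = (is o₁ j ∧ᶠ X j <ᶠ X i ∧ᶠ Y j <ᶠ Y i ⊕ 𝐚) ∨ᶠ (is o₂ j ∧ᶠ Y j <ᶠ Y i ∧ᶠ X j <ᶠ X i ⊕ 𝐚)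
    toLeft   = is o₁ j ∧ᶠ Y j <ᶠ Y⁺ i ∧ᶠ X⁺ j ≤ᶠ X i

  module Extremal (a b : ℤ) (0<b : 0ℤ < b) (b≤a : b ≤ a)
           {R : Set} (_≟_ : DecidableEquality R) (at : R → Pos) (xs : List R) where

    open Semantics a b 0<b b≤a

    Harmless : R → Set
    Harmless r = ∀ {k} → k ∈ xs → ⟦ neg (offends 0F 1F) ⟧ (at k ∷ at r ∷ [])

    harmless? : Decidable Harmless
    harmless? r = forall? (λ k → holds? (neg (offends 0F 1F)) (at k ∷ at r ∷ [])) xs

    offended : ∀ r → ¬ Harmless r → ∃ λ k → k ∈ xs × ⟦ offends 0F 1F ⟧ (at k ∷ at r ∷ [])
    offended r ¬h with search (λ k → holds? (offends 0F 1F) (at k ∷ at r ∷ [])) xs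
    ... | inj₁ found = found
    ... | inj₂ none  = ⊥-elim (¬h λ {k} i → refuteLeft (decide (offends 0F 1F) (at k ∷ at r ∷ [])) (none i))
      where
      refuteLeft : ∀ {P Q : Set} → P ⊎ Q → ¬ P → Q
      refuteLeft (inj₁ p) ¬p = ⊥-elim (¬p p)
      refuteLeft (inj₂ q) _  = q

    Below : Pos → R → Set
    Below t r = ⟦ beyond 0F 1F ⟧ (t ∷ at r ∷ [])

    -- Why x + y drops: a horizontal left neighbour of a vertical rectangle starts exactly `a`
    -- further left and less than `a` higher, while an offending vertical one starts `b` further
    -- left and no higher. Below a horizontal rectangle the axes are exchanged.
    descent : ∀ t → (∀ {r} → r ∈ xs → Harmless r → ¬ Below t r) → ∀ {r} → r ∈ xs → ¬ Below t r
    descent t none {r} i q with least (λ r → holds? (beyond 0F 1F) (t ∷ at r ∷ [])) (λ r → x (at r) + y (at r)) xs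
    ... | inj₂ empty = empty i q
    ... | inj₁ (m , j , p , min) with harmless? m
    ...   | yes h = none j h p
    ...   | no ¬h with offended m ¬h
    ...     | k , l , off = ℤₚ.<⇒≱ smaller (min l inside)
      where
      rs : Vec Pos 3
      rs = t ∷ at m ∷ at k ∷ []
      inside : Below t k
      inside = prove rs (beyond 0F 2F) (beyond 0F 1F ∷ offends 2F 1F ∷ []) (p ∷ off ∷ [])
      smaller : x (at k) + y (at k) < x (at m) + y (at m)
      smaller = prove rs (X 2F ⊕ Y 2F <ᶠ X 1F ⊕ Y 1F) (beyond 0F 1F ∷ offends 2F 1F ∷ []) (p ∷ off ∷ [])

    descent′ : ∀ t → (∀ {r} → r ∈ xs → Harmless r → ¬ Below t r) →
               ∀ {r} → r ∈ xs → ⟦ neg (beyond 0F 1F) ⟧ (t ∷ at r ∷ [])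
    descent′ t none {r} i with decide (beyond 0F 1F) (t ∷ at r ∷ [])
    ... | inj₁ q = ⊥-elim (descent t none i q)
    ... | inj₂ q = q

    record Corner (r : R) (p : Orient) (reg : Formula 2) : Set where
      constructor corner
      field
        member   : r ∈ xs
        oriented : o (at r) ≡ p
        harmless : Harmless r
        free     : ∀ {k} → k ∈ xs → ⟦ reg ⟧ (at r ∷ at k ∷ [])

    -- Of the four ways in which `v` and `h` can be disjoint in `findCorner`, this condition
    -- excludes that `h` lies entirely to the left of `v`.
    Clear : R → Set
    Clear v = ∀ {k} → k ∈ xs → Harmless k → ⟦ neg (toLeft 0F 1F) ⟧ (at v ∷ at k ∷ [])

    clear? : Decidable Clear
    clear? v = forall? (λ k → harmless? k →-dec holds? (neg (toLeft 0F 1F)) (at v ∷ at k ∷ [])) xs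

    module _ (sep : ∀ {r s} → r ∈ xs → s ∈ xs → r ≢ s → ⟦ disjoint 0F 1F ⟧ (at r ∷ at s ∷ [])) where

      -- v is the lowest harmless vertical rectangle with no harmless horizontal one entirely to its left and
      -- starting below its top; h is the leftmost harmless horizontal one starting below the top of v.  If
      -- neither were a corner, v and h would overlap.
      findCorner : ∀ {r} → r ∈ xs → (∃ λ v → Corner v o₂ (region 0F 1F)) ⊎ (∃ λ h → Corner h o₁ (region′ 0F 1F))
      findCorner {r} i with least (λ v → o₂? v ×-dec harmless? v ×-dec clear? v) (λ v → y (at v)) xs
        where
        o₂? : ∀ v → Dec (o (at v) ≡ o₂)
        o₂? v = holds? (is o₂ 0F) (at v ∷ [])
      ... | inj₁ (v , v∈ , (ov , hv , cv) , lowest)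
          with least (λ h → harmless? h ×-dec holds? (is o₁ 1F ∧ᶠ Y 1F <ᶠ Y⁺ 0F) (at v ∷ at h ∷ [])) (λ h → x (at h)) xs
      ...   | inj₂ none = inj₁ (v , corner v∈ ov hv free)
        where
        -- Since the top of the vertical `v` is `y (at v) + a`, `beyond` at this point is exactly
        -- the negation of `region` for `v`.
        t : Pos
        t = pos (x⁺ (at v)) (y (at v)) o₁
        noHarmless : ∀ {k} → k ∈ xs → Harmless k → ¬ Below t k
        noHarmless {k} k∈ hk q with decide (is o₁ 1F) (at v ∷ at k ∷ [])
        ... | inj₁ ok = none k∈ (hk , prove rs (is o₁ 1F ∧ᶠ Y 1F <ᶠ Y⁺ 0F) φs (ov ∷ ok ∷ refl ∷ refl ∷ q ∷ []))
          where
          rs : Vec Pos 3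
          rs = at v ∷ at k ∷ t ∷ []
          φs : List (Formula 3)
          φs = is o₂ 0F ∷ is o₁ 1F ∷ X 2F ≡ᶠ X⁺ 0F ∷ Y 2F ≡ᶠ Y 0F ∷ beyond 2F 1F ∷ []
        ... | inj₂ ok = ℤₚ.<⇒≱ below-v (lowest k∈ (ok , hk , ck))
          where
          rs : Vec Pos 3
          rs = at v ∷ at k ∷ t ∷ []
          below-v : y (at k) < y (at v)
          below-v = prove rs (Y 1F <ᶠ Y 0F) (is o₂ 1F ∷ Y 2F ≡ᶠ Y 0F ∷ beyond 2F 1F ∷ []) (ok ∷ refl ∷ q ∷ [])
          ck : Clear k
          ck {h} h∈ hh with decide (toLeft 0F 1F) (at k ∷ at h ∷ [])
          ... | inj₂ p = p
          ... | inj₁ p = ⊥-elim (none h∈ (hh , prove (at v ∷ at k ∷ at h ∷ []) (is o₁ 2F ∧ᶠ Y 2F <ᶠ Y⁺ 0F)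
                   (is o₂ 0F ∷ is o₂ 1F ∷ Y 1F <ᶠ Y 0F ∷ toLeft 1F 2F ∷ []) (ov ∷ ok ∷ below-v ∷ p ∷ [])))
        free : ∀ {k} → k ∈ xs → ⟦ region 0F 1F ⟧ (at v ∷ at k ∷ [])
        free {k} k∈ = prove (at v ∷ at k ∷ t ∷ []) (region 0F 1F)
          (is o₂ 0F ∷ X 2F ≡ᶠ X⁺ 0F ∷ Y 2F ≡ᶠ Y 0F ∷ neg (beyond 2F 1F) ∷ [])
          (ov ∷ refl ∷ refl ∷ descent′ t noHarmless k∈ ∷ [])
      ...   | inj₁ (h , h∈ , (hh , oh , yh) , leftmost) = choose (decide (X⁺ 0F ≤ᶠ X 1F ∨ᶠ Y⁺ 1F ≤ᶠ Y 0F) (at v ∷ at h ∷ []))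
        where
        -- One apex serves both outcomes: its region contains the forbidden region of `v` if `h`
        -- starts right of `v`, and that of `h` if `h` ends below `v`.
        t : Pos
        t = pos (x (at h)) (y (at v)) o₁
        v≢h : v ≢ h
        v≢h refl with () ← trans (sym ov) oh
        xv : x (at v) < x⁺ (at h)
        xv = prove (at v ∷ at h ∷ []) (X 0F <ᶠ X⁺ 1F)
               ((is o₁ 1F ∧ᶠ Y 1F <ᶠ Y⁺ 0F) ∷ neg (toLeft 0F 1F) ∷ []) ((oh , yh) ∷ cv h∈ hh ∷ [])
        noHarmless : ∀ {k} → k ∈ xs → Harmless k → ¬ Below t k
        noHarmless {k} k∈ hk q with decide (is o₁ 1F) (at v ∷ at k ∷ [])
        ... | inj₁ ok = ℤₚ.<⇒≱
            (prove rs (X 1F <ᶠ X 2F) (is o₁ 1F ∷ X 3F ≡ᶠ X 2F ∷ beyond 3F 1F ∷ []) (ok ∷ refl ∷ q ∷ []))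
            (leftmost k∈ (hk , prove rs (is o₁ 1F ∧ᶠ Y 1F <ᶠ Y⁺ 0F)
              (is o₂ 0F ∷ is o₁ 1F ∷ Y 3F ≡ᶠ Y 0F ∷ beyond 3F 1F ∷ []) (ov ∷ ok ∷ refl ∷ q ∷ [])))
          where
          rs : Vec Pos 4
          rs = at v ∷ at k ∷ at h ∷ t ∷ []
        ... | inj₂ ok = ℤₚ.<⇒≱ below-v (lowest k∈ (ok , hk , ck))
          where
          rs : Vec Pos 4
          rs = at v ∷ at k ∷ at h ∷ t ∷ []
          below-v : y (at k) < y (at v)
          below-v = prove rs (Y 1F <ᶠ Y 0F) (is o₂ 1F ∷ Y 3F ≡ᶠ Y 0F ∷ beyond 3F 1F ∷ []) (ok ∷ refl ∷ q ∷ [])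
          -- A harmless horizontal `g` on the left of `k` ends before `k` starts, hence before
          -- `x (at h) + a`; having width `a`, it would start left of `h`.
          ck : Clear k
          ck {g} g∈ hg with decide (toLeft 0F 1F) (at k ∷ at g ∷ [])
          ... | inj₂ p = p
          ... | inj₁ p = ⊥-elim (ℤₚ.<⇒≱
                (prove rs′ (X 4F <ᶠ X 2F)
                  (is o₁ 2F ∷ is o₂ 1F ∷ toLeft 1F 4F ∷ X 3F ≡ᶠ X 2F ∷ beyond 3F 1F ∷ [])
                  (oh ∷ ok ∷ p ∷ refl ∷ q ∷ []))
                (leftmost g∈ (hg , prove rs′ (is o₁ 4F ∧ᶠ Y 4F <ᶠ Y⁺ 0F)
                  (is o₂ 0F ∷ is o₂ 1F ∷ Y 1F <ᶠ Y 0F ∷ toLeft 1F 4F ∷ []) (ov ∷ ok ∷ below-v ∷ p ∷ []))))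
            where
            rs′ : Vec Pos 5
            rs′ = at v ∷ at k ∷ at h ∷ t ∷ at g ∷ []
        choose : ⟦ X⁺ 0F ≤ᶠ X 1F ∨ᶠ Y⁺ 1F ≤ᶠ Y 0F ⟧ (at v ∷ at h ∷ []) ⊎
                 ⟦ neg (X⁺ 0F ≤ᶠ X 1F ∨ᶠ Y⁺ 1F ≤ᶠ Y 0F) ⟧ (at v ∷ at h ∷ []) →
                 (∃ λ v → Corner v o₂ (region 0F 1F)) ⊎ (∃ λ h → Corner h o₁ (region′ 0F 1F))
        choose (inj₁ (inj₁ p)) = inj₁ (v , corner v∈ ov hv λ {k} k∈ →
          prove (at v ∷ at k ∷ at h ∷ t ∷ []) (region 0F 1F)
            (is o₂ 0F ∷ is o₁ 2F ∷ X⁺ 0F ≤ᶠ X 2F ∷ X 3F ≡ᶠ X 2F ∷ Y 3F ≡ᶠ Y 0F ∷ neg (beyond 3F 1F) ∷ [])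
            (ov ∷ oh ∷ p ∷ refl ∷ refl ∷ descent′ t noHarmless k∈ ∷ []))
        choose (inj₁ (inj₂ p)) = inj₂ (h , corner h∈ oh hh λ {k} k∈ →
          prove (at v ∷ at k ∷ at h ∷ t ∷ []) (region′ 2F 1F)
            (is o₂ 0F ∷ is o₁ 2F ∷ Y⁺ 2F ≤ᶠ Y 0F ∷ X 3F ≡ᶠ X 2F ∷ Y 3F ≡ᶠ Y 0F ∷ neg (beyond 3F 1F) ∷ [])
            (ov ∷ oh ∷ p ∷ refl ∷ refl ∷ descent′ t noHarmless k∈ ∷ []))
        choose (inj₂ p) = ⊥-elim (refute (at v ∷ at h ∷ [])
          (is o₂ 0F ∷ (is o₁ 1F ∧ᶠ Y 1F <ᶠ Y⁺ 0F) ∷ X 0F <ᶠ X⁺ 1F ∷ neg (X⁺ 0F ≤ᶠ X 1F ∨ᶠ Y⁺ 1F ≤ᶠ Y 0F) ∷ disjoint 0F 1F ∷ [])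
          (ov ∷ (oh , yh) ∷ xv ∷ p ∷ sep v∈ h∈ v≢h ∷ []))
      findCorner {r} i | inj₂ noV with least (λ h → holds? (is o₁ 0F) (at h ∷ []) ×-dec harmless? h) (λ h → x (at h)) xs
      ... | inj₂ noH = ⊥-elim (descent t noHarmless i self)
        where
        -- The upper right corner of `r` as apex puts `r` itself into the region, which must
        -- therefore contain a harmless rectangle.
        t : Pos
        t = pos (x⁺ (at r)) (y⁺ (at r)) o₁
        noHarmless : ∀ {k} → k ∈ xs → Harmless k → ¬ Below t k
        noHarmless {k} k∈ hk _ with decide (is o₁ 0F) (at k ∷ [])
        ... | inj₁ ok = noH k∈ (ok , hk)
        ... | inj₂ ok = noV k∈ (ok , hk , λ {h} h∈ hh → case (decide (toLeft 0F 1F) (at k ∷ at h ∷ [])) h∈ hh)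
          where
          case : ∀ {h} → ⟦ toLeft 0F 1F ⟧ (at k ∷ at h ∷ []) ⊎ ⟦ neg (toLeft 0F 1F) ⟧ (at k ∷ at h ∷ []) →
                 h ∈ xs → Harmless h → ⟦ neg (toLeft 0F 1F) ⟧ (at k ∷ at h ∷ [])
          case (inj₁ p) h∈ hh = ⊥-elim (noH h∈ (proj₁ p , hh))
          case (inj₂ p) h∈ hh = p
        self : Below t r
        self = prove (at r ∷ t ∷ []) (beyond 1F 0F) (X 1F ≡ᶠ X⁺ 0F ∷ Y 1F ≡ᶠ Y⁺ 0F ∷ []) (refl ∷ refl ∷ [])
      ... | inj₁ (h , h∈ , (oh , hh) , leftmost) = inj₂ (h , corner h∈ oh hh free)
        where
        t : Pos
        t = pos (x (at h)) (y⁺ (at h)) o₁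
        noHarmless : ∀ {k} → k ∈ xs → Harmless k → ¬ Below t k
        noHarmless {k} k∈ hk q with decide (is o₁ 0F) (at k ∷ [])
        ... | inj₁ ok = ℤₚ.<⇒≱
            (prove (at k ∷ at h ∷ t ∷ []) (X 0F <ᶠ X 1F) (is o₁ 0F ∷ X 2F ≡ᶠ X 1F ∷ beyond 2F 0F ∷ []) (ok ∷ refl ∷ q ∷ []))
            (leftmost k∈ (ok , hk))
        ... | inj₂ ok = noV k∈ (ok , hk , clear)
          where
          clear : Clear k
          clear {g} g∈ hg with decide (toLeft 0F 1F) (at k ∷ at g ∷ [])
          ... | inj₂ p = p
          ... | inj₁ p = ⊥-elim (ℤₚ.<⇒≱
                (prove (at k ∷ at h ∷ t ∷ at g ∷ []) (X 3F <ᶠ X 1F)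
                  (is o₂ 0F ∷ is o₁ 1F ∷ toLeft 0F 3F ∷ X 2F ≡ᶠ X 1F ∷ beyond 2F 0F ∷ [])
                  (ok ∷ oh ∷ p ∷ refl ∷ q ∷ []))
                (leftmost g∈ (proj₁ p , hg)))
        free : ∀ {k} → k ∈ xs → ⟦ region′ 0F 1F ⟧ (at h ∷ at k ∷ [])
        free {k} k∈ = prove (at h ∷ at k ∷ t ∷ []) (region′ 0F 1F)
          (is o₁ 0F ∷ X 2F ≡ᶠ X 0F ∷ Y 2F ≡ᶠ Y⁺ 0F ∷ neg (beyond 2F 1F) ∷ [])
          (oh ∷ refl ∷ refl ∷ descent′ t noHarmless k∈ ∷ [])

open Corners

-- A parity version of the Jordan curve theorem for walks on cells

module Walks where

  open import Data.Integer using (ℤ; +_; 1ℤ; _+_; _≤_; _<_; pred)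

  Cell : Set
  Cell = ℤ × ℤ

  -- Both directions of an edge are named by its left or lower cell, so that the mod 2 counts treat
  -- them alike.
  data Adjacent : Cell → Cell → Set where
    east  : ∀ x y → Adjacent (x , y) (1ℤ + x , y)
    west  : ∀ x y → Adjacent (1ℤ + x , y) (x , y)
    north : ∀ x y → Adjacent (x , y) (x , 1ℤ + y)
    south : ∀ x y → Adjacent (x , 1ℤ + y) (x , y)

  infixr 5 _∙_

  data Walk (P : Cell → Set) : Cell → Cell → Set where
    stop : ∀ {c} → P c → Walk P c c
    step : ∀ {c d e} → P c → Adjacent c d → Walk P d e → Walk P c e

  _∙_ : ∀ {P c d e} → Walk P c d → Walk P d e → Walk P c e
  stop _     ∙ w′ = w′
  step p a w ∙ w′ = step p a (w ∙ w′)

  weaken : ∀ {P Q : Cell → Set} → (∀ {c} → P c → Q c) → ∀ {c d} → Walk P c d → Walk Q c d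
  weaken f (stop p)     = stop (f p)
  weaken f (step p a w) = step (f p) a (weaken f w)

  eq? lt? : ℤ → ℤ → Bool
  eq? u v = does (u ℤₚ.≟ v)
  lt? u v = does (u ℤₚ.<? v)

  hor ver : ∀ {c d} → Adjacent c d → ℤ → ℤ → Bool
  hor (east u v)  x y = eq? u x ∧ lt? y v
  hor (west u v)  x y = eq? u x ∧ lt? y v
  hor (north u v) x y = false
  hor (south u v) x y = false
  ver (east u v)  x y = false
  ver (west u v)  x y = false
  ver (north u v) x y = eq? u x ∧ eq? v y
  ver (south u v) x y = eq? u x ∧ eq? v y

  above : Cell → ℤ → ℤ → Bool
  above (u , v) x y = eq? u x ∧ lt? y v

  -- crossings counts, mod 2, the steps between the columns x and x + 1 above row y, that is, the walk's
  -- intersections with a vertical ray.  For a closed walk this parity only changes across the walk itself.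
  crossings verticals : ∀ {P c d} → Walk P c d → ℤ → ℤ → Bool
  crossings (stop _)     x y = false
  crossings (step _ a w) x y = hor a x y xor crossings w x y
  verticals (stop _)     x y = false
  verticals (step _ a w) x y = ver a x y xor verticals w x y

  eq?-suc : ∀ u x → eq? (1ℤ + u) (1ℤ + x) ≡ eq? u x
  eq?-suc u x with u ℤₚ.≟ x
  ... | yes refl = dec-true (1ℤ + u ℤₚ.≟ 1ℤ + u) refl
  ... | no u≢x  = dec-false (1ℤ + u ℤₚ.≟ 1ℤ + x)
    (λ p → u≢x (trans (sym (ℤₚ.pred-suc u)) (trans (cong pred p) (ℤₚ.pred-suc x))))

  i<1+i : ∀ i → i < 1ℤ + i
  i<1+i i = ℤₚ.suc[i]≤j⇒i<j ℤₚ.≤-refl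

  <1+⇒≤ : ∀ {i j} → i < 1ℤ + j → i ≤ j
  <1+⇒≤ {i} {j} p = subst₂ _≤_ (ℤₚ.pred-suc i) (ℤₚ.pred-suc j) (ℤₚ.pred-mono (ℤₚ.i<j⇒suc[i]≤j p))

  lt?-suc : ∀ y v → lt? y (1ℤ + v) ≡ eq? v y xor lt? y v
  lt?-suc y v with v ℤₚ.≟ y
  ... | yes refl = trans (dec-true (y ℤₚ.<? 1ℤ + v) (i<1+i v))
                         (sym (cong not (dec-false (v ℤₚ.<? v) (ℤₚ.<-irrefl refl))))
  ... | no v≢y with y ℤₚ.<? v
  ...   | yes y<v = dec-true (y ℤₚ.<? 1ℤ + v) (ℤₚ.<-trans y<v (i<1+i v))
  ...   | no y≮v  = dec-false (y ℤₚ.<? 1ℤ + v)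
    (λ p → y≮v (ℤₚ.≤∧≢⇒< (<1+⇒≤ p) (λ q → v≢y (sym q))))

  lt?-shift : ∀ y v → v ≢ 1ℤ + y → lt? y v ≡ lt? (1ℤ + y) v
  lt?-shift y v v≢ with y ℤₚ.<? v
  ... | yes y<v = sym (dec-true (1ℤ + y ℤₚ.<? v) (ℤₚ.≤∧≢⇒< (ℤₚ.i<j⇒suc[i]≤j y<v) (λ q → v≢ (sym q))))
  ... | no y≮v  = sym (dec-false (1ℤ + y ℤₚ.<? v) (λ p → y≮v (ℤₚ.<-trans (i<1+i y) p)))

  -- Consider the half-column of cells in column `1ℤ + x` above row `y`. A step enters or leaves it
  -- exactly by crossing its left side, its right side or its bottom, which are the three terms on
  -- the left.
  edge : ∀ {c d} (a : Adjacent c d) x y →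
         (hor a x y xor hor a (1ℤ + x) y) xor ver a (1ℤ + x) y ≡ above c (1ℤ + x) y xor above d (1ℤ + x) y
  edge (east u v) x y rewrite eq?-suc u x = lem (eq? u x ∧ lt? y v) _
    where
    lem : ∀ p q → (p xor q) xor false ≡ q xor p
    lem false q = refl
    lem true  q = trans (xor-identityʳ (not q)) (sym (xor-comm q true))
  edge (west u v) x y rewrite eq?-suc u x = xor-identityʳ _
  edge (north u v) x y rewrite lt?-suc y v = lem (eq? u (1ℤ + x)) (eq? v y) (lt? y v)
    where
    lem : ∀ p q r → p ∧ q ≡ (p ∧ r) xor (p ∧ (q xor r))
    lem false q     r     = refl
    lem true  false r     = sym (xor-same r)
    lem true  true  false = refl
    lem true  true  true  = refl
  edge (south u v) x y rewrite lt?-suc y v = lem (eq? u (1ℤ + x)) (eq? v y) (lt? y v)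
    where
    lem : ∀ p q r → p ∧ q ≡ (p ∧ (q xor r)) xor (p ∧ r)
    lem false q     r     = refl
    lem true  false r     = sym (xor-same r)
    lem true  true  false = refl
    lem true  true  true  = refl

  xor-interchange : ∀ p q r s → (p xor q) xor (r xor s) ≡ (p xor r) xor (q xor s)
  xor-interchange p q r s = trans (xor-assoc p q (r xor s)) (trans (cong (p xor_) middle) (sym (xor-assoc p r (q xor s))))
    where
    middle : q xor (r xor s) ≡ r xor (q xor s)
    middle = trans (sym (xor-assoc q r s)) (trans (cong (_xor s) (xor-comm q r)) (xor-assoc r q s))

  telescope : ∀ {P c e} (w : Walk P c e) x y →
              (crossings w x y xor crossings w (1ℤ + x) y) xor verticals w (1ℤ + x) y ≡
              above c (1ℤ + x) y xor above e (1ℤ + x) y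
  telescope {c = c} (stop _) x y = sym (xor-same (above c (1ℤ + x) y))
  telescope {c = c} {e} (step {d = d} _ a w) x y =
    trans (lem (hor a x y) (crossings w x y) (hor a (1ℤ + x) y) (crossings w (1ℤ + x) y)
               (ver a (1ℤ + x) y) (verticals w (1ℤ + x) y))
    (trans (cong₂ _xor_ (edge a x y) (telescope w x y)) (lem′ (above c _ y) (above d _ y) (above e _ y)))
    where
    lem : ∀ h C h′ C′ v V → ((h xor C) xor (h′ xor C′)) xor (v xor V) ≡
                            ((h xor h′) xor v) xor ((C xor C′) xor V)
    lem h C h′ C′ v V = trans (cong (_xor (v xor V)) (xor-interchange h C h′ C′)) (xor-interchange (h xor h′) (C xor C′) v V)
    lem′ : ∀ p q r → (p xor q) xor (q xor r) ≡ p xor r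
    lem′ p q r = trans (xor-assoc p q (q xor r))
      (cong (p xor_) (trans (sym (xor-assoc q q r)) (cong (_xor r) (xor-same q))))

  start : ∀ {P c d} → Walk P c d → P c
  start (stop p)     = p
  start (step p _ _) = p

  private
    vanish : ∀ u x v y → ¬ (u ≡ x × v ≡ y) → eq? u x ∧ eq? v y ≡ false
    vanish u x v y n with u ℤₚ.≟ x
    ... | no _ = refl
    ... | yes p = dec-false (v ℤₚ.≟ y) (λ q → n (p , q))

    shift : ∀ u x v y → ¬ (u ≡ x × v ≡ 1ℤ + y) → eq? u x ∧ lt? y v ≡ eq? u x ∧ lt? (1ℤ + y) v
    shift u x v y n with u ℤₚ.≟ x
    ... | no _ = refl
    ... | yes p = lt?-shift y v (λ q → n (p , q))

  verticals-off : ∀ {P c d} (w : Walk P c d) x y → ¬ P (x , y) → verticals w x y ≡ false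
  verticals-off (stop _)               x y n = refl
  verticals-off (step _ (east _ _) w)  x y n = verticals-off w x y n
  verticals-off (step _ (west _ _) w)  x y n = verticals-off w x y n
  verticals-off (step p (north u v) w) x y n =
    cong₂ _xor_ (vanish u x v y λ { (refl , refl) → n p }) (verticals-off w x y n)
  verticals-off (step _ (south u v) w) x y n =
    cong₂ _xor_ (vanish u x v y λ { (refl , refl) → n (start w) }) (verticals-off w x y n)

  -- The two rays differ by a single edge, the one leading east from the cell `(x , 1ℤ + y)`.
  crossings-off : ∀ {P c d} (w : Walk P c d) x y → ¬ P (x , 1ℤ + y) → crossings w x y ≡ crossings w x (1ℤ + y)
  crossings-off (stop _)               x y n = refl
  crossings-off (step p (east u v) w)  x y n =
    cong₂ _xor_ (shift u x v y λ { (refl , refl) → n p }) (crossings-off w x y n)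
  crossings-off (step _ (west u v) w)  x y n =
    cong₂ _xor_ (shift u x v y λ { (refl , refl) → n (start w) }) (crossings-off w x y n)
  crossings-off (step _ (north _ _) w) x y n = crossings-off w x y n
  crossings-off (step _ (south _ _) w) x y n = crossings-off w x y n

  verticals-∙ : ∀ {P c d e} (w : Walk P c d) (w′ : Walk P d e) x y →
                verticals (w ∙ w′) x y ≡ verticals w x y xor verticals w′ x y
  verticals-∙ (stop _)     w′ x y = refl
  verticals-∙ (step _ a w) w′ x y =
    trans (cong (ver a x y xor_) (verticals-∙ w w′ x y)) (sym (xor-assoc (ver a x y) _ _))

  verticals-weaken : ∀ {P Q : Cell → Set} (f : ∀ {c} → P c → Q c) {c d} (w : Walk P c d) x y →
                     verticals (weaken f w) x y ≡ verticals w x y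
  verticals-weaken f (stop _)     x y = refl
  verticals-weaken f (step _ a w) x y = cong (ver a x y xor_) (verticals-weaken f w x y)

  xor≡false : ∀ {p q} → p xor q ≡ false → p ≡ q
  xor≡false {false} {false} _ = refl
  xor≡false {true}  {true}  _ = refl

  module Loop {P : Cell → Set} {c : Cell} (w : Walk P c c) where

    east-step : ∀ x y → verticals w (1ℤ + x) y ≡ false → crossings w x y ≡ crossings w (1ℤ + x) y
    east-step x y off = xor≡false (trans (sym (xor-identityʳ _))
      (trans (cong ((crossings w x y xor crossings w (1ℤ + x) y) xor_) (sym off))
        (trans (telescope w x y) (xor-same (above c (1ℤ + x) y)))))

    constant-off : ∀ {Q d e} → (∀ {c} → Q c → ¬ P c) → Walk Q d e →
               crossings w (proj₁ d) (proj₂ d) ≡ crossings w (proj₁ e) (proj₂ e)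
    constant-off n (stop _) = refl
    constant-off n (step q (east u v) w′) =
      trans (east-step u v (verticals-off w _ _ (n (start w′)))) (constant-off n w′)
    constant-off n (step q (west u v) w′) =
      trans (sym (east-step u v (verticals-off w _ _ (n q)))) (constant-off n w′)
    constant-off n (step q (north u v) w′) =
      trans (crossings-off w u v (n (start w′))) (constant-off n w′)
    constant-off n (step q (south u v) w′) =
      trans (sym (crossings-off w u v (n q))) (constant-off n w′)

  -- The first walk is closed up through the centre. The loop uses the edge between the centre and
  -- the cell above it exactly once, so its parities to the left and to the right of the centre
  -- differ; the second walk avoids the loop and makes them equal.
  jordan : ∀ {P Q : Cell → Set} x y → (∀ {c} → Q c → ¬ P c) → ¬ P (1ℤ + x , 1ℤ + y) → ¬ Q (1ℤ + x , 1ℤ + y) →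
           Walk P (1ℤ + x , 1ℤ + (1ℤ + y)) (1ℤ + x , y) →
           Walk Q (1ℤ + (1ℤ + x) , 1ℤ + y) (x , 1ℤ + y) → ⊥
  jordan {P} {Q} x y Q∩P ¬Pc ¬Qc w w′ = true≢false contradiction
    where
    centre : Cell
    centre = 1ℤ + x , 1ℤ + y
    P′ : Cell → Set
    P′ c = P c ⊎ c ≡ centre
    tail : Walk P′ (1ℤ + x , y) centre
    tail = step (inj₁ (end w)) (north (1ℤ + x) y) (stop (inj₂ refl))
      where
      end : ∀ {P c d} → Walk P c d → P d
      end (stop p)     = p
      end (step _ _ w) = end w
    loop : Walk P′ centre centre
    loop = step (inj₂ refl) (north (1ℤ + x) (1ℤ + y)) (weaken inj₁ w ∙ tail)
    open Loop loop
    off : ∀ {c} → Q c → ¬ P′ c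
    off q (inj₁ p)    = Q∩P q p
    off q (inj₂ refl) = ¬Qc q
    W : ℤ → ℤ → Bool
    W = crossings loop
    centre-vertical : verticals loop (1ℤ + x) (1ℤ + y) ≡ true
    centre-vertical = cong₂ _xor_
      (cong₂ _∧_ (dec-true (1ℤ + x ℤₚ.≟ 1ℤ + x) refl) (dec-true (1ℤ + y ℤₚ.≟ 1ℤ + y) refl))
      (trans (verticals-∙ (weaken inj₁ w) tail _ _)
        (cong₂ _xor_ (trans (verticals-weaken inj₁ w _ _) (verticals-off w _ _ ¬Pc))
          (trans (xor-identityʳ _) (vanish (1ℤ + x) (1ℤ + x) y (1ℤ + y) λ { (_ , p) → ℤₚ.<-irrefl p (i<1+i y) }))))
    right : W (1ℤ + x) (1ℤ + y) ≡ W (1ℤ + (1ℤ + x)) (1ℤ + y)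
    right = east-step (1ℤ + x) (1ℤ + y) (verticals-off loop _ _ (off (start w′)))
    around : W (1ℤ + (1ℤ + x)) (1ℤ + y) ≡ W x (1ℤ + y)
    around = constant-off off w′
    contradiction : true ≡ false
    contradiction = begin
      true
        ≡⟨ sym centre-vertical ⟩
      verticals loop (1ℤ + x) (1ℤ + y)
        ≡⟨ cong (_xor verticals loop (1ℤ + x) (1ℤ + y)) (sym (trans (cong (W x (1ℤ + y) xor_) (trans right around)) (xor-same (W x (1ℤ + y))))) ⟩
      (W x (1ℤ + y) xor W (1ℤ + x) (1ℤ + y)) xor verticals loop (1ℤ + x) (1ℤ + y)
        ≡⟨ telescope loop x (1ℤ + y) ⟩
      above centre (1ℤ + x) (1ℤ + y) xor above centre (1ℤ + x) (1ℤ + y)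
        ≡⟨ xor-same (above centre (1ℤ + x) (1ℤ + y)) ⟩
      false ∎
      where open ≡-Reasoning
    true≢false : true ≡ false → ⊥
    true≢false ()

open Walks

-- From chains of touching rectangles to crossing walks

module Crossing where

  open import Data.Integer using (ℤ; +_; 0ℤ; 1ℤ; -1ℤ; _+_; _-_; -_; _≤_; _<_; ∣_∣; +≤+)

  data Chain {R : Set} (S : R → Set) (_~_ : R → R → Set) : R → R → Set where
    [_]  : ∀ {r} → S r → Chain S _~_ r r
    link : ∀ {r s t} → S r → r ~ s → Chain S _~_ s t → Chain S _~_ r t

  turn : ∀ {c d} → Adjacent c d → Adjacent d c
  turn (east x y)  = west x y
  turn (west x y)  = east x y
  turn (north x y) = south x y
  turn (south x y) = north x y

  reverse : ∀ {P c d} → Walk P c d → Walk P d c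
  reverse (stop p)     = stop p
  reverse (step p a w) = reverse w ∙ step (start w) (turn a) (stop p)

  private
    gap : ∀ {i j} → i ≤ j → j ≡ + ∣ j - i ∣ + i
    gap {i} {j} p = sym (trans (cong (_+ i) (ℤₚ.0≤i⇒+∣i∣≡i (ℤₚ.i≤j⇒0≤j-i p)))
      (trans (ℤₚ.+-assoc j (- i) i) (trans (cong (λ u → j + u) (ℤₚ.+-inverseˡ i)) (ℤₚ.+-identityʳ j))))

    next : ∀ n i → + suc n + i ≡ + n + (1ℤ + i)
    next n i = trans (cong (_+ i) (ℤₚ.+-comm 1ℤ (+ n))) (ℤₚ.+-assoc (+ n) 1ℤ i)

    1+≤ : ∀ n i → 1ℤ + i ≤ + suc n + i
    1+≤ n i = ℤₚ.+-monoˡ-≤ i (+≤+ (ℕ.s≤s ℕ.z≤n))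

  module Line (P : Cell → Set) where

    eastward : ∀ n i i′ j → i′ ≡ + n + i → (∀ {k} → i ≤ k → k ≤ i′ → P (k , j)) → Walk P (i , j) (i′ , j)
    eastward zero    i i′ j eq f with refl ← trans eq (ℤₚ.+-identityˡ i) = stop (f ℤₚ.≤-refl ℤₚ.≤-refl)
    eastward (suc n) i i′ j eq f =
      step (f ℤₚ.≤-refl (ℤₚ.≤-trans i≤1+i 1+i≤i′)) (east i j)
        (eastward n (1ℤ + i) i′ j (trans eq (next n i)) (f ∘ ℤₚ.≤-trans i≤1+i))
      where
      i≤1+i : i ≤ 1ℤ + i
      i≤1+i = ℤₚ.<⇒≤ (i<1+i i)
      1+i≤i′ : 1ℤ + i ≤ i′
      1+i≤i′ = subst (1ℤ + i ≤_) (sym eq) (1+≤ n i)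

    northward : ∀ n i j j′ → j′ ≡ + n + j → (∀ {k} → j ≤ k → k ≤ j′ → P (i , k)) → Walk P (i , j) (i , j′)
    northward zero    i j j′ eq f with refl ← trans eq (ℤₚ.+-identityˡ j) = stop (f ℤₚ.≤-refl ℤₚ.≤-refl)
    northward (suc n) i j j′ eq f =
      step (f ℤₚ.≤-refl (ℤₚ.≤-trans j≤1+j 1+j≤j′)) (north i j)
        (northward n i (1ℤ + j) j′ (trans eq (next n j)) (f ∘ ℤₚ.≤-trans j≤1+j))
      where
      j≤1+j : j ≤ 1ℤ + j
      j≤1+j = ℤₚ.<⇒≤ (i<1+i j)
      1+j≤j′ : 1ℤ + j ≤ j′
      1+j≤j′ = subst (1ℤ + j ≤_) (sym eq) (1+≤ n j)

  record Block : Set where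
    constructor block
    field
      left right bottom top : ℤ

  data _∋_ : Block → Cell → Set where
    within : ∀ {l r b t i j} → l ≤ i → i < r → b ≤ j → j < t → block l r b t ∋ (i , j)

  blockWalk : ∀ {B c d} → B ∋ c → B ∋ d → Walk (B ∋_) c d
  blockWalk {B} (within {i = i} {j} l≤i i<r b≤j j<t) (within {i = i′} {j′} l≤i′ i′<r b≤j′ j′<t) = horizontal ∙ vertical
    where
    open Line (B ∋_)
    horizontal : Walk (B ∋_) (i , j) (i′ , j)
    horizontal with ℤₚ.≤-total i i′
    ... | inj₁ p = eastward _ i i′ j (gap p)
      (λ q r → within (ℤₚ.≤-trans l≤i q) (ℤₚ.≤-<-trans r i′<r) b≤j j<t)
    ... | inj₂ p = reverse (eastward _ i′ i j (gap p)
      (λ q r → within (ℤₚ.≤-trans l≤i′ q) (ℤₚ.≤-<-trans r i<r) b≤j j<t))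
    vertical : Walk (B ∋_) (i′ , j) (i′ , j′)
    vertical with ℤₚ.≤-total j j′
    ... | inj₁ p = northward _ i′ j j′ (gap p)
      (λ q r → within l≤i′ i′<r (ℤₚ.≤-trans b≤j q) (ℤₚ.≤-<-trans r j′<t))
    ... | inj₂ p = reverse (northward _ i′ j′ j (gap p)
      (λ q r → within l≤i′ i′<r (ℤₚ.≤-trans b≤j′ q) (ℤₚ.≤-<-trans r j<t)))

  -- A block written with the coordinates of the rectangles at hand; cells enter formulas as rectangles
  -- of which only the corner is used.
  record Blockᶠ (n : ℕ) : Set where
    constructor blockᶠ
    field
      left right bottom top : Term n

  open Blockᶠ

  thrice : ∀ {n} → Term n → Term n
  thrice t = t ⊕ t ⊕ t

  -- Coordinates are tripled to leave room inside a rectangle of width 1.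
  tripled : ∀ {n} → Fin n → Blockᶠ n
  tripled i = blockᶠ (thrice (X i)) (thrice (X⁺ i)) (thrice (Y i)) (thrice (Y⁺ i))

  inBlock : ∀ {n} → Blockᶠ n → Fin n → Formula n
  inBlock B c = left B ≤ᶠ X c ∧ᶠ X c <ᶠ right B ∧ᶠ bottom B ≤ᶠ Y c ∧ᶠ Y c <ᶠ top B

  -- The left side of `u` marks a column of `v` and the bottom of `r` marks a row of `v`; these
  -- locate the centre where the two walks cross. The disjunctions cover both kinds of reducible
  -- rectangle: next to a corner `l` may sit on top, left of `u`, and `d` on the right, below `r`.
  crossing : ∀ {n} (v u l d r : Fin n) → Formula n
  crossing v u l d r =
    (below v u ∧ᶠ X v ≤ᶠ X u) ∧ᶠ
    (leftOf v r ∧ᶠ Y v ≤ᶠ Y r) ∧ᶠ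
    ((leftOf l v ∧ᶠ Y⁺ v ≤ᶠ Y⁺ l) ∨ᶠ (below v l ∧ᶠ X l <ᶠ X v ∧ᶠ X⁺ l ≤ᶠ X u)) ∧ᶠ
    (below d v ∨ᶠ (leftOf v d ∧ᶠ Y⁺ d ≤ᶠ Y r))

  -- With v, u and r as the rectangles 0, 1 and 2: the centre is the cell (3 x u + 1 , 3 y r + 1) of v, and
  -- these parts of v lead from the sides of the centre to the neighbours of v.
  module _ {n : ℕ} where

    upᶠ downᶠ leftᶠ rightᶠ centreᶠ : Blockᶠ (3 ℕ.+ n)
    upᶠ     = blockᶠ (♯ (+ 1) ⊕ thrice (X 1F)) (♯ (+ 2) ⊕ thrice (X 1F)) (♯ (+ 2) ⊕ thrice (Y 2F)) (thrice (Y⁺ 0F))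
    -- This part alone has the full width of `v`, so `d` may be met below or on the right. The left
    -- and right parts start at the row of the centre and hence stay clear of it.
    downᶠ   = blockᶠ (thrice (X 0F)) (thrice (X⁺ 0F)) (thrice (Y 0F)) (♯ (+ 1) ⊕ thrice (Y 2F))
    leftᶠ   = blockᶠ (thrice (X 0F)) (♯ (+ 1) ⊕ thrice (X 1F)) (♯ (+ 1) ⊕ thrice (Y 2F)) (thrice (Y⁺ 0F))
    rightᶠ  = blockᶠ (♯ (+ 2) ⊕ thrice (X 1F)) (thrice (X⁺ 0F)) (♯ (+ 1) ⊕ thrice (Y 2F)) (thrice (Y⁺ 0F))
    centreᶠ = blockᶠ (♯ (+ 1) ⊕ thrice (X 1F)) (♯ (+ 2) ⊕ thrice (X 1F)) (♯ (+ 1) ⊕ thrice (Y 2F)) (♯ (+ 2) ⊕ thrice (Y 2F))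

    frame : Formula (3 ℕ.+ n)
    frame = below 0F 1F ∧ᶠ X 0F ≤ᶠ X 1F ∧ᶠ leftOf 0F 2F ∧ᶠ Y 0F ≤ᶠ Y 2F

  meets : Blockᶠ 5 → List (Formula 5)
  meets B = frame ∷ is o₁ 3F ∷ inBlock B 3F ∷ inBlock (tripled 4F) 3F ∷ disjoint 0F 4F ∷ []

  coincide : Blockᶠ 4 → Blockᶠ 4 → List (Formula 4)
  coincide B C = frame ∷ is o₁ 3F ∷ inBlock B 3F ∷ inBlock C 3F ∷ []

  module Chains (a b : ℤ) (0<b : 0ℤ < b) (b≤a : b ≤ a) {R : Set} (at : R → Pos) where

    open Semantics a b 0<b b≤a

    Contact : R → R → Set
    Contact r s = ⟦ touch 0F 1F ⟧ (at r ∷ at s ∷ [])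

    ⟦_⟧ᵇ : ∀ {n} → Blockᶠ n → Vec Pos n → Block
    ⟦ B ⟧ᵇ rs = block (⟦ left B ⟧ᵗ rs) (⟦ right B ⟧ᵗ rs) (⟦ bottom B ⟧ᵗ rs) (⟦ top B ⟧ᵗ rs)

    cell : Cell → Pos
    cell (i , j) = pos i j o₁

    toBlock : ∀ {l r b t i j} → l ≤ i × i < r × b ≤ j × j < t → block l r b t ∋ (i , j)
    toBlock (p , q , p′ , q′) = within p q p′ q′

    fromBlock : ∀ {l r b t i j} → block l r b t ∋ (i , j) → l ≤ i × i < r × b ≤ j × j < t
    fromBlock (within p q p′ q′) = p , q , p′ , q′

    cells : R → Block
    cells r = ⟦ tripled 0F ⟧ᵇ (at r ∷ [])

    private
      max : ∀ i j → ∃ λ k → i ≤ k × j ≤ k × (k ≡ i ⊎ k ≡ j)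
      max i j with ℤₚ.≤-total i j
      ... | inj₁ p = j , p , ℤₚ.≤-refl , inj₂ refl
      ... | inj₂ p = i , ℤₚ.≤-refl , p , inj₁ refl

    -- With `k` the larger of the two lower ends, the refined row 3k + 1 runs through both
    -- rectangles; their common side separates the columns 3x - 1 and 3x, where x is the left end of
    -- `s`.
    sideCells : ∀ r s → ⟦ leftOf 0F 1F ⟧ (at r ∷ at s ∷ []) → ∃₂ λ c d → cells r ∋ c × cells s ∋ d × Adjacent c d
    sideCells r s p with max (y (at r)) (y (at s))
    ... | k , r≤k , s≤k , k≡ =
      (i , j) , (1ℤ + i , j) ,
      toBlock (prove rs (inBlock (tripled 0F) 3F) φs ps) ,
      toBlock (prove rs (inBlock (tripled 1F) 4F) φs ps) ,
      east i j
      where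
      i j : ℤ
      i = -1ℤ + (x (at s) + x (at s) + x (at s))
      j = 1ℤ + (k + k + k)
      rs : Vec Pos 5
      rs = at r ∷ at s ∷ pos k k o₁ ∷ pos i j o₁ ∷ pos (1ℤ + i) j o₁ ∷ []
      φs : List (Formula 5)
      φs = is o₁ 2F ∷ is o₁ 3F ∷ is o₁ 4F ∷ leftOf 0F 1F ∷ Y 0F ≤ᶠ Y 2F ∷ Y 1F ≤ᶠ Y 2F ∷ X 3F ≡ᶠ ♯ -1ℤ ⊕ thrice (X 1F) ∷ X 4F ≡ᶠ ♯ 1ℤ ⊕ X 3F ∷
           Y 3F ≡ᶠ ♯ 1ℤ ⊕ thrice (Y 2F) ∷ Y 4F ≡ᶠ Y 3F ∷ (Y 2F ≡ᶠ Y 0F ∨ᶠ Y 2F ≡ᶠ Y 1F) ∷ []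
      ps : All (λ φ → ⟦ φ ⟧ rs) φs
      -- New cells enter as rectangles whose coordinates are definitionally the values of the terms
      -- describing them, so these equations hold by `refl`.
      ps = refl ∷ refl ∷ refl ∷ p ∷ r≤k ∷ s≤k ∷ refl ∷ refl ∷ refl ∷ refl ∷ k≡ ∷ []

    faceCells : ∀ r s → ⟦ below 0F 1F ⟧ (at r ∷ at s ∷ []) → ∃₂ λ c d → cells r ∋ c × cells s ∋ d × Adjacent c d
    faceCells r s p with max (x (at r)) (x (at s))
    ... | k , r≤k , s≤k , k≡ =
      (i , j) , (i , 1ℤ + j) ,
      toBlock (prove rs (inBlock (tripled 0F) 3F) φs ps) ,
      toBlock (prove rs (inBlock (tripled 1F) 4F) φs ps) ,
      north i j
      where
      i j : ℤ
      i = 1ℤ + (k + k + k)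
      j = -1ℤ + (y (at s) + y (at s) + y (at s))
      rs : Vec Pos 5
      rs = at r ∷ at s ∷ pos k k o₁ ∷ pos i j o₁ ∷ pos i (1ℤ + j) o₁ ∷ []
      φs : List (Formula 5)
      φs = is o₁ 2F ∷ is o₁ 3F ∷ is o₁ 4F ∷ below 0F 1F ∷ X 0F ≤ᶠ X 2F ∷ X 1F ≤ᶠ X 2F ∷ Y 3F ≡ᶠ ♯ -1ℤ ⊕ thrice (Y 1F) ∷ Y 4F ≡ᶠ ♯ 1ℤ ⊕ Y 3F ∷
           X 3F ≡ᶠ ♯ 1ℤ ⊕ thrice (X 2F) ∷ X 4F ≡ᶠ X 3F ∷ (X 2F ≡ᶠ X 0F ∨ᶠ X 2F ≡ᶠ X 1F) ∷ []
      ps : All (λ φ → ⟦ φ ⟧ rs) φs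
      ps = refl ∷ refl ∷ refl ∷ p ∷ r≤k ∷ s≤k ∷ refl ∷ refl ∷ refl ∷ refl ∷ k≡ ∷ []

    touchCells : ∀ r s → Contact r s → ∃₂ λ c d → cells r ∋ c × cells s ∋ d × Adjacent c d
    touchCells r s (inj₁ p)               = sideCells r s p
    touchCells r s (inj₂ (inj₂ (inj₁ p))) = faceCells r s p
    touchCells r s (inj₂ (inj₁ p)) with sideCells s r p
    ... | c , d , c∈ , d∈ , a = d , c , d∈ , c∈ , turn a
    touchCells r s (inj₂ (inj₂ (inj₂ p))) with faceCells s r p
    ... | c , d , c∈ , d∈ , a = d , c , d∈ , c∈ , turn a

    Covered : (R → Set) → Cell → Set
    Covered S c = ∃ λ k → S k × cells k ∋ c

    chainWalk : ∀ {S r s} → Chain S Contact r s → ∀ {c d} → cells r ∋ c → cells s ∋ d → Walk (Covered S) c d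
    chainWalk [ q ]        c∈ d∈ = weaken (λ e → _ , q , e) (blockWalk c∈ d∈)
    chainWalk (link {r} {s} q t ch) c∈ d∈ with touchCells r s t
    ... | e , f , e∈ , f∈ , a =
      weaken (λ g → r , q , g) (blockWalk c∈ e∈) ∙ step (r , q , e∈) a (chainWalk ch f∈ d∈)

    module _ {xs : List R} (sep : ∀ {r s} → r ∈ xs → s ∈ xs → r ≢ s → ⟦ disjoint 0F 1F ⟧ (at r ∷ at s ∷ []))
             {v u l d r : R} (v∈ : v ∈ xs) {S S′ : R → Set}
             (S⊆ : ∀ {k} → S k → k ∈ xs × k ≢ v) (S′⊆ : ∀ {k} → S′ k → k ∈ xs × k ≢ v)
             (S∩S′ : ∀ {k} → S k → S′ k → ⊥) where

      private
        vs : Vec Pos 3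
        vs = at v ∷ at u ∷ at r ∷ []

        U D L R′ : Block
        U  = ⟦ upᶠ ⟧ᵇ vs
        D  = ⟦ downᶠ ⟧ᵇ vs
        L  = ⟦ leftᶠ ⟧ᵇ vs
        R′ = ⟦ rightᶠ ⟧ᵇ vs

        P Q : Cell → Set
        P c = Covered S c ⊎ (U ∋ c ⊎ D ∋ c)
        Q c = Covered S′ c ⊎ (L ∋ c ⊎ R′ ∋ c)

        X₃ Y₃ : ℤ
        X₃ = x (at u) + x (at u) + x (at u)
        Y₃ = y (at r) + y (at r) + y (at r)

      -- Each chain gives a walk outside `v`. Completed by the upper and lower parts of `v`,
      -- respectively by the left and right parts, the two become disjoint walks joining opposite
      -- sides of the centre, against `jordan`.
      noCrossing : ⟦ crossing 0F 1F 2F 3F 4F ⟧ (at v ∷ at u ∷ at l ∷ at d ∷ at r ∷ []) →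
                   Chain S Contact u d → Chain S′ Contact l r → ⊥
      noCrossing ((v↑u , v≤u) , (v→r , v≤r) , lcase , dcase) chain chain′ = jordan X₃ Y₃ Q∩P offP offQ vertical horizontal
        where
        framed : ⟦ frame ⟧ vs
        framed = v↑u , v≤u , v→r , v≤r

        clash : ∀ {k c} (B : Blockᶠ 5) {_ : T (absurd (meets B))} → k ∈ xs × k ≢ v → cells k ∋ c →
                ⟦ inBlock B 3F ⟧ (at v ∷ at u ∷ at r ∷ cell c ∷ at k ∷ []) → ⊥
        clash {k} {c} B {t} (k∈ , k≢v) c∈ p = refute (at v ∷ at u ∷ at r ∷ cell c ∷ at k ∷ []) (meets B) {t}
          (framed ∷ refl ∷ p ∷ fromBlock c∈ ∷ sep v∈ k∈ (λ q → k≢v (sym q)) ∷ [])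

        clashParts : ∀ {c} (B C : Blockᶠ 4) {_ : T (absurd (coincide B C))} →
                     ⟦ inBlock B 3F ⟧ (at v ∷ at u ∷ at r ∷ cell c ∷ []) →
                     ⟦ inBlock C 3F ⟧ (at v ∷ at u ∷ at r ∷ cell c ∷ []) → ⊥
        clashParts {c} B C {t} p q = refute (at v ∷ at u ∷ at r ∷ cell c ∷ []) (coincide B C) {t}
          (framed ∷ refl ∷ p ∷ q ∷ [])

        Q∩P : ∀ {c} → Q c → ¬ P c
        Q∩P (inj₁ (k′ , s′ , c∈′)) (inj₁ (k , s , c∈)) =
          refute (at k ∷ at k′ ∷ cell _ ∷ [])
            (is o₁ 2F ∷ inBlock (tripled 0F) 2F ∷ inBlock (tripled 1F) 2F ∷ disjoint 0F 1F ∷ [])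
            (refl ∷ fromBlock c∈ ∷ fromBlock c∈′ ∷
             sep (proj₁ (S⊆ s)) (proj₁ (S′⊆ s′)) (λ { refl → S∩S′ s s′ }) ∷ [])
        Q∩P (inj₁ (_ , s′ , c∈)) (inj₂ (inj₁ p)) = clash upᶠ (S′⊆ s′) c∈ (fromBlock p)
        Q∩P (inj₁ (_ , s′ , c∈)) (inj₂ (inj₂ p)) = clash downᶠ (S′⊆ s′) c∈ (fromBlock p)
        Q∩P (inj₂ (inj₁ p)) (inj₁ (_ , s , c∈))  = clash leftᶠ (S⊆ s) c∈ (fromBlock p)
        Q∩P (inj₂ (inj₂ p)) (inj₁ (_ , s , c∈))  = clash rightᶠ (S⊆ s) c∈ (fromBlock p)
        Q∩P (inj₂ (inj₁ p)) (inj₂ (inj₁ q)) = clashParts leftᶠ upᶠ (fromBlock p) (fromBlock q)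
        Q∩P (inj₂ (inj₁ p)) (inj₂ (inj₂ q)) = clashParts leftᶠ downᶠ (fromBlock p) (fromBlock q)
        Q∩P (inj₂ (inj₂ p)) (inj₂ (inj₁ q)) = clashParts rightᶠ upᶠ (fromBlock p) (fromBlock q)
        Q∩P (inj₂ (inj₂ p)) (inj₂ (inj₂ q)) = clashParts rightᶠ downᶠ (fromBlock p) (fromBlock q)

        centre : ⟦ inBlock centreᶠ 3F ⟧ (at v ∷ at u ∷ at r ∷ cell (1ℤ + X₃ , 1ℤ + Y₃) ∷ [])
        centre = prove (at v ∷ at u ∷ at r ∷ cell (1ℤ + X₃ , 1ℤ + Y₃) ∷ []) (inBlock centreᶠ 3F)
          (is o₁ 3F ∷ X 3F ≡ᶠ ♯ 1ℤ ⊕ thrice (X 1F) ∷ Y 3F ≡ᶠ ♯ 1ℤ ⊕ thrice (Y 2F) ∷ []) (refl ∷ refl ∷ refl ∷ [])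

        offP : ¬ P (1ℤ + X₃ , 1ℤ + Y₃)
        offP (inj₁ (_ , s , c∈)) = clash centreᶠ (S⊆ s) c∈ centre
        offP (inj₂ (inj₁ p))     = clashParts upᶠ centreᶠ (fromBlock p) centre
        offP (inj₂ (inj₂ p))     = clashParts downᶠ centreᶠ (fromBlock p) centre

        offQ : ¬ Q (1ℤ + X₃ , 1ℤ + Y₃)
        offQ (inj₁ (_ , s , c∈)) = clash centreᶠ (S′⊆ s) c∈ centre
        offQ (inj₂ (inj₁ p))     = clashParts leftᶠ centreᶠ (fromBlock p) centre
        offQ (inj₂ (inj₂ p))     = clashParts rightᶠ centreᶠ (fromBlock p) centre

        at₄ : Cell → Vec Pos 4
        at₄ c = at v ∷ at u ∷ at r ∷ cell c ∷ []

        Y⁺₃ : ℤ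
        Y⁺₃ = y⁺ (at v) + y⁺ (at v) + y⁺ (at v)
        X⁺₃ : ℤ
        X⁺₃ = x⁺ (at v) + x⁺ (at v) + x⁺ (at v)
        xv₃ yv₃ : ℤ
        xv₃ = x (at v) + x (at v) + x (at v)
        yv₃ = y (at v) + y (at v) + y (at v)

        vertical : Walk P (1ℤ + X₃ , 1ℤ + (1ℤ + Y₃)) (1ℤ + X₃ , Y₃)
        vertical = weaken (inj₂ ∘ inj₁) (blockWalk first last)
                 ∙ step (inj₂ (inj₁ last)) (north (1ℤ + X₃) (-1ℤ + Y⁺₃)) (toD dcase)
          where
          first : U ∋ (1ℤ + X₃ , 1ℤ + (1ℤ + Y₃))
          first = toBlock (prove (at₄ _) (inBlock upᶠ 3F)
            (frame ∷ is o₁ 3F ∷ X 3F ≡ᶠ ♯ 1ℤ ⊕ thrice (X 1F) ∷ Y 3F ≡ᶠ ♯ 1ℤ ⊕ (♯ 1ℤ ⊕ thrice (Y 2F)) ∷ [])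
            (framed ∷ refl ∷ refl ∷ refl ∷ []))
          last : U ∋ (1ℤ + X₃ , -1ℤ + Y⁺₃)
          last = toBlock (prove (at₄ _) (inBlock upᶠ 3F)
            (frame ∷ is o₁ 3F ∷ X 3F ≡ᶠ ♯ 1ℤ ⊕ thrice (X 1F) ∷ Y 3F ≡ᶠ ♯ -1ℤ ⊕ thrice (Y⁺ 0F) ∷ [])
            (framed ∷ refl ∷ refl ∷ refl ∷ []))
          inU : cells u ∋ (1ℤ + X₃ , 1ℤ + (-1ℤ + Y⁺₃))
          inU = toBlock (prove (at₄ _) (inBlock (tripled 1F) 3F)
            (frame ∷ is o₁ 3F ∷ X 3F ≡ᶠ ♯ 1ℤ ⊕ thrice (X 1F) ∷ Y 3F ≡ᶠ ♯ 1ℤ ⊕ (♯ -1ℤ ⊕ thrice (Y⁺ 0F)) ∷ [])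
            (framed ∷ refl ∷ refl ∷ refl ∷ []))
          bottom-cell : D ∋ (1ℤ + X₃ , Y₃)
          bottom-cell = toBlock (prove (at₄ _) (inBlock downᶠ 3F)
            (frame ∷ is o₁ 3F ∷ X 3F ≡ᶠ ♯ 1ℤ ⊕ thrice (X 1F) ∷ Y 3F ≡ᶠ thrice (Y 2F) ∷ [])
            (framed ∷ refl ∷ refl ∷ refl ∷ []))
          through : ∀ {c e} → cells d ∋ c → Adjacent c e → D ∋ e → Walk P (1ℤ + X₃ , 1ℤ + (-1ℤ + Y⁺₃)) (1ℤ + X₃ , Y₃)
          through c∈ a e∈ = weaken inj₁ w ∙ step (inj₁ (start (reverse w))) a
                              (weaken (inj₂ ∘ inj₂) (blockWalk e∈ bottom-cell))
            where
            w : Walk (Covered S) _ _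
            w = chainWalk chain inU c∈
          toD : ⟦ below 1F 0F ∨ᶠ (leftOf 0F 1F ∧ᶠ Y⁺ 1F ≤ᶠ Y 2F) ⟧ (at v ∷ at d ∷ at r ∷ []) →
                Walk P (1ℤ + X₃ , 1ℤ + (-1ℤ + Y⁺₃)) (1ℤ + X₃ , Y₃)
          toD (inj₁ p) with max (x (at v)) (x (at d))
          ... | k , v≤k , d≤k , k≡ = through
              (toBlock (prove rs (inBlock (tripled 3F) 4F) φs ps)) (north i j) (toBlock (prove rs (inBlock downᶠ 5F) φs ps))
            where
            i j : ℤ
            i = 1ℤ + (k + k + k)
            j = -1ℤ + yv₃
            rs : Vec Pos 7
            rs = at v ∷ at u ∷ at r ∷ at d ∷ pos i j o₁ ∷ pos i (1ℤ + j) o₁ ∷ pos k k o₁ ∷ []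
            φs : List (Formula 7)
            φs = is o₁ 4F ∷ is o₁ 5F ∷ is o₁ 6F ∷ Y 0F ≤ᶠ Y 2F ∷ below 3F 0F ∷
                 X 0F ≤ᶠ X 6F ∷ X 3F ≤ᶠ X 6F ∷ X 4F ≡ᶠ ♯ 1ℤ ⊕ thrice (X 6F) ∷ Y 4F ≡ᶠ ♯ -1ℤ ⊕ thrice (Y 0F) ∷
                 X 5F ≡ᶠ X 4F ∷ Y 5F ≡ᶠ ♯ 1ℤ ⊕ Y 4F ∷ (X 6F ≡ᶠ X 0F ∨ᶠ X 6F ≡ᶠ X 3F) ∷ []
            ps : All (λ φ → ⟦ φ ⟧ rs) φs
            ps = refl ∷ refl ∷ refl ∷ v≤r ∷ p ∷ v≤k ∷ d≤k ∷ refl ∷ refl ∷ refl ∷ refl ∷ k≡ ∷ []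
          toD (inj₂ (p , d≤r)) with max (y (at v)) (y (at d))
          ... | k , v≤k , d≤k , k≡ = through
              (toBlock (prove rs (inBlock (tripled 3F) 4F) φs ps)) (west i j) (toBlock (prove rs (inBlock downᶠ 5F) φs ps))
            where
            i j : ℤ
            i = -1ℤ + X⁺₃
            j = 1ℤ + (k + k + k)
            rs : Vec Pos 7
            rs = at v ∷ at u ∷ at r ∷ at d ∷ pos (1ℤ + i) j o₁ ∷ pos i j o₁ ∷ pos k k o₁ ∷ []
            φs : List (Formula 7)
            φs = is o₁ 4F ∷ is o₁ 5F ∷ is o₁ 6F ∷ leftOf 0F 3F ∷ Y⁺ 3F ≤ᶠ Y 2F ∷
                 Y 0F ≤ᶠ Y 6F ∷ Y 3F ≤ᶠ Y 6F ∷ Y 4F ≡ᶠ ♯ 1ℤ ⊕ thrice (Y 6F) ∷ X 5F ≡ᶠ ♯ -1ℤ ⊕ thrice (X⁺ 0F) ∷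
                 Y 5F ≡ᶠ Y 4F ∷ X 4F ≡ᶠ ♯ 1ℤ ⊕ X 5F ∷ (Y 6F ≡ᶠ Y 0F ∨ᶠ Y 6F ≡ᶠ Y 3F) ∷ []
            ps : All (λ φ → ⟦ φ ⟧ rs) φs
            ps = refl ∷ refl ∷ refl ∷ p ∷ d≤r ∷ v≤k ∷ d≤k ∷ refl ∷ refl ∷ refl ∷ refl ∷ k≡ ∷ []

        horizontal : Walk Q (1ℤ + (1ℤ + X₃) , 1ℤ + Y₃) (X₃ , 1ℤ + Y₃)
        horizontal = weaken (inj₂ ∘ inj₂) (blockWalk first last)
                   ∙ step (inj₂ (inj₂ last)) (east (-1ℤ + X⁺₃) (1ℤ + Y₃)) (toL lcase)
          where
          first : R′ ∋ (1ℤ + (1ℤ + X₃) , 1ℤ + Y₃)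
          first = toBlock (prove (at₄ _) (inBlock rightᶠ 3F)
            (frame ∷ is o₁ 3F ∷ X 3F ≡ᶠ ♯ 1ℤ ⊕ (♯ 1ℤ ⊕ thrice (X 1F)) ∷ Y 3F ≡ᶠ ♯ 1ℤ ⊕ thrice (Y 2F) ∷ [])
            (framed ∷ refl ∷ refl ∷ refl ∷ []))
          last : R′ ∋ (-1ℤ + X⁺₃ , 1ℤ + Y₃)
          last = toBlock (prove (at₄ _) (inBlock rightᶠ 3F)
            (frame ∷ is o₁ 3F ∷ X 3F ≡ᶠ ♯ -1ℤ ⊕ thrice (X⁺ 0F) ∷ Y 3F ≡ᶠ ♯ 1ℤ ⊕ thrice (Y 2F) ∷ [])
            (framed ∷ refl ∷ refl ∷ refl ∷ []))
          inR : cells r ∋ (1ℤ + (-1ℤ + X⁺₃) , 1ℤ + Y₃)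
          inR = toBlock (prove (at₄ _) (inBlock (tripled 2F) 3F)
            (frame ∷ is o₁ 3F ∷ X 3F ≡ᶠ ♯ 1ℤ ⊕ (♯ -1ℤ ⊕ thrice (X⁺ 0F)) ∷ Y 3F ≡ᶠ ♯ 1ℤ ⊕ thrice (Y 2F) ∷ [])
            (framed ∷ refl ∷ refl ∷ refl ∷ []))
          left-cell : L ∋ (X₃ , 1ℤ + Y₃)
          left-cell = toBlock (prove (at₄ _) (inBlock leftᶠ 3F)
            (frame ∷ is o₁ 3F ∷ X 3F ≡ᶠ thrice (X 1F) ∷ Y 3F ≡ᶠ ♯ 1ℤ ⊕ thrice (Y 2F) ∷ [])
            (framed ∷ refl ∷ refl ∷ refl ∷ []))
          through : ∀ {c e} → cells l ∋ c → Adjacent c e → L ∋ e → Walk Q (1ℤ + (-1ℤ + X⁺₃) , 1ℤ + Y₃) (X₃ , 1ℤ + Y₃)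
          through c∈ a e∈ = weaken inj₁ (reverse w) ∙ step (inj₁ (start w)) a
                              (weaken (inj₂ ∘ inj₁) (blockWalk e∈ left-cell))
            where
            w : Walk (Covered S′) _ _
            w = chainWalk chain′ c∈ inR
          toL : ⟦ (leftOf 1F 0F ∧ᶠ Y⁺ 0F ≤ᶠ Y⁺ 1F) ∨ᶠ (below 0F 1F ∧ᶠ X 1F <ᶠ X 0F ∧ᶠ X⁺ 1F ≤ᶠ X 2F) ⟧ (at v ∷ at l ∷ at u ∷ []) →
                Walk Q (1ℤ + (-1ℤ + X⁺₃) , 1ℤ + Y₃) (X₃ , 1ℤ + Y₃)
          toL (inj₁ (p , v≤l)) = through
              (toBlock (prove (at l ∷ at v ∷ cell c ∷ []) (inBlock (tripled 0F) 2F)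
                (is o₁ 2F ∷ leftOf 0F 1F ∷ Y⁺ 1F ≤ᶠ Y⁺ 0F ∷
                 X 2F ≡ᶠ ♯ -1ℤ ⊕ thrice (X 1F) ∷ Y 2F ≡ᶠ ♯ (- (+ 2)) ⊕ thrice (Y⁺ 1F) ∷ [])
                (refl ∷ p ∷ v≤l ∷ refl ∷ refl ∷ [])))
              (east (proj₁ c) (proj₂ c))
              (toBlock (prove (at₄ (1ℤ + proj₁ c , proj₂ c)) (inBlock leftᶠ 3F)
                (is o₁ 3F ∷ X 0F ≤ᶠ X 1F ∷ Y 2F <ᶠ Y⁺ 0F ∷
                 X 3F ≡ᶠ ♯ 1ℤ ⊕ (♯ -1ℤ ⊕ thrice (X 0F)) ∷ Y 3F ≡ᶠ ♯ (- (+ 2)) ⊕ thrice (Y⁺ 0F) ∷ [])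
                (refl ∷ v≤u ∷ proj₂ (proj₂ v→r) ∷ refl ∷ refl ∷ [])))
            where
            -- This row lies in the topmost unit of `v`: `l` covers it because its top is no lower,
            -- and it is not below the row of the centre because `r` starts below the top of `v`.
            c : Cell
            c = -1ℤ + xv₃ , - (+ 2) + Y⁺₃
          toL (inj₂ (p , l<v , l≤u)) = through
              (toBlock (prove (at l ∷ at v ∷ cell (proj₁ c , 1ℤ + proj₂ c) ∷ []) (inBlock (tripled 0F) 2F)
                (is o₁ 2F ∷ below 1F 0F ∷ X 0F <ᶠ X 1F ∷
                 X 2F ≡ᶠ ♯ 1ℤ ⊕ thrice (X 1F) ∷ Y 2F ≡ᶠ ♯ 1ℤ ⊕ (♯ -1ℤ ⊕ thrice (Y⁺ 1F)) ∷ [])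
                (refl ∷ p ∷ l<v ∷ refl ∷ refl ∷ [])))
              (south (proj₁ c) (proj₂ c))
              (toBlock (prove (at₄ c) (inBlock leftᶠ 3F)
                (is o₁ 3F ∷ X 0F <ᶠ X 1F ∷ Y 2F <ᶠ Y⁺ 0F ∷
                 X 3F ≡ᶠ ♯ 1ℤ ⊕ thrice (X 0F) ∷ Y 3F ≡ᶠ ♯ -1ℤ ⊕ thrice (Y⁺ 0F) ∷ [])
                (refl ∷ ℤₚ.<-≤-trans (proj₁ (proj₂ p)) l≤u ∷ proj₂ (proj₂ v→r) ∷ refl ∷ refl ∷ [])))
            where
            c : Cell
            c = 1ℤ + xv₃ , -1ℤ + Y⁺₃

open Crossing

-- Reducible rectangles: four slots for the neighbours

module Slots where

  open import Data.Integer using (ℤ; 0ℤ; _≤_; _<_)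

  -- The neighbours of v occupy at most four slots, in the cyclic order 0, 1, 2, 3.
  record Reducible {R : Set} (xs : List R) (_~_ : R → R → Set) (v : R) : Set₁ where
    field
      member    : v ∈ xs
      slot      : Fin 4 → R → Set
      slot?     : ∀ i → Decidable (slot i)
      covered   : ∀ {k} → k ∈ xs → v ~ k → ∃ λ i → slot i k
      unique    : ∀ i {k k′} → k ∈ xs → k′ ∈ xs → slot i k → slot i k′ → k ≡ k′
      -- The only trace of planarity that Kempe's argument uses.
      uncrossed : ∀ {u l d r} → u ∈ xs → l ∈ xs → d ∈ xs → r ∈ xs →
                  slot 0F u → slot 1F l → slot 2F d → slot 3F r →
                  ∀ {S S′ : R → Set} → (∀ {k} → S k → k ∈ xs × k ≢ v) → (∀ {k} → S′ k → k ∈ xs × k ≢ v) →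
                  (∀ {k} → S k → S′ k → ⊥) → Chain S _~_ u d → Chain S′ _~_ l r → ⊥

  mapChain : ∀ {R : Set} {S : R → Set} {_~_ _≈_ : R → R → Set} → (∀ {r s} → r ~ s → r ≈ s) →
             ∀ {r s} → Chain S _~_ r s → Chain S _≈_ r s
  mapChain f [ p ]         = [ p ]
  mapChain f (link p q ch) = link p (f q) (mapChain f ch)

  mapReducible : ∀ {R : Set} {xs : List R} {_~_ _≈_ : R → R → Set} → (∀ {r s} → r ≈ s → r ~ s) →
                 ∀ {v} → Reducible xs _~_ v → Reducible xs _≈_ v
  mapReducible f red = record
    { member = member ; slot = slot ; slot? = slot? ; covered = λ i t → covered i (f t) ; unique = unique
    ; uncrossed = λ i j k l p q r s S⊆ S′⊆ S∩S′ ch ch′ →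
        uncrossed i j k l p q r s S⊆ S′⊆ S∩S′ (mapChain f ch) (mapChain f ch′) }
    where open Reducible red

  module _ {n} (v k : Fin n) where

    -- Slots of a corner itself, and of the lowest flush rectangle on its right.
    cornerSlot flushSlot : Fin 4 → Formula n
    cornerSlot 0F = below v k ∧ᶠ X v ≤ᶠ X k
    cornerSlot 1F = leftOf k v ∨ᶠ (below v k ∧ᶠ X k <ᶠ X v)
    cornerSlot 2F = leftOf v k ∧ᶠ is o₁ k
    cornerSlot 3F = leftOf v k ∧ᶠ is o₂ k
    flushSlot 0F = below v k
    flushSlot 1F = leftOf k v
    flushSlot 2F = below k v ∨ᶠ (leftOf v k ∧ᶠ Y k <ᶠ Y v)
    flushSlot 3F = leftOf v k ∧ᶠ Y v ≤ᶠ Y k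

  module _ (a b : ℤ) (0<b : 0ℤ < b) (b≤a : b ≤ a) {R : Set} (_≟_ : DecidableEquality R) where

    open Semantics a b 0<b b≤a

    module VerticalCorner (at : R → Pos) (xs : List R)
           (sep : ∀ {r s} → r ∈ xs → s ∈ xs → r ≢ s → ⟦ disjoint 0F 1F ⟧ (at r ∷ at s ∷ [])) where

      open Extremal a b 0<b b≤a _≟_ at xs
      open Chains a b 0<b b≤a at

      apart! : ∀ {r s} → r ∈ xs → s ∈ xs → ⟦ apart 0F 1F ⟧ (at r ∷ at s ∷ [])
      apart! {r} {s} r∈ s∈ with r ≟ s
      ... | no r≢s = inj₂ (sep r∈ s∈ r≢s)
      ... | yes refl = prove (at r ∷ []) (apart 0F 0F) [] []

      equal : ∀ {r s} → r ∈ xs → s ∈ xs → (⟦ disjoint 0F 1F ⟧ (at r ∷ at s ∷ []) → ⊥) → r ≡ s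
      equal {r} {s} r∈ s∈ f with r ≟ s
      ... | yes p = p
      ... | no ¬p = ⊥-elim (f (sep r∈ s∈ ¬p))

      module _ {v : R} (c : Corner v o₂ (region 0F 1F)) where

        open Corner c

        corner-reducible : (∀ {k k′} → k ∈ xs → k′ ∈ xs → ⟦ flush 0F 1F ⟧ (at v ∷ at k ∷ []) →
                            ⟦ flush 0F 1F ⟧ (at v ∷ at k′ ∷ []) → k ≡ k′) → Reducible xs Contact v
        corner-reducible one = record
          { member = member
          ; slot = λ i k → ⟦ cornerSlot 0F 1F i ⟧ (at v ∷ at k ∷ [])
          ; slot? = λ i k → holds? (cornerSlot 0F 1F i) (at v ∷ at k ∷ [])
          ; covered = covered
          ; unique = unique
          ; uncrossed = λ {u} {l} {d} {r} u∈ l∈ d∈ r∈ su sl sd sr S⊆ S′⊆ S∩S′ →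
              noCrossing sep member S⊆ S′⊆ S∩S′ (crossed u∈ l∈ d∈ r∈ su sl sd sr) }
          where
          covered : ∀ {k} → k ∈ xs → Contact v k → ∃ λ i → ⟦ cornerSlot 0F 1F i ⟧ (at v ∷ at k ∷ [])
          covered {k} k∈ (inj₁ p) with decide (is o₁ 1F) (at v ∷ at k ∷ [])
          ... | inj₁ q = 2F , p , q
          ... | inj₂ q = 3F , p , q
          covered {k} k∈ (inj₂ (inj₁ p)) = 1F , inj₁ p
          covered {k} k∈ (inj₂ (inj₂ (inj₁ p))) with decide (X 0F ≤ᶠ X 1F) (at v ∷ at k ∷ [])
          ... | inj₁ q = 0F , p , q
          ... | inj₂ q = 1F , inj₂ (p , q)
          -- Nothing touches the corner from below: either orientation of such a neighbour falls
          -- into the forbidden region.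
          covered {k} k∈ (inj₂ (inj₂ (inj₂ p))) = ⊥-elim (refute (at v ∷ at k ∷ [])
            (is o₂ 0F ∷ below 1F 0F ∷ region 0F 1F ∷ []) (oriented ∷ p ∷ free k∈ ∷ []))

          unique : ∀ i {k k′} → k ∈ xs → k′ ∈ xs → ⟦ cornerSlot 0F 1F i ⟧ (at v ∷ at k ∷ []) →
                   ⟦ cornerSlot 0F 1F i ⟧ (at v ∷ at k′ ∷ []) → k ≡ k′
          -- Both start above the top side of `v`, which has length `𝐛`, and both are at least that
          -- wide.
          unique 0F {k} {k′} k∈ k′∈ p q = equal k∈ k′∈ λ e → refute (at v ∷ at k ∷ at k′ ∷ [])
            (is o₂ 0F ∷ cornerSlot 0F 1F 0F ∷ cornerSlot 0F 2F 0F ∷ disjoint 1F 2F ∷ [])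
            (oriented ∷ p ∷ q ∷ e ∷ [])
          -- Every rectangle in this slot covers the unit cell diagonally outside the upper left
          -- corner of `v`; a left neighbour does because it is vertical and strictly higher than
          -- `v`.
          unique 1F {k} {k′} k∈ k′∈ p q = equal k∈ k′∈ λ e → refute (at v ∷ at k ∷ at k′ ∷ [])
            (is o₂ 0F ∷ cornerSlot 0F 1F 1F ∷ cornerSlot 0F 2F 1F ∷ disjoint 1F 2F ∷
             neg (offends 1F 0F) ∷ neg (offends 2F 0F) ∷ [])
            (oriented ∷ p ∷ q ∷ e ∷ harmless k∈ ∷ harmless k′∈ ∷ [])
          unique 2F {k} {k′} k∈ k′∈ p q = one k∈ k′∈ (flushed p) (flushed q)
            where
            flushed : ∀ {k} → ⟦ cornerSlot 0F 1F 2F ⟧ (at v ∷ at k ∷ []) → ⟦ flush 0F 1F ⟧ (at v ∷ at k ∷ [])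
            flushed {k} r = prove (at v ∷ at k ∷ []) (flush 0F 1F) (cornerSlot 0F 1F 2F ∷ []) (r ∷ [])
          -- By `region` both start no lower than `v`, and below its top; since all three have
          -- height `𝐚`, the two would overlap.
          unique 3F {k} {k′} k∈ k′∈ p q = equal k∈ k′∈ λ e → refute (at v ∷ at k ∷ at k′ ∷ [])
            (is o₂ 0F ∷ cornerSlot 0F 1F 3F ∷ cornerSlot 0F 2F 3F ∷ disjoint 1F 2F ∷ region 0F 1F ∷ region 0F 2F ∷ [])
            (oriented ∷ p ∷ q ∷ e ∷ free k∈ ∷ free k′∈ ∷ [])

          crossed : ∀ {u l d r} → u ∈ xs → l ∈ xs → d ∈ xs → r ∈ xs →
            ⟦ cornerSlot 0F 1F 0F ⟧ (at v ∷ at u ∷ []) → ⟦ cornerSlot 0F 1F 1F ⟧ (at v ∷ at l ∷ []) →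
            ⟦ cornerSlot 0F 1F 2F ⟧ (at v ∷ at d ∷ []) → ⟦ cornerSlot 0F 1F 3F ⟧ (at v ∷ at r ∷ []) →
            ⟦ crossing 0F 1F 2F 3F 4F ⟧ (at v ∷ at u ∷ at l ∷ at d ∷ at r ∷ [])
          crossed {u} {l} {d} {r} u∈ l∈ d∈ r∈ su sl sd sr =
            su ,
            (proj₁ sr , prove (at v ∷ at r ∷ []) (Y 0F ≤ᶠ Y 1F)
              (is o₂ 0F ∷ cornerSlot 0F 1F 3F ∷ region 0F 1F ∷ []) (oriented ∷ sr ∷ free r∈ ∷ [])) ,
            prove (at v ∷ at u ∷ at l ∷ [])
              ((leftOf 2F 0F ∧ᶠ Y⁺ 0F ≤ᶠ Y⁺ 2F) ∨ᶠ (below 0F 2F ∧ᶠ X 2F <ᶠ X 0F ∧ᶠ X⁺ 2F ≤ᶠ X 1F))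
              (is o₂ 0F ∷ cornerSlot 0F 1F 0F ∷ cornerSlot 0F 2F 1F ∷ neg (offends 2F 0F) ∷ apart 1F 2F ∷ [])
              (oriented ∷ su ∷ sl ∷ harmless l∈ ∷ apart! u∈ l∈ ∷ []) ,
            inj₂ (proj₁ sd , prove (at v ∷ at d ∷ at r ∷ []) (Y⁺ 1F ≤ᶠ Y 2F)
              (is o₂ 0F ∷ cornerSlot 0F 1F 2F ∷ cornerSlot 0F 2F 3F ∷ region 0F 2F ∷ apart 1F 2F ∷ [])
              (oriented ∷ sd ∷ sr ∷ free r∈ ∷ apart! d∈ r∈ ∷ []))

        -- A second flush rectangle `h` lies above the lowest one `g` and still starts below the top
        -- of `v`. Hence all of `g` is below that top, and `region` restricts its left and upper
        -- neighbours.
        flush-reducible : ∀ {g h} → g ∈ xs → h ∈ xs → g ≢ h →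
          ⟦ flush 0F 1F ⟧ (at v ∷ at g ∷ []) → ⟦ flush 0F 1F ⟧ (at v ∷ at h ∷ []) →
          (∀ {k} → k ∈ xs → ⟦ flush 0F 1F ⟧ (at v ∷ at k ∷ []) → y (at g) ≤ y (at k)) → Reducible xs Contact g
        flush-reducible {g} {h} g∈ h∈ g≢h fg fh lowest = record
          { member = g∈
          ; slot = λ i k → ⟦ flushSlot 0F 1F i ⟧ (at g ∷ at k ∷ [])
          ; slot? = λ i k → holds? (flushSlot 0F 1F i) (at g ∷ at k ∷ [])
          ; covered = covered
          ; unique = unique
          ; uncrossed = λ {u} {l} {d} {r} u∈ l∈ d∈ r∈ su sl sd sr S⊆ S′⊆ S∩S′ →
              noCrossing sep g∈ S⊆ S′⊆ S∩S′ (crossed u∈ l∈ d∈ r∈ su sl sd sr) }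
          where
          covered : ∀ {k} → k ∈ xs → Contact g k → ∃ λ i → ⟦ flushSlot 0F 1F i ⟧ (at g ∷ at k ∷ [])
          covered {k} k∈ (inj₁ p) with decide (Y 0F ≤ᶠ Y 1F) (at g ∷ at k ∷ [])
          ... | inj₁ q = 3F , p , q
          ... | inj₂ q = 2F , inj₂ (p , q)
          covered {k} k∈ (inj₂ (inj₁ p)) = 1F , p
          covered {k} k∈ (inj₂ (inj₂ (inj₁ p))) = 0F , p
          covered {k} k∈ (inj₂ (inj₂ (inj₂ p))) = 2F , inj₁ p

          lowest! : ∀ {k} → k ∈ xs → ⟦ neg (flush 0F 2F) ∨ᶠ Y 1F ≤ᶠ Y 2F ⟧ (at v ∷ at g ∷ at k ∷ [])
          lowest! {k} k∈ with decide (flush 0F 1F) (at v ∷ at k ∷ [])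
          ... | inj₁ p = inj₂ (lowest k∈ p)
          ... | inj₂ p = inj₁ p

          -- A vertical rectangle on `g` would start no lower than `v`, by `region`; with height `𝐚`
          -- it reaches the top of `v` and so runs into `h`.
          top-horizontal : ∀ {k} → k ∈ xs → ⟦ below 0F 1F ⟧ (at g ∷ at k ∷ []) → o (at k) ≡ o₁
          top-horizontal {k} k∈ p = prove (at v ∷ at g ∷ at h ∷ at k ∷ []) (is o₁ 3F)
            (is o₂ 0F ∷ flush 0F 1F ∷ flush 0F 2F ∷ Y 1F ≤ᶠ Y 2F ∷ disjoint 1F 2F ∷
             below 1F 3F ∷ region 0F 3F ∷ apart 2F 3F ∷ [])
            (oriented ∷ fg ∷ fh ∷ lowest h∈ fh ∷ sep g∈ h∈ g≢h ∷ p ∷ free k∈ ∷ apart! h∈ k∈ ∷ [])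

          unique : ∀ i {k k′} → k ∈ xs → k′ ∈ xs → ⟦ flushSlot 0F 1F i ⟧ (at g ∷ at k ∷ []) →
                   ⟦ flushSlot 0F 1F i ⟧ (at g ∷ at k′ ∷ []) → k ≡ k′
          unique 0F {k} {k′} k∈ k′∈ p q = equal k∈ k′∈ λ e →
            refute (at v ∷ at g ∷ at h ∷ at k ∷ at k′ ∷ [])
              (is o₂ 0F ∷ is o₁ 3F ∷ is o₁ 4F ∷ flush 0F 1F ∷ flush 0F 2F ∷ Y 1F ≤ᶠ Y 2F ∷ disjoint 1F 2F ∷
               below 1F 3F ∷ below 1F 4F ∷ disjoint 3F 4F ∷ region 0F 3F ∷ region 0F 4F ∷ [])
              (oriented ∷ top-horizontal k∈ p ∷ top-horizontal k′∈ q ∷ fg ∷ fh ∷ lowest h∈ fh ∷ sep g∈ h∈ g≢h ∷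
               p ∷ q ∷ e ∷ free k∈ ∷ free k′∈ ∷ [])
          -- By `region` left neighbours of `g` are vertical and start no lower than `v`, but below
          -- its top; two of them would overlap.
          unique 1F {k} {k′} k∈ k′∈ p q = equal k∈ k′∈ λ e →
            refute (at v ∷ at g ∷ at h ∷ at k ∷ at k′ ∷ [])
              (is o₂ 0F ∷ flush 0F 1F ∷ flush 0F 2F ∷ Y 1F ≤ᶠ Y 2F ∷ disjoint 1F 2F ∷
               leftOf 3F 1F ∷ leftOf 4F 1F ∷ disjoint 3F 4F ∷ region 0F 3F ∷ region 0F 4F ∷ [])
              (oriented ∷ fg ∷ fh ∷ lowest h∈ fh ∷ sep g∈ h∈ g≢h ∷ p ∷ q ∷ e ∷ free k∈ ∷ free k′∈ ∷ [])
          -- By `region` and the minimality of `g`, a rectangle below `g` is horizontal and starts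
          -- further right. So all of this slot covers the unit cell diagonally outside the lower
          -- right corner of `g`.
          unique 2F {k} {k′} k∈ k′∈ p q = equal k∈ k′∈ λ e →
            refute (at v ∷ at g ∷ at k ∷ at k′ ∷ [])
              (is o₂ 0F ∷ flush 0F 1F ∷ flushSlot 1F 2F 2F ∷ flushSlot 1F 3F 2F ∷ disjoint 2F 3F ∷
               region 0F 2F ∷ region 0F 3F ∷ (neg (flush 0F 2F) ∨ᶠ Y 1F ≤ᶠ Y 2F) ∷ (neg (flush 0F 3F) ∨ᶠ Y 1F ≤ᶠ Y 3F) ∷ [])
              (oriented ∷ fg ∷ p ∷ q ∷ e ∷ free k∈ ∷ free k′∈ ∷ lowest! k∈ ∷ lowest! k′∈ ∷ [])
          unique 3F {k} {k′} k∈ k′∈ p q = equal k∈ k′∈ λ e →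
            refute (at g ∷ at k ∷ at k′ ∷ [])
              (is o₁ 0F ∷ flushSlot 0F 1F 3F ∷ flushSlot 0F 2F 3F ∷ disjoint 1F 2F ∷ [])
              (proj₁ fg ∷ p ∷ q ∷ e ∷ [])

          crossed : ∀ {u l d r} → u ∈ xs → l ∈ xs → d ∈ xs → r ∈ xs →
            ⟦ flushSlot 0F 1F 0F ⟧ (at g ∷ at u ∷ []) → ⟦ flushSlot 0F 1F 1F ⟧ (at g ∷ at l ∷ []) →
            ⟦ flushSlot 0F 1F 2F ⟧ (at g ∷ at d ∷ []) → ⟦ flushSlot 0F 1F 3F ⟧ (at g ∷ at r ∷ []) →
            ⟦ crossing 0F 1F 2F 3F 4F ⟧ (at g ∷ at u ∷ at l ∷ at d ∷ at r ∷ [])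
          crossed {u} {l} {d} {r} u∈ l∈ d∈ r∈ su sl sd sr =
            (su , prove (at v ∷ at g ∷ at h ∷ at u ∷ []) (X 1F ≤ᶠ X 3F)
              (is o₂ 0F ∷ is o₁ 3F ∷ flush 0F 1F ∷ flush 0F 2F ∷ Y 1F ≤ᶠ Y 2F ∷ disjoint 1F 2F ∷ below 1F 3F ∷ region 0F 3F ∷ [])
              (oriented ∷ top-horizontal u∈ su ∷ fg ∷ fh ∷ lowest h∈ fh ∷ sep g∈ h∈ g≢h ∷ su ∷ free u∈ ∷ [])) ,
            sr ,
            inj₁ (sl , prove (at v ∷ at g ∷ at h ∷ at l ∷ []) (Y⁺ 1F ≤ᶠ Y⁺ 3F)
              (is o₂ 0F ∷ flush 0F 1F ∷ flush 0F 2F ∷ Y 1F ≤ᶠ Y 2F ∷ disjoint 1F 2F ∷ leftOf 3F 1F ∷ region 0F 3F ∷ [])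
              (oriented ∷ fg ∷ fh ∷ lowest h∈ fh ∷ sep g∈ h∈ g≢h ∷ sl ∷ free l∈ ∷ [])) ,
            prove (at g ∷ at d ∷ at r ∷ []) (below 1F 0F ∨ᶠ (leftOf 0F 1F ∧ᶠ Y⁺ 1F ≤ᶠ Y 2F))
              (flushSlot 0F 1F 2F ∷ flushSlot 0F 2F 3F ∷ apart 1F 2F ∷ [])
              (sd ∷ sr ∷ apart! d∈ r∈ ∷ [])

        reducible : ∃ λ w → Reducible xs Contact w
        reducible with least (λ k → holds? (flush 0F 1F) (at v ∷ at k ∷ [])) (λ k → y (at k)) xs
        ... | inj₂ none = v , corner-reducible (λ k∈ _ p → ⊥-elim (none k∈ p))
        ... | inj₁ (g , g∈ , fg , lowest)
            with search (λ k → holds? (flush 0F 1F) (at v ∷ at k ∷ []) ×-dec ¬? (g ≟ k)) xs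
        ...   | inj₁ (h , h∈ , fh , g≢h) = g , flush-reducible g∈ h∈ g≢h fg fh lowest
        ...   | inj₂ none = v , corner-reducible (λ k∈ k′∈ p q → trans (sym (is-g k∈ p)) (is-g k′∈ q))
          where
          is-g : ∀ {k} → k ∈ xs → ⟦ flush 0F 1F ⟧ (at v ∷ at k ∷ []) → g ≡ k
          is-g {k} k∈ p with g ≟ k
          ... | yes e = e
          ... | no ¬e = ⊥-elim (none k∈ (p , ¬e))

open Slots

-- Kempe's argument and four colours by induction

module KempeChains where

  Colour : Set
  Colour = Fin 4

  exchange : Colour → Colour → Colour → Colour
  exchange p q c with c Fin.≟ p | c Fin.≟ q
  ... | yes _ | _     = q
  ... | no _  | yes _ = p
  ... | no _  | no _  = c

  exchange-left : ∀ p q → exchange p q p ≡ q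
  exchange-left p q with p Fin.≟ p
  ... | yes _ = refl
  ... | no ¬p = ⊥-elim (¬p refl)

  exchange-right : ∀ p q → exchange p q q ≡ p
  exchange-right p q with q Fin.≟ p | q Fin.≟ q
  ... | yes r | _     = r
  ... | no _  | yes _ = refl
  ... | no _  | no ¬q = ⊥-elim (¬q refl)

  infix 4 _∈⟦_,_⟧

  _∈⟦_,_⟧ : Colour → Colour → Colour → Set
  c ∈⟦ p , q ⟧ = c ≡ p ⊎ c ≡ q

  pair? : ∀ c p q → Dec (c ∈⟦ p , q ⟧)
  pair? c p q = c Fin.≟ p ⊎-dec c Fin.≟ q

  exchange-closed : ∀ {p q c} → c ∈⟦ p , q ⟧ → exchange p q c ∈⟦ p , q ⟧
  exchange-closed {p} {q} (inj₁ refl) = inj₂ (exchange-left p q)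
  exchange-closed {p} {q} (inj₂ refl) = inj₁ (exchange-right p q)

  exchange-injective : ∀ {p q c d} → c ∈⟦ p , q ⟧ → d ∈⟦ p , q ⟧ → exchange p q c ≡ exchange p q d → c ≡ d
  exchange-injective {p} {q} (inj₁ refl) (inj₁ refl) e = refl
  exchange-injective {p} {q} (inj₂ refl) (inj₂ refl) e = refl
  exchange-injective {p} {q} (inj₁ refl) (inj₂ refl) e = trans (sym (exchange-right p q)) (trans (sym e) (exchange-left p q))
  exchange-injective {p} {q} (inj₂ refl) (inj₁ refl) e = trans (sym (exchange-left p q)) (trans (sym e) (exchange-right p q))

  module Exchange {R : Set} (_≟_ : DecidableEquality R) (_~_ : R → R → Set) (_~?_ : ∀ r s → Dec (r ~ s))
               (~-sym : ∀ {r s} → r ~ s → s ~ r) (~-irrefl : ∀ {r} → ¬ (r ~ r)) where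

    open import Data.List.Membership.DecPropositional _≟_ using (_∈?_)

    snoc : ∀ {S r s t} → Chain S _~_ r s → s ~ t → S t → Chain S _~_ r t
    snoc [ p ]         q z = link p q [ z ]
    snoc (link p q ch) e z = link p q (snoc ch e z)

    record Component (S : R → Set) (xs : List R) (u : R) : Set where
      field
        members : List R
        origin  : u ∈ members
        reached : ∀ {k} → k ∈ members → Chain S _~_ u k
        closed  : ∀ {k m} → k ∈ members → m ∈ xs → S m → k ~ m → m ∈ members

    last : ∀ {S r s} → Chain S _~_ r s → S s
    last [ p ]         = p
    last (link _ _ ch) = last ch

    -- Saturation: one adjacent candidate is absorbed in each round, and the shrinking list `rest`
    -- of candidates bounds the number of rounds.
    component : ∀ {S} → Decidable S → ∀ xs {u} → S u → Component S xs u
    component {S} S? xs {u} Su = grow (length xs) xs ℕₚ.≤-refl (u ∷ []) (here refl)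
        (λ { (here refl) → [ Su ] }) (λ i → inj₂ i)
      where
      grow : ∀ n rest → length rest ℕ.≤ n → ∀ C → u ∈ C → (∀ {k} → k ∈ C → Chain S _~_ u k) →
             (∀ {m} → m ∈ xs → m ∈ C ⊎ m ∈ rest) → Component S xs u
      grow n rest bound C origin reached known
        with search (λ m → S? m ×-dec ¬? (m ∈? C) ×-dec Any.any? (_~? m) C) rest
      ... | inj₂ none = record { members = C ; origin = origin ; reached = reached ; closed = closed }
        where
        closed : ∀ {k m} → k ∈ C → m ∈ xs → S m → k ~ m → m ∈ C
        closed {m = m} k∈ m∈ Sm k~m with known m∈
        ... | inj₁ m∈C = m∈C
        ... | inj₂ m∈rest with m ∈? C
        ...   | yes m∈C = m∈C
        ...   | no m∉C  = ⊥-elim (none m∈rest (Sm , m∉C , lose k∈ k~m))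
      grow zero    []   bound C origin reached known | inj₁ (m , () , _)
      grow (suc n) rest bound C origin reached known | inj₁ (m , m∈ , Sm , m∉C , near) with find near
      ... | k , k∈ , k~m = grow n (filter keep? rest)
              (ℕ.s≤s⁻¹ (ℕₚ.≤-trans (Listₚ.filter-notAll keep? rest (lose m∈ (λ ¬e → ¬e refl))) bound))
              (m ∷ C) (there origin)
              (λ { (here refl) → snoc (reached k∈) k~m Sm ; (there i) → reached i }) known′
        where
        keep? : Decidable (λ t → ¬ t ≡ m)
        keep? t = ¬? (t ≟ m)
        known′ : ∀ {t} → t ∈ xs → t ∈ m ∷ C ⊎ t ∈ filter keep? rest
        known′ {t} t∈ with t ≟ m | known t∈
        ... | yes refl | _      = inj₁ (here refl)
        ... | no _     | inj₁ i = inj₁ (there i)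
        ... | no ¬e    | inj₂ i = inj₂ (∈-filter⁺ keep? i ¬e)

    Proper : List R → (R → Colour) → Set
    Proper xs κ = ∀ {r s} → r ∈ xs → s ∈ xs → r ~ s → κ r ≢ κ s

    module Extend {xs : List R} {v : R} (red : Reducible xs _~_ v) (κ : R → Colour)
                  (proper : ∀ {r s} → r ∈ xs → s ∈ xs → r ≢ v → s ≢ v → r ~ s → κ r ≢ κ s) where

      open Reducible red

      ProperOff : (R → Colour) → Set
      ProperOff κ = ∀ {r s} → r ∈ xs → s ∈ xs → r ≢ v → s ≢ v → r ~ s → κ r ≢ κ s

      recolour : ∀ κ → ProperOff κ → ∀ c → (∀ {k} → k ∈ xs → v ~ k → κ k ≢ c) → ∃ (Proper xs)
      recolour κ off c free = κ′ , proper′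
        where
        κ′ : R → Colour
        κ′ k with k ≟ v
        ... | yes _ = c
        ... | no _  = κ k
        proper′ : Proper xs κ′
        proper′ {r} {s} r∈ s∈ r~s with r ≟ v | s ≟ v
        ... | yes refl | yes refl = λ _ → ~-irrefl r~s
        ... | yes refl | no _     = λ e → free s∈ r~s (sym e)
        ... | no _     | yes refl = free r∈ (~-sym r~s)
        ... | no ¬r    | no ¬s    = off r∈ s∈ ¬r ¬s r~s

      Kept : Colour → Colour → R → Set
      Kept p q k = (k ∈ xs × k ≢ v) × κ k ∈⟦ p , q ⟧

      kept? : ∀ p q → Decidable (Kept p q)
      kept? p q k = ((k ∈? xs) ×-dec ¬? (k ≟ v)) ×-dec pair? (κ k) p q

      -- If the two-coloured component of `u` misses `d`, exchanging its colours frees `κ u` at `v`,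
      -- because by the last hypothesis no further neighbour has either colour.
      switch : ∀ {u d} → u ∈ xs → u ≢ v → κ u ≢ κ d →
               (∀ {k} → k ∈ xs → v ~ k → k ≡ u ⊎ k ≡ d ⊎ ¬ (κ k ∈⟦ κ u , κ d ⟧)) →
               Chain (Kept (κ u) (κ d)) _~_ u d ⊎ ∃ (Proper xs)
      switch {u} {d} u∈ u≢v u≢d others with component (kept? (κ u) (κ d)) xs ((u∈ , u≢v) , inj₁ refl)
      ... | C with d ∈? Component.members C
      ...   | yes d∈C = inj₁ (Component.reached C d∈C)
      ...   | no d∉C  = inj₂ (recolour κ′ off (κ u) free)
        where
        open Component C
        κ′ : R → Colour
        κ′ k with k ∈? members
        ... | yes _ = exchange (κ u) (κ d) (κ k)
        ... | no _  = κ k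
        coloured : ∀ {k} → k ∈ members → κ k ∈⟦ κ u , κ d ⟧
        coloured k∈ = proj₂ (last (reached k∈))
        border : ∀ {k m} → k ∈ members → ¬ (m ∈ members) → m ∈ xs → m ≢ v → k ~ m →
                 exchange (κ u) (κ d) (κ k) ≢ κ m
        border k∈ m∉ m∈xs m≢v k~m e =
          m∉ (closed k∈ m∈xs ((m∈xs , m≢v) , subst (_∈⟦ κ u , κ d ⟧) e (exchange-closed (coloured k∈))) k~m)
        off : ProperOff κ′
        off {r} {s} r∈ s∈ r≢v s≢v r~s with r ∈? members | s ∈? members
        ... | yes i | yes j = λ e → proper r∈ s∈ r≢v s≢v r~s (exchange-injective (coloured i) (coloured j) e)
        ... | yes i | no ¬j = border i ¬j s∈ s≢v r~s
        ... | no ¬i | yes j = λ e → border j ¬i r∈ r≢v (~-sym r~s) (sym e)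
        ... | no ¬i | no ¬j = proper r∈ s∈ r≢v s≢v r~s
        free : ∀ {k} → k ∈ xs → v ~ k → κ′ k ≢ κ u
        free {k} k∈ v~k with others k∈ v~k | k ∈? members
        ... | inj₁ refl        | yes _ = λ e → u≢d (sym (trans (sym (exchange-left (κ u) (κ d))) e))
        ... | inj₁ refl        | no ¬i = ⊥-elim (¬i origin)
        ... | inj₂ (inj₁ refl) | yes i = ⊥-elim (d∉C i)
        ... | inj₂ (inj₁ refl) | no _  = λ e → u≢d (sym e)
        ... | inj₂ (inj₂ ¬p)   | yes i = ⊥-elim (¬p (coloured i))
        ... | inj₂ (inj₂ ¬p)   | no _  = λ e → ¬p (inj₁ e)

      Used : Colour → Set
      Used c = ∃ λ k → k ∈ xs × v ~ k × κ k ≡ c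

      kempe : (∀ c → Used c) → ∃ (Proper xs)
      kempe used = finish (switch (in-xs 0F) (≢v 0F) (distinct 0F 2F λ ()) (others 0F 2F))
                          (switch (in-xs 1F) (≢v 1F) (distinct 1F 3F λ ()) (others 1F 3F))
        where
        nb : Colour → R
        nb c = proj₁ (used c)
        slotOf : Colour → Fin 4
        slotOf c = proj₁ (covered (proj₁ (proj₂ (used c))) (proj₁ (proj₂ (proj₂ (used c)))))
        slotted : ∀ c → slot (slotOf c) (nb c)
        slotted c = proj₂ (covered (proj₁ (proj₂ (used c))) (proj₁ (proj₂ (proj₂ (used c)))))
        slotOf-injective : ∀ {c d} → slotOf c ≡ slotOf d → c ≡ d
        slotOf-injective {c} {d} e = trans (sym (proj₂ (proj₂ (proj₂ (used c)))))
          (trans (cong κ (unique (slotOf d) (proj₁ (proj₂ (used c))) (proj₁ (proj₂ (used d)))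
                    (subst (λ i → slot i (nb c)) e (slotted c)) (slotted d)))
                 (proj₂ (proj₂ (proj₂ (used d)))))
        -- If the injective `slotOf` missed a slot, punching that slot out would embed four colours
        -- into three slots.
        preimage : ∀ i → ∃ λ c → slotOf c ≡ i
        preimage i with Finₚ.any? (λ c → slotOf c Fin.≟ i)
        ... | yes p = p
        ... | no ¬p = ⊥-elim (ℕₚ.<-irrefl refl (Finₚ.injective⇒≤ {f = λ c → Fin.punchOut (λ e → ¬p (c , sym e))}
                        (λ e → slotOf-injective (Finₚ.punchOut-injective (λ e′ → ¬p (_ , sym e′)) (λ e′ → ¬p (_ , sym e′)) e))))
        at : Fin 4 → R
        at i = nb (proj₁ (preimage i))
        in-xs : ∀ i → at i ∈ xs
        in-xs i = proj₁ (proj₂ (used (proj₁ (preimage i))))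
        touching : ∀ i → v ~ at i
        touching i = proj₁ (proj₂ (proj₂ (used (proj₁ (preimage i)))))
        ≢v : ∀ i → at i ≢ v
        ≢v i e = ~-irrefl (subst (v ~_) e (touching i))
        in-slot : ∀ i → slot i (at i)
        in-slot i = subst (λ j → slot j (at i)) (proj₂ (preimage i)) (slotted (proj₁ (preimage i)))
        distinct : ∀ i j → i ≢ j → κ (at i) ≢ κ (at j)
        distinct i j i≢j e = i≢j (trans (sym (proj₂ (preimage i))) (trans (cong slotOf
          (trans (sym (proj₂ (proj₂ (proj₂ (used (proj₁ (preimage i)))))))
            (trans e (proj₂ (proj₂ (proj₂ (used (proj₁ (preimage j))))))))) (proj₂ (preimage j))))
        others : ∀ i j {k} → k ∈ xs → v ~ k → k ≡ at i ⊎ k ≡ at j ⊎ ¬ (κ k ∈⟦ κ (at i) , κ (at j) ⟧)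
        others i j {k} k∈ v~k with covered k∈ v~k
        ... | m , s with unique m k∈ (in-xs m) s (in-slot m) | m Fin.≟ i | m Fin.≟ j
        ...   | refl | yes refl | _        = inj₁ refl
        ...   | refl | no _     | yes refl = inj₂ (inj₁ refl)
        ...   | refl | no m≢i   | no m≢j   = inj₂ (inj₂ λ { (inj₁ e) → distinct m i m≢i e ; (inj₂ e) → distinct m j m≢j e })
        finish : Chain (Kept (κ (at 0F)) (κ (at 2F))) _~_ (at 0F) (at 2F) ⊎ ∃ (Proper xs) →
                 Chain (Kept (κ (at 1F)) (κ (at 3F))) _~_ (at 1F) (at 3F) ⊎ ∃ (Proper xs) → ∃ (Proper xs)
        finish (inj₂ p) _        = p
        finish (inj₁ _) (inj₂ p) = p
        finish (inj₁ ch) (inj₁ ch′) = ⊥-elim (uncrossed (in-xs 0F) (in-xs 1F) (in-xs 2F) (in-xs 3F)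
          (in-slot 0F) (in-slot 1F) (in-slot 2F) (in-slot 3F) proj₁ proj₁ disjointColours ch ch′)
          where
          disjointColours : ∀ {k} → Kept (κ (at 0F)) (κ (at 2F)) k → Kept (κ (at 1F)) (κ (at 3F)) k → ⊥
          disjointColours (_ , inj₁ e) (_ , inj₁ e′) = distinct 0F 1F (λ ()) (trans (sym e) e′)
          disjointColours (_ , inj₁ e) (_ , inj₂ e′) = distinct 0F 3F (λ ()) (trans (sym e) e′)
          disjointColours (_ , inj₂ e) (_ , inj₁ e′) = distinct 2F 1F (λ ()) (trans (sym e) e′)
          disjointColours (_ , inj₂ e) (_ , inj₂ e′) = distinct 2F 3F (λ ()) (trans (sym e) e′)

      extend : ∃ (Proper xs)
      extend with Finₚ.any? (λ c → forall? (λ k → (v ~? k) →-dec ¬? (κ k Fin.≟ c)) xs)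
      ... | yes (c , free) = recolour κ proper c free
      ... | no ¬free = kempe used
        where
        used : ∀ c → Used c
        used c with search (λ k → (v ~? k) ×-dec (κ k Fin.≟ c)) xs
        ... | inj₁ found = found
        ... | inj₂ none  = ⊥-elim (¬free (c , λ k∈ v~k e → none k∈ (v~k , e)))

    module _ (Apart : R → R → Set)
             (find : ∀ xs → (∀ {r s} → r ∈ xs → s ∈ xs → r ≢ s → Apart r s) →
                     ∀ {r} → r ∈ xs → ∃ (Reducible xs _~_)) where

      -- Filtering removes every copy of `v`, so the list may contain repetitions; the length bound
      -- is the measure of the recursion.
      fourColouring : ∀ n xs → length xs ℕ.≤ n → (∀ {r s} → r ∈ xs → s ∈ xs → r ≢ s → Apart r s) → ∃ (Proper xs)
      fourColouring n       []       bound sep = (λ _ → 0F) , λ ()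
      fourColouring (suc n) (r ∷ xs) bound sep with find (r ∷ xs) sep (here refl)
      ... | v , red = Extend.extend red κ (λ i j ¬i ¬j → proper (∈-filter⁺ keep? i ¬i) (∈-filter⁺ keep? j ¬j))
        where
        keep? : Decidable (λ t → ¬ t ≡ v)
        keep? t = ¬? (t ≟ v)
        rest : List R
        rest = filter keep? (r ∷ xs)
        ih : ∃ (Proper rest)
        ih = fourColouring n rest
          (ℕ.s≤s⁻¹ (ℕₚ.≤-trans (Listₚ.filter-notAll keep? (r ∷ xs) (lose (Reducible.member red) (λ ¬e → ¬e refl))) bound))
          (λ i j → sep (proj₁ (∈-filter⁻ keep? i)) (proj₁ (∈-filter⁻ keep? j)))
        κ : R → Colour
        κ = proj₁ ih
        proper : Proper rest κ
        proper = proj₂ ih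

open KempeChains

-- Four colours for packings, using reflection in the diagonal

module Planar where

  open import Data.Integer using (ℤ; 0ℤ; _≤_; _<_)

  _≟ᵒ_ : DecidableEquality Orient
  o₁ ≟ᵒ o₁ = yes refl
  o₁ ≟ᵒ o₂ = no λ ()
  o₂ ≟ᵒ o₁ = no λ ()
  o₂ ≟ᵒ o₂ = yes refl

  _≟ᵖ_ : DecidableEquality Pos
  pos i j p ≟ᵖ pos k l q =
    map′ (λ { (refl , refl , refl) → refl }) (λ { refl → refl , refl , refl })
         (i ℤₚ.≟ k ×-dec j ℤₚ.≟ l ×-dec p ≟ᵒ q)

  -- The corner arguments allow any placement `at`. A horizontal corner is therefore a vertical one
  -- for the same list, placed by this reflection.
  mirror : Pos → Pos
  mirror p = pos (y p) (x p) (flip (o p))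

  module FourColours (a b : ℤ) (0<b : 0ℤ < b) (b≤a : b ≤ a) where

    open Semantics a b 0<b b≤a
    open Chains a b 0<b b≤a using (Contact)

    -- The graph of `mirror` as a formula, so that `prove` can carry statements across the
    -- reflection.
    mirrored : ∀ {n} → Fin n → Fin n → Formula n
    mirrored i j = X j ≡ᶠ Y i ∧ᶠ Y j ≡ᶠ X i ∧ᶠ (is o₁ i ∧ᶠ is o₂ j ∨ᶠ is o₂ i ∧ᶠ is o₁ j)

    is-mirrored : ∀ p → ⟦ mirrored 0F 1F ⟧ (p ∷ mirror p ∷ [])
    is-mirrored (pos _ _ o₁) = refl , refl , inj₁ (refl , refl)
    is-mirrored (pos _ _ o₂) = refl , refl , inj₂ (refl , refl)

    Separated : Pos → Pos → Set
    Separated r s = ⟦ disjoint 0F 1F ⟧ (r ∷ s ∷ [])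

    reduce : ∀ xs → (∀ {r s} → r ∈ xs → s ∈ xs → r ≢ s → Separated r s) → ∀ {r} → r ∈ xs → ∃ (Reducible xs (Contact id))
    reduce xs sep i with Extremal.findCorner a b 0<b b≤a _≟ᵖ_ id xs sep i
    ... | inj₁ (v , c) = VerticalCorner.reducible a b 0<b b≤a _≟ᵖ_ id xs sep c
    ... | inj₂ (h , Extremal.corner member oriented harmless free) =
      _ , mapReducible touch-mirror (proj₂ (VerticalCorner.reducible a b 0<b b≤a _≟ᵖ_ mirror xs sep′
            (Extremal.corner member (cong flip oriented) harmless′ free′)))
      where
      pair : Pos → Pos → Vec Pos 4
      pair r s = r ∷ s ∷ mirror r ∷ mirror s ∷ []
      sep′ : ∀ {r s} → r ∈ xs → s ∈ xs → r ≢ s → ⟦ disjoint 0F 1F ⟧ (mirror r ∷ mirror s ∷ [])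
      sep′ {r} {s} i j e = prove (pair r s) (disjoint 2F 3F) (mirrored 0F 2F ∷ mirrored 1F 3F ∷ disjoint 0F 1F ∷ [])
        (is-mirrored r ∷ is-mirrored s ∷ sep i j e ∷ [])
      touch-mirror : ∀ {r s} → Contact id r s → Contact mirror r s
      touch-mirror {r} {s} t = prove (pair r s) (touch 2F 3F) (mirrored 0F 2F ∷ mirrored 1F 3F ∷ touch 0F 1F ∷ [])
        (is-mirrored r ∷ is-mirrored s ∷ t ∷ [])
      harmless′ : ∀ {k} → k ∈ xs → ⟦ neg (offends 0F 1F) ⟧ (mirror k ∷ mirror h ∷ [])
      harmless′ {k} k∈ = prove (pair k h) (neg (offends 2F 3F))
        (mirrored 0F 2F ∷ mirrored 1F 3F ∷ neg (offends 0F 1F) ∷ [])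
        (is-mirrored k ∷ is-mirrored h ∷ harmless k∈ ∷ [])
      free′ : ∀ {k} → k ∈ xs → ⟦ region 0F 1F ⟧ (mirror h ∷ mirror k ∷ [])
      free′ {k} k∈ = prove (pair h k) (region 2F 3F) (mirrored 0F 2F ∷ mirrored 1F 3F ∷ region′ 0F 1F ∷ is o₁ 0F ∷ [])
        (is-mirrored h ∷ is-mirrored k ∷ free k∈ ∷ oriented ∷ [])

    contact? : ∀ r s → Dec (Contact id r s)
    contact? r s = holds? (touch 0F 1F) (r ∷ s ∷ [])

    contact-sym : ∀ {r s} → Contact id r s → Contact id s r
    contact-sym {r} {s} t = prove (r ∷ s ∷ []) (touch 1F 0F) (touch 0F 1F ∷ []) (t ∷ [])

    contact-irrefl : ∀ {r} → ¬ Contact id r r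
    contact-irrefl {r} t = refute (r ∷ []) (touch 0F 0F ∷ []) (t ∷ [])

    open Exchange _≟ᵖ_ (Contact id) contact? contact-sym contact-irrefl

    packing-fourColourable : ∀ xs → (∀ {r s} → r ∈ xs → s ∈ xs → r ≢ s → Separated r s) →
      ∃ λ (κ : Pos → Colour) → ∀ {r s} → r ∈ xs → s ∈ xs → Contact id r s → κ r ≢ κ s
    packing-fourColourable xs = fourColouring Separated reduce (length xs) xs ℕₚ.≤-refl

open Planar

-- Parity colourings with eight and sixteen colours

module Universal where

  open import Data.Integer using (ℤ; +_; -[1+_]; 1ℤ; -1ℤ; _+_; _-_; _*_; -_; _⊖_)

  Brick : Set
  Brick = Root × Orient

  -- Residue classes as positions on a cycle: integers act by iterating a permutation, so later
  -- checks over all residues run over a finite type.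
  module Orbit {A : Set} (next prev : A → A) (next-prev : ∀ p → next (prev p) ≡ p)
               (prev-next : ∀ p → prev (next p) ≡ p) (origin : A) where

    shift : ℤ → A → A
    shift (+ zero)       p = p
    shift (+ suc n)      p = next (shift (+ n) p)
    shift -[1+ zero ]    p = prev p
    shift -[1+ suc n ]   p = prev (shift -[1+ n ] p)

    shift-suc : ∀ e p → shift (1ℤ + e) p ≡ next (shift e p)
    shift-suc (+ n)          p = refl
    shift-suc -[1+ zero ]    p = sym (next-prev p)
    shift-suc -[1+ suc n ]   p = sym (next-prev _)

    shift-pred : ∀ e p → shift (-1ℤ + e) p ≡ prev (shift e p)
    shift-pred (+ zero)     p = refl
    shift-pred (+ suc n)    p = sym (prev-next _)
    shift-pred -[1+ n ]     p = refl

    shift-+ : ∀ d e p → shift (d + e) p ≡ shift d (shift e p)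
    shift-+ (+ zero)     e p = cong (λ u → shift u p) (ℤₚ.+-identityˡ e)
    shift-+ (+ suc n)    e p = trans (cong (λ u → shift u p) (ℤₚ.+-assoc 1ℤ (+ n) e))
      (trans (shift-suc (+ n + e) p) (cong next (shift-+ (+ n) e p)))
    shift-+ -[1+ zero ]  e p = shift-pred e p
    shift-+ -[1+ suc n ] e p = trans (cong (λ u → shift u p) (ℤₚ.+-assoc -1ℤ -[1+ n ] e))
      (trans (shift-pred (-[1+ n ] + e) p) (cong prev (shift-+ -[1+ n ] e p)))

    phase : ℤ → A
    phase e = shift e origin

  other : Fin 2 → Fin 2
  other 0F = 1F
  other 1F = 0F

  other-other : ∀ c → other (other c) ≡ c
  other-other 0F = refl
  other-other 1F = refl

  other≢ : ∀ c → other c ≢ c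
  other≢ 0F ()
  other≢ 1F ()

  module Parity = Orbit other other other-other other-other 0F

  open Parity using () renaming (phase to parity; shift to flips) public

  flips-double : ∀ n c → flips (+ (n ℕ.* 2)) c ≡ c
  flips-double zero    c = refl
  flips-double (suc n) c = trans (cong (other ∘ other) (flips-double n c)) (other-other c)

  parity-odd : ∀ {a} → a % 2 ≡ 1 → ∀ u → parity (u + + a) ≡ other (parity u)
  parity-odd {a} odd u = begin
    parity (u + + a)                              ≡⟨ cong parity (ℤₚ.+-comm u (+ a)) ⟩
    parity (+ a + u)                              ≡⟨ Parity.shift-+ (+ a) u 0F ⟩
    flips (+ a) (parity u)                        ≡⟨ cong (λ m → flips (+ m) (parity u)) (DivMod.m≡m%n+[m/n]*n a 2) ⟩
    flips (+ (a % 2 ℕ.+ a / 2 ℕ.* 2)) (parity u)  ≡⟨ cong (λ m → flips (+ (m ℕ.+ a / 2 ℕ.* 2)) (parity u)) odd ⟩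
    other (flips (+ (a / 2 ℕ.* 2)) (parity u))    ≡⟨ cong other (flips-double (a / 2) (parity u)) ⟩
    other (parity u)                              ∎
    where open ≡-Reasoning

  -- This rounds down, not towards zero; otherwise the shift law `quot-+` would fail at the origin.
  quot : (p : ℕ) .{{_ : NonZero p}} → ℤ → ℤ
  quot p (+ n)    = + (n / p)
  quot p -[1+ n ] = -[1+ n / p ]

  quot-+ : ∀ p .{{_ : NonZero p}} u → quot p (u + + p) ≡ 1ℤ + quot p u
  quot-+ p (+ n) = cong +_ (trans (DivMod.m/n≡1+[m∸n]/n (ℕₚ.m≤n+m p n)) (cong (λ m → suc (m / p)) (ℕₚ.m+n∸n≡m n p)))
  quot-+ p -[1+ n ] with ℕₚ.<-≤-connex n p
  ... | inj₁ n<p = trans (cong (quot p) (ℤₚ.⊖-≥ n<p))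
        (trans (cong +_ (DivMod.m<n⇒m/n≡0 (ℕₚ.∸-monoʳ-< (s≤s z≤n) n<p)))
               (sym (cong (λ m → 1ℤ + -[1+ m ]) (DivMod.m<n⇒m/n≡0 n<p))))
  ... | inj₂ p≤n = trans (cong (quot p) eq)
        (sym (cong (λ m → 1ℤ + -[1+ m ]) (DivMod.m/n≡1+[m∸n]/n p≤n)))
    where
    eq : p ⊖ suc n ≡ -[1+ n ℕ.∸ p ]
    eq = trans (ℤₚ.⊖-< (s≤s p≤n)) (cong (λ m → - (+ m)) (ℕₚ.+-∸-assoc 1 p≤n))

  bit : (p : ℕ) .{{_ : NonZero p}} → ℤ → Fin 2
  bit p u = parity (quot p u)

  bit-+ : ∀ p .{{_ : NonZero p}} u → bit p (u + + p) ≡ other (bit p u)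
  bit-+ p u = trans (cong parity (quot-+ p u)) (Parity.shift-suc (quot p u) 0F)

  ProperColouring : ℕ → ℕ → ℕ → {K : Set} → (Root → Orient → K) → Set
  ProperColouring a b c κ = ∀ r o r′ o′ → FaceContact (cub a b c r o) (cub a b c r′ o′) → κ r o ≢ κ r′ o′

  bounds-chromatic : ∀ {a b c k} (κ : Root → Orient → Fin k) → ProperColouring a b c κ → ChiLe a b c k
  bounds-chromatic κ proper n cfg _ =
    (λ i → κ (proj₁ (cfg i)) (proj₂ (cfg i))) ,
    (λ i j t → proper (proj₁ (cfg i)) (proj₂ (cfg i)) (proj₁ (cfg j)) (proj₂ (cfg j)) (proj₂ t))

  Bits : Set
  Bits = Fin 2 × Fin 2 × Fin 2

  encode : Bits → Fin 8
  encode (i , j , k) = combine i (combine j k)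

  encode-injective : ∀ p q → encode p ≡ encode q → p ≡ q
  encode-injective (i , j , k) (i′ , j′ , k′) e with Finₚ.combine-injective i (combine j k) i′ (combine j′ k′) e
  ... | refl , q with Finₚ.combine-injective j k j′ k′ q
  ...   | refl , refl = refl

  changes : ∀ (f : ℤ → Fin 2) p → (∀ u → f (u + + p) ≡ other (f u)) → ∀ u {v} → u + + p ≡ v → f u ≢ f v
  changes f p law u refl e = other≢ (f u) (trans (sym (law u)) (sym e))

  chromatic-odd : ∀ a b c .{{_ : NonZero c}} → a % 2 ≡ 1 → b % 2 ≡ 1 → ChiLe a b c 8
  chromatic-odd a b c a-odd b-odd = bounds-chromatic (λ r _ → encode (code r)) proper
    where
    code : Root → Bits
    code (x , y , z) = parity x , parity y , bit c z

    along : ∀ ax r o r′ o′ → hi (cub a b c r o) ax ≡ lo (cub a b c r′ o′) ax → code r ≢ code r′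
    along ax-x (x , y , z) o₁ (x′ , y′ , z′) o′ eq e = changes parity a (parity-odd a-odd) x eq (cong proj₁ e)
    along ax-x (x , y , z) o₂ (x′ , y′ , z′) o′ eq e = changes parity b (parity-odd b-odd) x eq (cong proj₁ e)
    along ax-y (x , y , z) o₁ (x′ , y′ , z′) o′ eq e = changes parity b (parity-odd b-odd) y eq (cong (proj₁ ∘ proj₂) e)
    along ax-y (x , y , z) o₂ (x′ , y′ , z′) o′ eq e = changes parity a (parity-odd a-odd) y eq (cong (proj₁ ∘ proj₂) e)
    along ax-z (x , y , z) o₁ (x′ , y′ , z′) o′ eq e = changes (bit c) c (bit-+ c) z eq (cong (proj₂ ∘ proj₂) e)
    along ax-z (x , y , z) o₂ (x′ , y′ , z′) o′ eq e = changes (bit c) c (bit-+ c) z eq (cong (proj₂ ∘ proj₂) e)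

    proper : ProperColouring a b c (λ r _ → encode (code r))
    proper r o r′ o′ (ax , inj₁ eq , _) = along ax r o r′ o′ eq ∘ encode-injective (code r) (code r′)
    proper r o r′ o′ (ax , inj₂ eq , _) = along ax r′ o′ r o eq ∘ sym ∘ encode-injective (code r) (code r′)

  orientation : Orient → Fin 2
  orientation o₁ = 0F
  orientation o₂ = 1F

  -- The orientation is a fourth bit. It settles contacts between different orientations and leaves
  -- the three parities to those of equal orientation.
  chromatic-general : ∀ a b c .{{_ : NonZero a}} .{{_ : NonZero b}} .{{_ : NonZero c}} → ChiLe a b c 16
  chromatic-general a b c = bounds-chromatic κ proper
    where
    code : Orient → Root → Bits
    code o₁ (x , y , z) = bit a x , bit b y , bit c z
    code o₂ (x , y , z) = bit b x , bit a y , bit c z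

    κ : Root → Orient → Fin 16
    κ r o = combine (orientation o) (encode (code o r))

    along : ∀ ax r o r′ → hi (cub a b c r o) ax ≡ lo (cub a b c r′ o) ax → code o r ≢ code o r′
    along ax-x (x , y , z) o₁ (x′ , y′ , z′) eq e = changes (bit a) a (bit-+ a) x eq (cong proj₁ e)
    along ax-x (x , y , z) o₂ (x′ , y′ , z′) eq e = changes (bit b) b (bit-+ b) x eq (cong proj₁ e)
    along ax-y (x , y , z) o₁ (x′ , y′ , z′) eq e = changes (bit b) b (bit-+ b) y eq (cong (proj₁ ∘ proj₂) e)
    along ax-y (x , y , z) o₂ (x′ , y′ , z′) eq e = changes (bit a) a (bit-+ a) y eq (cong (proj₁ ∘ proj₂) e)
    along ax-z (x , y , z) o₁ (x′ , y′ , z′) eq e = changes (bit c) c (bit-+ c) z eq (cong (proj₂ ∘ proj₂) e)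
    along ax-z (x , y , z) o₂ (x′ , y′ , z′) eq e = changes (bit c) c (bit-+ c) z eq (cong (proj₂ ∘ proj₂) e)

    proper : ProperColouring a b c κ
    proper r o r′ o′ t e with Finₚ.combine-injective (orientation o) (encode (code o r)) (orientation o′) (encode (code o′ r′)) e
    proper r o₁ r′ o₁ (ax , inj₁ eq , _) _ | _ , p = along ax r o₁ r′ eq (encode-injective (code o₁ r) (code o₁ r′) p)
    proper r o₁ r′ o₁ (ax , inj₂ eq , _) _ | _ , p = along ax r′ o₁ r eq (sym (encode-injective (code o₁ r) (code o₁ r′) p))
    proper r o₂ r′ o₂ (ax , inj₁ eq , _) _ | _ , p = along ax r o₂ r′ eq (encode-injective (code o₂ r) (code o₂ r′) p)
    proper r o₂ r′ o₂ (ax , inj₂ eq , _) _ | _ , p = along ax r′ o₂ r eq (sym (encode-injective (code o₂ r) (code o₂ r′) p))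
    proper r o₁ r′ o₂ t _ | () , _
    proper r o₂ r′ o₁ t _ | () , _

open Universal

-- The cuboids [2,1,1]: a periodic colouring and its optimality

module Dominoes where

  open import Data.Integer using (ℤ; +_; -[1+_]; 0ℤ; 1ℤ; -1ℤ; _+_; _-_; _*_; -_; _≤_; _<_; +≤+; -≤-; +<+)

  _≟ᵃ_ : ∀ (p q : Axis) → Dec (p ≡ q)
  ax-x ≟ᵃ ax-x = yes refl
  ax-x ≟ᵃ ax-y = no λ ()
  ax-x ≟ᵃ ax-z = no λ ()
  ax-y ≟ᵃ ax-x = no λ ()
  ax-y ≟ᵃ ax-y = yes refl
  ax-y ≟ᵃ ax-z = no λ ()
  ax-z ≟ᵃ ax-x = no λ ()
  ax-z ≟ᵃ ax-y = no λ ()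
  ax-z ≟ᵃ ax-z = yes refl

  someAxis? : {P : Axis → Set} → (∀ ax → Dec (P ax)) → Dec (∃ P)
  someAxis? P? = map′ (λ { (inj₁ p) → ax-x , p ; (inj₂ (inj₁ p)) → ax-y , p ; (inj₂ (inj₂ p)) → ax-z , p })
                      (λ { (ax-x , p) → inj₁ p ; (ax-y , p) → inj₂ (inj₁ p) ; (ax-z , p) → inj₂ (inj₂ p) })
                      (P? ax-x ⊎-dec P? ax-y ⊎-dec P? ax-z)

  everyAxis? : {P : Axis → Set} → (∀ ax → Dec (P ax)) → Dec (∀ ax → P ax)
  everyAxis? P? = map′ (λ { (p , q , r) ax-x → p ; (p , q , r) ax-y → q ; (p , q , r) ax-z → r })
                       (λ f → f ax-x , f ax-y , f ax-z)
                       (P? ax-x ×-dec P? ax-y ×-dec P? ax-z)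

  faceContact? : ∀ A B → Dec (FaceContact A B)
  faceContact? A B = someAxis? λ ax →
    (hi A ax ℤₚ.≟ lo B ax ⊎-dec hi B ax ℤₚ.≟ lo A ax) ×-dec
    everyAxis? λ ax′ → ¬? (ax′ ≟ᵃ ax) →-dec
      ((lo A ax′ ℤₚ.<? hi B ax′) ×-dec (lo B ax′ ℤₚ.<? hi A ax′))

  interiorDisjoint? : ∀ A B → Dec (InteriorDisjoint A B)
  interiorDisjoint? A B = someAxis? λ ax → (hi A ax ℤₚ.≤? lo B ax) ⊎-dec (hi B ax ℤₚ.≤? lo A ax)

  touch? : ∀ A B → Dec (Touch A B)
  touch? A B = interiorDisjoint? A B ×-dec faceContact? A B

  domino : Root → Orient → Box
  domino = cub 2 1 1

  infixl 6 _⊝_ _⊞_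

  _⊞_ : Root → Root → Root
  (x , y , z) ⊞ (x′ , y′ , z′) = x + x′ , y + y′ , z + z′

  _⊝_ : Root → Root → Root
  (x , y , z) ⊝ (x′ , y′ , z′) = x - x′ , y - y′ , z - z′

  coord : Root → Axis → ℤ
  coord (x , y , z) ax-x = x
  coord (x , y , z) ax-y = y
  coord (x , y , z) ax-z = z

  size : Orient → Axis → ℤ
  size o ax = + len (domino (0ℤ , 0ℤ , 0ℤ) o) ax

  -- Contact seen from the first root: it depends only on the displacement, which reduces properness
  -- to finitely many cases.
  Meets : Orient → Orient → (Axis → ℤ) → Set
  Meets o o′ d = ∃ λ ax → (size o ax ≡ d ax ⊎ d ax + size o′ ax ≡ 0ℤ) ×
                          (∀ ax′ → ax′ ≢ ax → 0ℤ < d ax′ + size o′ ax′ × d ax′ < size o ax′)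

  meets? : ∀ o o′ d → Dec (Meets o o′ d)
  meets? o o′ d = someAxis? λ ax → (size o ax ℤₚ.≟ d ax ⊎-dec d ax + size o′ ax ℤₚ.≟ 0ℤ) ×-dec
    everyAxis? λ ax′ → ¬? (ax′ ≟ᵃ ax) →-dec
      (0ℤ ℤₚ.<? d ax′ + size o′ ax′ ×-dec d ax′ ℤₚ.<? size o ax′)

  -- The arithmetic is borrowed with dummy sides: along one axis, `X` carries a coordinate or
  -- displacement and `Y` a side length.
  open Semantics 1ℤ 1ℤ (+<+ (s≤s z≤n)) ℤₚ.≤-refl

  contact⇒meets : ∀ {r o r′ o′} → FaceContact (domino r o) (domino r′ o′) → Meets o o′ (coord (r′ ⊝ r))
  contact⇒meets {r} {o} {r′} {o′} (ax , touching , overlaps) = ax ,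
      prove (rs ax) (Y 0F ≡ᶠ X 2F ∨ᶠ X 2F ⊕ Y 1F ≡ᶠ ♯ 0ℤ)
        (flat ∷ X 0F ⊕ X 2F ≡ᶠ X 1F ∷ (X 0F ⊕ Y 0F ≡ᶠ X 1F ∨ᶠ X 1F ⊕ Y 1F ≡ᶠ X 0F) ∷ [])
        (is-flat ax ∷ displacement ax ∷ touching ∷ []) ,
      λ ax′ n → prove (rs ax′) (♯ 0ℤ <ᶠ X 2F ⊕ Y 1F ∧ᶠ X 2F <ᶠ Y 0F)
        (flat ∷ X 0F ⊕ X 2F ≡ᶠ X 1F ∷ (X 0F <ᶠ X 1F ⊕ Y 1F ∧ᶠ X 1F <ᶠ X 0F ⊕ Y 0F) ∷ [])
        (is-flat ax′ ∷ displacement ax′ ∷ overlaps ax′ n ∷ [])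
    where
    rs : Axis → Vec Pos 3
    rs ax = pos (lo (domino r o) ax) (size o ax) o₁ ∷ pos (lo (domino r′ o′) ax) (size o′ ax) o₁ ∷
            pos (coord (r′ ⊝ r) ax) 0ℤ o₁ ∷ []
    flat : Formula 3
    flat = is o₁ 0F ∧ᶠ is o₁ 1F ∧ᶠ is o₁ 2F
    is-flat : ∀ ax → ⟦ flat ⟧ (rs ax)
    is-flat _ = refl , refl , refl
    cancel : ∀ u v → u + (v - u) ≡ v
    cancel u v = trans (ℤₚ.+-comm u (v - u)) (trans (ℤₚ.+-assoc v (- u) u)
      (trans (cong (λ t → v + t) (ℤₚ.+-inverseˡ u)) (ℤₚ.+-identityʳ v)))
    displacement : ∀ ax → lo (domino r o) ax + coord (r′ ⊝ r) ax ≡ lo (domino r′ o′) ax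
    displacement ax-x = cancel (proj₁ r) (proj₁ r′)
    displacement ax-y = cancel (proj₁ (proj₂ r)) (proj₁ (proj₂ r′))
    displacement ax-z = cancel (proj₂ (proj₂ r)) (proj₂ (proj₂ r′))

  nearby : List ℤ
  nearby = -[1+ 1 ] ∷ -1ℤ ∷ 0ℤ ∷ 1ℤ ∷ + 2 ∷ []

  size-bounds : ∀ o ax → 0ℤ ≤ size o ax × size o ax ≤ + 2
  size-bounds o ax = +≤+ z≤n , +≤+ (len≤2 o ax)
    where
    len≤2 : ∀ o ax → len (domino (0ℤ , 0ℤ , 0ℤ) o) ax ℕ.≤ 2
    len≤2 o₁ ax-x = ℕₚ.≤-refl
    len≤2 o₁ ax-y = s≤s z≤n
    len≤2 o₁ ax-z = s≤s z≤n
    len≤2 o₂ ax-x = s≤s z≤n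
    len≤2 o₂ ax-y = ℕₚ.≤-refl
    len≤2 o₂ ax-z = s≤s z≤n

  within-nearby : ∀ d → -[1+ 1 ] ≤ d → d ≤ + 2 → d ∈ nearby
  within-nearby (+ 0)         _ _ = there (there (here refl))
  within-nearby (+ 1)         _ _ = there (there (there (here refl)))
  within-nearby (+ 2)         _ _ = there (there (there (there (here refl))))
  within-nearby (+ suc (suc (suc n))) _ (+≤+ (s≤s (s≤s ())))
  within-nearby -[1+ 0 ]      _ _ = there (here refl)
  within-nearby -[1+ 1 ]      _ _ = here refl
  within-nearby -[1+ suc (suc n) ] (-≤- (s≤s ())) _

  meets-nearby : ∀ {o o′ d} → Meets o o′ d → ∀ ax → d ax ∈ nearby
  meets-nearby {o} {o′} {d} (ax , touching , overlaps) ax′ =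
    let p , q = bounds in within-nearby (d ax′) p q
    where
    rs : Vec Pos 2
    rs = pos (d ax′) (size o ax′) o₁ ∷ pos 0ℤ (size o′ ax′) o₁ ∷ []
    sizes : Formula 2
    sizes = is o₁ 0F ∧ᶠ is o₁ 1F ∧ᶠ ♯ 0ℤ ≤ᶠ Y 0F ∧ᶠ Y 0F ≤ᶠ ♯ (+ 2) ∧ᶠ ♯ 0ℤ ≤ᶠ Y 1F ∧ᶠ Y 1F ≤ᶠ ♯ (+ 2)
    sizes-hold : ⟦ sizes ⟧ rs
    sizes-hold = let p , q = size-bounds o ax′ ; p′ , q′ = size-bounds o′ ax′ in refl , refl , p , q , p′ , q′
    goal : Formula 2
    goal = ♯ -[1+ 1 ] ≤ᶠ X 0F ∧ᶠ X 0F ≤ᶠ ♯ (+ 2)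
    bounds : ⟦ goal ⟧ rs
    bounds with ax′ ≟ᵃ ax
    ... | yes refl = prove rs goal (sizes ∷ (Y 0F ≡ᶠ X 0F ∨ᶠ X 0F ⊕ Y 1F ≡ᶠ ♯ 0ℤ) ∷ []) (sizes-hold ∷ touching ∷ [])
    ... | no n     = prove rs goal (sizes ∷ (♯ 0ℤ <ᶠ X 0F ⊕ Y 1F ∧ᶠ X 0F <ᶠ Y 0F) ∷ []) (sizes-hold ∷ overlaps ax′ n ∷ [])

  cycle cycle⁻¹ : Fin 10 → Fin 10
  cycle p   = lookup (1F ∷ 2F ∷ 3F ∷ 4F ∷ 5F ∷ 6F ∷ 7F ∷ 8F ∷ 9F ∷ 0F ∷ []) p
  cycle⁻¹ p = lookup (9F ∷ 0F ∷ 1F ∷ 2F ∷ 3F ∷ 4F ∷ 5F ∷ 6F ∷ 7F ∷ 8F ∷ []) p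

  cycle-cycle⁻¹ : ∀ p → cycle (cycle⁻¹ p) ≡ p
  cycle-cycle⁻¹ = toWitness {a? = Finₚ.all? λ p → cycle (cycle⁻¹ p) Fin.≟ p} tt

  cycle⁻¹-cycle : ∀ p → cycle⁻¹ (cycle p) ≡ p
  cycle⁻¹-cycle = toWitness {a? = Finₚ.all? λ p → cycle⁻¹ (cycle p) Fin.≟ p} tt

  open Orbit cycle cycle⁻¹ cycle-cycle⁻¹ cycle⁻¹-cycle 0F

  -- Found by computer search; so is the linear form below.
  palette : Orient → Fin 10 → Fin 5
  palette o₁ p = lookup (1F ∷ 2F ∷ 2F ∷ 4F ∷ 4F ∷ 3F ∷ 3F ∷ 0F ∷ 0F ∷ 1F ∷ []) p
  palette o₂ p = lookup (1F ∷ 0F ∷ 2F ∷ 1F ∷ 4F ∷ 2F ∷ 3F ∷ 4F ∷ 0F ∷ 3F ∷ []) p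

  linear : Root → ℤ
  linear (x , y , z) = x + (y * + 7 + z * + 5)

  dominoColour : Root → Orient → Fin 5
  dominoColour r o = palette o (phase (linear r))

  -- As no side exceeds 2, each coordinate of the displacement is between -2 and 2; evaluation goes
  -- through four pairs of orientations, 125 displacements and ten phases.
  palette-proper : ∀ {o o′ dx dy dz} → dx ∈ nearby → dy ∈ nearby → dz ∈ nearby →
                   Meets o o′ (coord (dx , dy , dz)) → ∀ p → palette o p ≢ palette o′ (shift (linear (dx , dy , dz)) p)
  palette-proper {o} {o′} i j k = All.lookup (All.lookup (All.lookup (table o o′) i) j) k
    where
    Good : Orient → Orient → Root → Set
    Good o o′ d = Meets o o′ (coord d) → ∀ p → palette o p ≢ palette o′ (shift (linear d) p)
    good? : ∀ o o′ d → Dec (Good o o′ d)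
    good? o o′ d = meets? o o′ (coord d) →-dec Finₚ.all? λ p → ¬? (palette o p Fin.≟ palette o′ (shift (linear d) p))
    Table : Orient → Orient → Set
    Table o o′ = All (λ dx → All (λ dy → All (λ dz → Good o o′ (dx , dy , dz)) nearby) nearby) nearby
    table? : ∀ o o′ → Dec (Table o o′)
    table? o o′ = all? (λ dx → all? (λ dy → all? (λ dz → good? o o′ (dx , dy , dz)) nearby) nearby) nearby
    table : ∀ o o′ → Table o o′
    table o₁ o₁ = toWitness {a? = table? o₁ o₁} tt
    table o₁ o₂ = toWitness {a? = table? o₁ o₂} tt
    table o₂ o₁ = toWitness {a? = table? o₂ o₁} tt
    table o₂ o₂ = toWitness {a? = table? o₂ o₂} tt

  linear-⊞ : ∀ u v → linear (u ⊞ v) ≡ linear u + linear v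
  linear-⊞ (x , y , z) (x′ , y′ , z′) =
    trans (cong (λ t → x + x′ + t)
            (trans (cong₂ _+_ (ℤₚ.*-distribʳ-+ (+ 7) y y′) (ℤₚ.*-distribʳ-+ (+ 5) z z′))
                   (interchange (y * + 7) (y′ * + 7) (z * + 5) (z′ * + 5))))
          (interchange x x′ (y * + 7 + z * + 5) (y′ * + 7 + z′ * + 5))

  ⊝-⊞ : ∀ r r′ → (r′ ⊝ r) ⊞ r ≡ r′
  ⊝-⊞ (x , y , z) (x′ , y′ , z′) = cong₂ _,_ (lem x x′) (cong₂ _,_ (lem y y′) (lem z z′))
    where
    lem : ∀ u v → v - u + u ≡ v
    lem u v = trans (ℤₚ.+-assoc v (- u) u) (trans (cong (λ t → v + t) (ℤₚ.+-inverseˡ u)) (ℤₚ.+-identityʳ v))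

  dominoColour-proper : ProperColouring 2 1 1 dominoColour
  dominoColour-proper r o r′ o′ t e =
    palette-proper (near ax-x) (near ax-y) (near ax-z) meeting (phase (linear r)) (trans e (cong (palette o′) moved))
    where
    meeting : Meets o o′ (coord (r′ ⊝ r))
    meeting = contact⇒meets {r} {o} {r′} {o′} t
    near : ∀ ax → coord (r′ ⊝ r) ax ∈ nearby
    near = meets-nearby {o} {o′} meeting
    moved : phase (linear r′) ≡ shift (linear (r′ ⊝ r)) (phase (linear r))
    moved = trans (cong (phase ∘ linear) (sym (⊝-⊞ r r′)))
      (trans (cong phase (linear-⊞ (r′ ⊝ r) r)) (shift-+ (linear (r′ ⊝ r)) (linear r) 0F))

  period : ∀ k → (∀ p → shift (linear k) p ≡ p) → ∀ r o → dominoColour (r ⊞ k) o ≡ dominoColour r o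
  period k trivial r o = cong (palette o)
    (trans (cong phase (trans (linear-⊞ r k) (ℤₚ.+-comm (linear r) (linear k))))
      (trans (shift-+ (linear k) (linear r) 0F) (trivial (phase (linear r)))))

  -- The form changes by 10, 70 and 10 along the three periods, all multiples of 10; the coefficient
  -- 5 is what allows period 2 in z.
  dominoColouring : PeriodicColoring 2 1 1 10 10 2 5
  dominoColouring = record
    { κ = dominoColour
    ; perX = λ x y z o → trans (cong (λ r → dominoColour r o) (cong₂ _,_ (refl {x = x + + 10}) (cong₂ _,_ (id+ y) (id+ z))))
                               (period (+ 10 , 0ℤ , 0ℤ) (full (+ 10) tt) (x , y , z) o)
    ; perY = λ x y z o → trans (cong (λ r → dominoColour r o) (cong₂ _,_ (id+ x) (cong₂ _,_ (refl {x = y + + 10}) (id+ z))))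
                               (period (0ℤ , + 10 , 0ℤ) (full (+ 70) tt) (x , y , z) o)
    ; perZ = λ x y z o → trans (cong (λ r → dominoColour r o) (cong₂ _,_ (id+ x) (cong₂ _,_ (id+ y) (refl {x = z + + 2}))))
                               (period (0ℤ , 0ℤ , + 2) (full (+ 10) tt) (x , y , z) o)
    ; proper = λ r o r′ o′ t → dominoColour-proper r o r′ o′ (proj₂ t)
    }
    where
    id+ : ∀ u → u ≡ u + 0ℤ
    id+ u = sym (ℤₚ.+-identityʳ u)
    full? : ∀ e → Dec (∀ p → shift e p ≡ p)
    full? e = Finₚ.all? λ p → shift e p Fin.≟ p
    full : ∀ e → True (full? e) → ∀ p → shift e p ≡ p
    full e = toWitness

  box : Brick → Box
  box (r , o) = domino r o

  -- Backtracking: every extension of the partial colouring to the listed bricks, taken in order, clashes.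
  clash? : ∀ (v : Brick) (c : Fin 4) w d → Dec (d ≡ c × Touch (box w) (box v))
  clash? v c w d = d Fin.≟ c ×-dec touch? (box w) (box v)

  clashes : Brick → Fin 4 → List (Brick × Fin 4) → Bool
  clashes v c []             = false
  clashes v c ((w , d) ∷ ds) = ⌊ clash? v c w d ⌋ ∨ clashes v c ds

  stuck : List Brick → List (Brick × Fin 4) → Bool
  stuck []       ds = false
  stuck (v ∷ vs) ds = dead 0F ∧ dead 1F ∧ dead 2F ∧ dead 3F
    where
    dead : Fin 4 → Bool
    dead c = clashes v c ds ∨ stuck vs ((v , c) ∷ ds)

  module _ (κ : Brick → Fin 4) (proper : ∀ v w → Touch (box v) (box w) → κ v ≢ κ w) where

    clashes-sound : ∀ v ds → All (λ (w , d) → κ w ≡ d) ds → ¬ T (clashes v (κ v) ds)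
    clashes-sound v ((w , d) ∷ ds) (p ∷ ps) t with Equivalence.to T-∨ t
    ... | inj₂ t′ = clashes-sound v ds ps t′
    ... | inj₁ t′ with toWitness {a? = clash? v (κ v) w d} t′
    ...   | q , touching = proper w v touching (trans p q)

    stuck-sound : ∀ vs ds → All (λ (w , d) → κ w ≡ d) ds → ¬ T (stuck vs ds)
    stuck-sound (v ∷ vs) ds ps t with Equivalence.to T-∨ (chosen (κ v) t)
      where
      dead : Fin 4 → Bool
      dead c = clashes v c ds ∨ stuck vs ((v , c) ∷ ds)
      chosen : ∀ c → T (dead 0F ∧ dead 1F ∧ dead 2F ∧ dead 3F) → T (dead c)
      chosen 0F t = proj₁ (Equivalence.to T-∧ t)
      chosen 1F t = proj₁ (Equivalence.to T-∧ (proj₂ (Equivalence.to (T-∧ {dead 0F}) t)))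
      chosen 2F t = proj₁ (Equivalence.to T-∧ (proj₂ (Equivalence.to (T-∧ {dead 1F}) (proj₂ (Equivalence.to (T-∧ {dead 0F}) t)))))
      chosen 3F t = proj₂ (Equivalence.to (T-∧ {dead 2F}) (proj₂ (Equivalence.to (T-∧ {dead 1F}) (proj₂ (Equivalence.to (T-∧ {dead 0F}) t)))))
    ... | inj₁ t′ = clashes-sound v ds ps t′
    ... | inj₂ t′ = stuck-sound vs ((v , κ v) ∷ ds) (refl ∷ ps) t′

  -- Found by computer search.  They are not a configuration: some of them intersect.
  bricks : List Brick
  bricks =
    ((+ 1 , + 1 , + 0) , o₂) ∷ ((+ 0 , + 2 , + 1) , o₁) ∷ ((+ 1 , + 0 , + 1) , o₂) ∷ ((+ 0 , + 1 , + 0) , o₂) ∷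
    ((+ 0 , + 1 , + 1) , o₁) ∷ ((+ 0 , + 0 , + 1) , o₂) ∷ ((+ 1 , + 2 , + 1) , o₂) ∷ ((+ 0 , + 2 , + 1) , o₂) ∷
    ((+ 0 , + 0 , + 0) , o₁) ∷ ((+ 1 , + 1 , + 0) , o₁) ∷ ((+ 2 , + 1 , + 1) , o₂) ∷ []

  -- Any smaller palette embeds into four colours, so a single search refutes every `n`.
  domino-lower : ∀ n → n ℕ.< 5 → ¬ PeriodicColoring 2 1 1 10 10 2 n
  domino-lower n n<5 colouring = stuck-sound (λ (r , o) → Fin.inject≤ (κ r o) n≤4)
      (λ (r , o) (r′ , o′) t e → proper r o r′ o′ t (Finₚ.inject≤-injective n≤4 n≤4 _ _ e)) bricks [] [] tt
    where
    open PeriodicColoring colouring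
    n≤4 : n ℕ.≤ 4
    n≤4 = ℕ.s≤s⁻¹ n<5

open Dominoes

-- Cuboids of height one, layer by layer

module Layered where

  open import Data.Integer using (ℤ; +_; 0ℤ; 1ℤ; _+_; _≤_; _<_; +<+; +≤+)

  level : Brick → ℤ
  level ((x , y , z) , o) = z

  -- long and short are the side lengths in decreasing order; turn exchanges the orientations if a < b.
  module Layers (a b : ℕ) (long short : ℤ) (0<short : 0ℤ < short) (short≤long : short ≤ long) (turn : Orient → Orient)
    (width-turn : ∀ r o → Semantics.width long short 0<short short≤long (turn o) ≡ + len (cub a b 1 r o) ax-x)
    (height-turn : ∀ r o → Semantics.height long short 0<short short≤long (turn o) ≡ + len (cub a b 1 r o) ax-y) where

    open Semantics long short 0<short short≤long
    open FourColours long short 0<short short≤long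
    open Chains long short 0<short short≤long {Pos} id using (Contact)

    brick : Brick → Box
    brick (r , o) = cub a b 1 r o

    place : Brick → Pos
    place ((x , y , z) , o) = pos x y (turn o)

    x⁺-place : ∀ c → x⁺ (place c) ≡ hi (brick c) ax-x
    x⁺-place (r@(x , y , z) , o) = cong (λ w → x + w) (width-turn r o)

    y⁺-place : ∀ c → y⁺ (place c) ≡ hi (brick c) ax-y
    y⁺-place (r@(x , y , z) , o) = cong (λ w → y + w) (height-turn r o)

    -- The two cases agree; matching on the orientation only makes the height compute to 1.
    higher : ∀ c d → hi (brick c) ax-z ≤ lo (brick d) ax-z → level c < level d
    higher ((x , y , z) , o₁) d p = ℤₚ.suc[i]≤j⇒i<j (subst (_≤ level d) (ℤₚ.+-comm z 1ℤ) p)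
    higher ((x , y , z) , o₂) d p = ℤₚ.suc[i]≤j⇒i<j (subst (_≤ level d) (ℤₚ.+-comm z 1ℤ) p)

    separated : ∀ c d → level c ≡ level d → InteriorDisjoint (brick c) (brick d) → Separated (place c) (place d)
    separated c d e (ax-x , inj₁ p) = inj₁ (subst (_≤ x (place d)) (sym (x⁺-place c)) p)
    separated c d e (ax-x , inj₂ p) = inj₂ (inj₁ (subst (_≤ x (place c)) (sym (x⁺-place d)) p))
    separated c d e (ax-y , inj₁ p) = inj₂ (inj₂ (inj₁ (subst (_≤ y (place d)) (sym (y⁺-place c)) p)))
    separated c d e (ax-y , inj₂ p) = inj₂ (inj₂ (inj₂ (subst (_≤ y (place c)) (sym (y⁺-place d)) p)))
    separated c d e (ax-z , inj₁ p) = ⊥-elim (ℤₚ.<-irrefl e (higher c d p))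
    separated c d e (ax-z , inj₂ p) = ⊥-elim (ℤₚ.<-irrefl (sym e) (higher d c p))

    -- Intervals of length 1 with integer ends overlap only if they coincide.
    same-level : ∀ c d → PosOverlap (brick c) (brick d) ax-z → level c ≡ level d
    same-level c d (p , q) = ℤₚ.≤-antisym (below-top c d p) (below-top d c q)
      where
      below-top : ∀ c d → lo (brick c) ax-z < hi (brick d) ax-z → level c ≤ level d
      below-top c d p with level d ℤₚ.<? level c
      ... | no d≮c  = ℤₚ.≮⇒≥ d≮c
      ... | yes d<c = ⊥-elim (ℤₚ.<⇒≱ p (top c d d<c))
        where
        top : ∀ c d → level d < level c → hi (brick d) ax-z ≤ lo (brick c) ax-z
        top c ((x , y , z) , o₁) q = subst (_≤ level c) (ℤₚ.+-comm 1ℤ z) (ℤₚ.i<j⇒suc[i]≤j q)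
        top c ((x , y , z) , o₂) q = subst (_≤ level c) (ℤₚ.+-comm 1ℤ z) (ℤₚ.i<j⇒suc[i]≤j q)

    overlap-x : ∀ c d → PosOverlap (brick c) (brick d) ax-x → x (place c) < x⁺ (place d) × x (place d) < x⁺ (place c)
    overlap-x c d (p , q) = subst (x (place c) <_) (sym (x⁺-place d)) p , subst (x (place d) <_) (sym (x⁺-place c)) q

    overlap-y : ∀ c d → PosOverlap (brick c) (brick d) ax-y → y (place c) < y⁺ (place d) × y (place d) < y⁺ (place c)
    overlap-y c d (p , q) = subst (y (place c) <_) (sym (y⁺-place d)) p , subst (y (place d) <_) (sym (y⁺-place c)) q

    layered : ∀ c d → FaceContact (brick c) (brick d) →
              (level c ≡ level d × Contact (place c) (place d)) ⊎ parity (level c) ≢ parity (level d)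
    layered c d (ax-x , inj₁ p , f) = inj₁ (same-level c d (f ax-z λ ()) ,
      inj₁ (trans (x⁺-place c) p , overlap-y c d (f ax-y λ ())))
    layered c d (ax-x , inj₂ p , f) = inj₁ (same-level c d (f ax-z λ ()) ,
      inj₂ (inj₁ (trans (x⁺-place d) p , swap (overlap-y c d (f ax-y λ ())))))
    layered c d (ax-y , inj₁ p , f) = inj₁ (same-level c d (f ax-z λ ()) ,
      inj₂ (inj₂ (inj₁ (trans (y⁺-place c) p , overlap-x c d (f ax-x λ ())))))
    layered c d (ax-y , inj₂ p , f) = inj₁ (same-level c d (f ax-z λ ()) ,
      inj₂ (inj₂ (inj₂ (trans (y⁺-place d) p , swap (overlap-x c d (f ax-x λ ()))))))
    layered c d (ax-z , inj₁ p , f) = inj₂ (stacked c d p)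
      where
      stacked : ∀ c d → hi (brick c) ax-z ≡ lo (brick d) ax-z → parity (level c) ≢ parity (level d)
      stacked ((x , y , z) , o₁) d p = changes parity 1 (parity-odd refl) z p
      stacked ((x , y , z) , o₂) d p = changes parity 1 (parity-odd refl) z p
    layered c d (ax-z , inj₂ p , f) = inj₂ (stacked d c p ∘ sym)
      where
      stacked : ∀ c d → hi (brick c) ax-z ≡ lo (brick d) ax-z → parity (level c) ≢ parity (level d)
      stacked ((x , y , z) , o₁) d p = changes parity 1 (parity-odd refl) z p
      stacked ((x , y , z) , o₂) d p = changes parity 1 (parity-odd refl) z p

    chromatic-layers : ChiLe a b 1 8
    chromatic-layers n cfg packed = colour , proper
      where
      layer : ℤ → List Pos
      layer z = map (place ∘ cfg) (filter (λ i → level (cfg i) ℤₚ.≟ z) (allFin n))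

      layer⁻ : ∀ {z p} → p ∈ layer z → ∃ λ i → level (cfg i) ≡ z × p ≡ place (cfg i)
      layer⁻ {z} p∈ with ∈-map⁻ (place ∘ cfg) p∈
      ... | i , i∈ , e = i , proj₂ (∈-filter⁻ (λ i → level (cfg i) ℤₚ.≟ z) {xs = allFin n} i∈) , e

      layer⁺ : ∀ {z} i → level (cfg i) ≡ z → place (cfg i) ∈ layer z
      layer⁺ {z} i e = ∈-map⁺ (place ∘ cfg) (∈-filter⁺ (λ i → level (cfg i) ℤₚ.≟ z) (∈-allFin i) e)

      layer-separated : ∀ z {p q} → p ∈ layer z → q ∈ layer z → p ≢ q → Separated p q
      layer-separated z p∈ q∈ p≢q with layer⁻ p∈ | layer⁻ q∈
      ... | i , ei , refl | j , ej , refl =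
        separated (cfg i) (cfg j) (trans ei (sym ej)) (packed i j λ { refl → p≢q refl })

      layerColouring : ∀ z → ∃ λ (κ : Pos → Colour) → ∀ {p q} → p ∈ layer z → q ∈ layer z → Contact p q → κ p ≢ κ q
      layerColouring z = packing-fourColourable (layer z) (layer-separated z)

      colour : Fin n → Fin 8
      colour i = combine (proj₁ (layerColouring (level (cfg i))) (place (cfg i))) (parity (level (cfg i)))

      proper : ∀ i j → Touch (brick (cfg i)) (brick (cfg j)) → colour i ≢ colour j
      proper i j (_ , contact) e with Finₚ.combine-injective _ _ _ _ e | layered (cfg i) (cfg j) contact
      ... | _ , q | inj₂ n = n q
      ... | p , _ | inj₁ (same , touching) =
        proj₂ (layerColouring (level (cfg i))) (layer⁺ i refl) (layer⁺ j (sym same)) touching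
          (trans p (cong (λ z → proj₁ (layerColouring z) (place (cfg j))) (sym same)))

  chromatic-flat : ∀ a b → 0 ℕ.< a → 0 ℕ.< b → ChiLe a b 1 8
  chromatic-flat a b 0<a 0<b with ℕₚ.≤-total b a
  ... | inj₁ b≤a = Layers.chromatic-layers a b (+ a) (+ b) (+<+ 0<b) (+≤+ b≤a) id
    (λ { r o₁ → refl ; r o₂ → refl }) (λ { r o₁ → refl ; r o₂ → refl })
  ... | inj₂ a≤b = Layers.chromatic-layers a b (+ b) (+ a) (+<+ 0<a) (+≤+ a≤b) flip
    (λ { r o₁ → refl ; r o₂ → refl }) (λ { r o₁ → refl ; r o₂ → refl })

open Layered

open import Data.Nat using (ℕ; _<_; _%_)

theorem4p3 : ((ChiLe 2 1 1 5 × P2Is 2 1 1 10 10 2 5)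
    × (∀ a b → 0 < a → 0 < b → ChiLe a b 1 8))
    × ((∀ a b c → 0 < a → 0 < b → 0 < c → a % 2 ≡ 1 → b % 2 ≡ 1 → ChiLe a b c 8)
    × (∀ a b c → 0 < a → 0 < b → 0 < c → ChiLe a b c 16))
theorem4p3 =
  ((bounds-chromatic dominoColour dominoColour-proper , dominoColouring , domino-lower) , chromatic-flat) ,
  (λ a b c _ _ 0<c → chromatic-odd a b c {{ℕ.>-nonZero 0<c}}) ,
  (λ a b c 0<a 0<b 0<c → chromatic-general a b c {{ℕ.>-nonZero 0<a}} {{ℕ.>-nonZero 0<b}} {{ℕ.>-nonZero 0<c}})
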